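{- For every integer $n\geq 2$, $$\min_{0\leq r\leq 4n-2}\left\{\binom{\lfloor (4n-1-r)/3\rfloor}{n}+r(4n-5)\right\}\leq \operatorname{GM}_3(K_{1,3}:nK_2)\leq (2n-1)!!,$$ where the minimum is over integers $r$.
   Context: All graphs are finite, simple and undirected; colorings are edge-colorings. $K_{1,3}$ is the star with three edges; $nK_2$ is a matching with $n$ edges. A $k$-coloring is exact if all $k$ colors are used at least once. A colored graph is rainbow if no two of its edges have the same color, and monochromatic if all its edges have the same color. Copies of a graph are counted as (not necessarily induced) subgraphs. $\binom{a}{b}=0$ if $0\le a<b$, and $(2n-1)!!=(2n-1)(2n-3)\cdots 3\cdot 1$. The Gallai-Ramsey number $\operatorname{gr}_k(G:H)$ is the minimum integer $m$ with $\binom{m}{2}\geq k$ such that for every $N\geq m$, every exact $k$-coloring of $K_N$ contains a rainbow copy of $G$ or a monochromatic copy of $H$. The Gallai-Ramsey multiplicity $\operatorname{GM}_k(G:H)$ (also written $\operatorname{GM}_k(G,H)$) is the minimum, over all exact $k$-colorings of $K_{\operatorname{gr}_k(G:H)}$, of the total number of rainbow copies of $G$ and monochromatic copies of $H$. -}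

module Defs where

open import Data.Bool.Properties using () renaming (_≟_ to _≟ᵇ_)
open import Data.Fin using (Fin; zero; quotient)
open import Data.Fin.Base using (finToFun)
open import Data.Fin.Properties using (_≟_; any?; all?)
open import Data.Fin.Subset using (Subset; _∈_)
open import Data.Fin.Subset.Properties using (_∈?_)
open import Data.List using (List; map; filter; deduplicate; length; allFin; upTo)
open import Data.List.Extrema.Nat using (min)
import Data.List.Membership.Propositional as List
open import Data.Nat using (ℕ; suc; _+_; _*_; _∸_; _^_; _/_; _≤_; _≥_)
open import Data.Nat.Combinatorics using (_C_)
open import Data.Product using (_×_; _,_; ∃-syntax)
open import Data.Product.Properties using () renaming (≡-dec to ×-≡-dec)
open import Data.Sum using (_⊎_; inj₁; inj₂)
open import Data.Vec using (Vec; lookup; tabulate)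
open import Data.Vec.Properties using () renaming (≡-dec to Vec-≡-dec)
open import Function using (_∘_)
open import Relation.Binary.Definitions using (DecidableEquality)
open import Relation.Binary.PropositionalEquality using (_≡_; _≢_; refl; sym)
open import Relation.Nullary using (¬_; Dec; does; ¬?; _×-dec_; _⊎-dec_; _→-dec_)
open import Relation.Unary using (Decidable)

record Graph : Set₁ where
  field
    order  : ℕ
    Adj    : Fin order → Fin order → Set
    adj?   : ∀ u v → Dec (Adj u v)
    symm   : ∀ {u v} → Adj u v → Adj v u
    irrefl : ∀ {u} → ¬ Adj u u

-- The hub is vertex zero.
K₁,₃ : Graph
K₁,₃ = record
  { order  = 4
  ; Adj    = λ u v → (u ≡ zero × v ≢ zero) ⊎ (u ≢ zero × v ≡ zero)
  ; adj?   = λ u v → ((u ≟ zero) ×-dec ¬? (v ≟ zero))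
                     ⊎-dec (¬? (u ≟ zero) ×-dec (v ≟ zero))
  ; symm   = λ { (inj₁ (p , q)) → inj₂ (q , p) ; (inj₂ (p , q)) → inj₁ (q , p) }
  ; irrefl = λ { (inj₁ (p , q)) → q p ; (inj₂ (p , q)) → p q }
  }

-- Vertices 2i and 2i+1 are matched: quotient 2 halves a vertex number,
-- rounding down.
_K₂ : ℕ → Graph
n K₂ = record
  { order  = n * 2
  ; Adj    = λ u v → half u ≡ half v × u ≢ v
  ; adj?   = λ u v → (half u ≟ half v) ×-dec ¬? (u ≟ v)
  ; symm   = λ (p , q) → sym p , q ∘ sym
  ; irrefl = λ (_ , q) → q refl
  }
  where
  half : Fin (n * 2) → Fin n
  half = quotient 2

-- The value of colour on the diagonal has no meaning; everything below only
-- looks at the colours of pairs of distinct vertices.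
record Colouring (k N : ℕ) : Set where
  field
    colour : Fin N → Fin N → Fin k
    symm   : ∀ i j → colour i j ≡ colour j i

open Colouring using (colour)

Exact : ∀ {k N} → Colouring k N → Set
Exact {k} c = ∀ (a : Fin k) → ∃[ i ] ∃[ j ] (i ≢ j × colour c i j ≡ a)

-- A subgraph of K_N is a vertex set together with the rows of an adjacency
-- matrix. Only the values of image below, which are genuine subgraphs, occur.
Subgraph : ℕ → Set
Subgraph N = Subset N × Vec (Subset N) N

EdgeOf : ∀ {N} → Subgraph N → Fin N → Fin N → Set
EdgeOf (_ , E) i j = j ∈ lookup E i

edgeOf? : ∀ {N} (S : Subgraph N) i j → Dec (EdgeOf S i j)
edgeOf? (_ , E) i j = j ∈? lookup E i

_≟ˢ_ : ∀ {N} → DecidableEquality (Subgraph N)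
_≟ˢ_ = ×-≡-dec (Vec-≡-dec _≟ᵇ_) (Vec-≡-dec (Vec-≡-dec _≟ᵇ_))

Injective : ∀ {m N} → (Fin m → Fin N) → Set
Injective f = ∀ u v → f u ≡ f v → u ≡ v

injective? : ∀ {m N} → Decidable (Injective {m} {N})
injective? f = all? λ u → all? λ v → (f u ≟ f v) →-dec (u ≟ v)

image : (G : Graph) → ∀ {N} → (Fin (Graph.order G) → Fin N) → Subgraph N
image G f =
  tabulate (λ i → does (any? λ u → f u ≟ i)) ,
  tabulate (λ i → tabulate (λ j →
    does (any? λ u → any? λ v → adj? u v ×-dec (f u ≟ i) ×-dec (f v ≟ j))))
  where open Graph G

-- finToFun lists every map from Fin m to Fin N exactly once.
allMaps : ∀ m N → List (Fin m → Fin N)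
allMaps m N = map finToFun (allFin (N ^ m))

-- The copies of G in K_N, each listed once: a subgraph is a copy of G when it
-- is the image of G under an injective map of vertices, and deduplication
-- removes the repetitions that come from the automorphisms of G.
copies : Graph → (N : ℕ) → List (Subgraph N)
copies G N =
  deduplicate _≟ˢ_ (map (image G) (filter injective? (allMaps (Graph.order G) N)))

module _ {k N : ℕ} (c : Colouring k N) where

  -- An edge occurs both as (i , j) and as (j , i).
  Rainbow : Subgraph N → Set
  Rainbow S = ∀ i j i′ j′ → EdgeOf S i j → EdgeOf S i′ j′ →
    colour c i j ≡ colour c i′ j′ → (i ≡ i′ × j ≡ j′) ⊎ (i ≡ j′ × j ≡ i′)

  Monochromatic : Subgraph N → Set
  Monochromatic S = ∀ i j i′ j′ → EdgeOf S i j → EdgeOf S i′ j′ →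
    colour c i j ≡ colour c i′ j′

  rainbow? : Decidable Rainbow
  rainbow? S = all? λ i → all? λ j → all? λ i′ → all? λ j′ →
    edgeOf? S i j →-dec (edgeOf? S i′ j′ →-dec ((colour c i j ≟ colour c i′ j′) →-dec
      (((i ≟ i′) ×-dec (j ≟ j′)) ⊎-dec ((i ≟ j′) ×-dec (j ≟ i′)))))

  monochromatic? : Decidable Monochromatic
  monochromatic? S = all? λ i → all? λ j → all? λ i′ → all? λ j′ →
    edgeOf? S i j →-dec (edgeOf? S i′ j′ →-dec (colour c i j ≟ colour c i′ j′))

  HasRainbow : Graph → Set
  HasRainbow G = ∃[ S ] (S List.∈ copies G N × Rainbow S)

  HasMonochromatic : Graph → Set
  HasMonochromatic H = ∃[ S ] (S List.∈ copies H N × Monochromatic S)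

  total : Graph → Graph → ℕ
  total G H = length (filter rainbow? (copies G N))
            + length (filter monochromatic? (copies H N))

IsLeast : (ℕ → Set) → ℕ → Set
IsLeast P m = P m × (∀ m′ → P m′ → m ≤ m′)

-- m is gr_k(G : H).
IsGR : ℕ → Graph → Graph → ℕ → Set
IsGR k G H = IsLeast λ m → m C 2 ≥ k ×
  (∀ N → N ≥ m → (c : Colouring k N) → Exact c → HasRainbow c G ⊎ HasMonochromatic c H)

-- v is GM_k(G : H). This includes the existence of gr_k(G : H).
IsGM : ℕ → Graph → Graph → ℕ → Set
IsGM k G H v = ∃[ m ] (IsGR k G H m ×
  IsLeast (λ t → ∃[ c ] (Exact {k} {m} c × total c G H ≡ t)) v)

-- The minimum of f r over 0 ≤ r ≤ m. The first argument of min only serves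
-- to make the minimum of an empty list meaningful.
minUpTo : ℕ → (ℕ → ℕ) → ℕ
minUpTo m f = min (f 0) (map f (upTo (suc m)))

-- Truncated subtraction agrees with the integer one for n ≥ 2 and r ≤ 4n - 2.
lowerBound : ℕ → ℕ
lowerBound n = minUpTo (4 * n ∸ 2) λ r →
  (((4 * n ∸ 1) ∸ r) / 3) C n + r * (4 * n ∸ 5)

infix 8 _!!
_!! : ℕ → ℕ
0 !!           = 1
1 !!           = 1
suc (suc n) !! = suc (suc n) * n !!

-- Here gr = N = 3n − 1. A vertex with colour degrees d₀, d₁, d₂ is the centre of
-- d₀d₁d₂ rainbow stars, so a colouring with few of them is nearly local: all but
-- a few vertices see at most two colours, and are sorted into three classes by a
-- colour they miss. Let C be the largest class, o its missing colour, and p, q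
-- the other two. Inside C only p and q occur. The vertices missing q are joined
-- to C completely in colour p, and a rainbow vertex of p-degree at least 2n − 1
-- always has a free p-neighbour; both kinds serve as "covers", each contributing
-- an edge to a p-matching, and likewise for q. If at most one further ("heavy")
-- vertex exists, the proof of the Ramsey theorem for matchings, which repeatedly
-- deletes a path with one edge of each colour, goes through inside C, and each
-- deletion or cover offers two choices, which gives about 2ⁿ monochromatic
-- matchings. Otherwise the heavy vertices together are centres of about 4n² rainbow
-- stars. Either quantity exceeds a suitable term of the minimum.
--
-- For the upper bounds, take parts A, B, C with |A| = n and |B| = n − 1; colour 0
-- lives on A ∪ B, colour 1 between A and C, and colour 2 on C and between B and C.
module Submission where

open import Defs
open import Data.Bool using (true)
open import Data.Empty using (⊥)
open import Data.Fin
  using (Fin; _↑ʳ_; _↑ˡ_; combine; finToFun; funToFin; inject≤; quotient; remQuot; remainder;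
    splitAt; suc; zero)
open import Data.Fin.Properties
  using (_≟_; all?; any?; combine-injective; combine-remQuot; finToFun-funToFin; injective⇒≤;
    inject≤-injective; remQuot-combine; splitAt-↑ʳ; splitAt-↑ˡ; splitAt⁻¹-↑ʳ; splitAt⁻¹-↑ˡ;
    ↑ʳ-injective; ↑ˡ-injective)
open import Data.List
  using (List; []; [_]; _++_; _∷_; allFin; concatMap; filter; length; map; take; upTo)
open import Data.List.Extrema.Nat using (min≤v⁺)
open import Data.List.Membership.DecPropositional using () renaming (_∈?_ to mem?)
open import Data.List.Membership.Propositional using (_∉_; lose) renaming (_∈_ to _∈ˡ_)
open import Data.List.Membership.Propositional.Properties
  using (∈-++⁺ʳ; ∈-++⁺ˡ; ∈-++⁻; ∈-allFin; ∈-concatMap⁺; ∈-deduplicate⁺; ∈-deduplicate⁻; ∈-filter⁺;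
    ∈-filter⁻; ∈-map⁺; ∈-map⁻; ∈-tabulate⁻; ∈-upTo⁺; ∈-∃++)
open import Data.List.Properties
  using (filter-none; filter-notAll; filter-≐; length-++; length-map; length-tabulate;
    length-take)
open import Data.List.Relation.Binary.Permutation.Propositional
  using (_↭_; ↭-prep; ↭-refl; ↭-swap; ↭-sym; ↭-trans; ↭⇒↭ₛ)
open import Data.List.Relation.Binary.Permutation.Propositional.Properties
  using (++-comm; ++-commutativeMonoid; ++⁺ʳ; ++⁺ˡ; shift; ↭-length; ∈-resp-↭)
open import Data.List.Relation.Binary.Subset.Propositional using (_⊆_)
open import Data.List.Relation.Unary.All as All using (All; []; _∷_)
open import Data.List.Relation.Unary.All.Properties as Allₚ using (¬Any⇒All¬)
open import Data.List.Relation.Unary.AllPairs using ([]; _∷_)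
open import Data.List.Relation.Unary.Any as Any using (here; there)
open import Data.List.Relation.Unary.Unique.Propositional using (Unique)
import Data.List.Relation.Unary.Unique.Propositional.Properties as Uniqueₚ
open import Data.Maybe using (Maybe; just; nothing)
open import Data.Maybe.Properties using () renaming (≡-dec to Maybe-≡-dec)
open import Data.Nat
  using (_!; _*_; _+_; _/_; _<_; _^_; _∸_; _≤?_; _≤_; _≥_; _⊓_; suc; s≤s; s≤s⁻¹; zero; z≤n; ℕ)
open import Data.Nat.Combinatorics
  using (nC1≡n; nCk+nC[k+1]≡[n+1]C[k+1]; nCk≡nC[n∸k]) renaming (_C_ to _choose_)
open import Data.Nat.DivMod using (+-distrib-/-∣ʳ; m*n/n≡m)
open import Data.Nat.Divisibility using (divides-refl)
open import Data.Nat.Properties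
  using (*-assoc; *-comm; *-distribʳ-+; *-distribˡ-+; *-identityʳ; *-identityˡ; *-mono-≤;
    *-monoʳ-≤; *-monoˡ-≤; +-assoc; +-cancelʳ-≡; +-cancelˡ-≡; +-cancelˡ-≤; +-comm; +-identityʳ;
    +-mono-<-≤; +-mono-≤; +-monoʳ-<; +-monoʳ-≤; +-monoˡ-≤; +-suc; 0∸n≡0; 1+n≰n; <⇒≤; <⇒≱;
    ^-distribˡ-+-*; ^-monoʳ-≤; m+[n∸m]≡n; m+n∸m≡n; m+n∸n≡m; m+n≡0⇒m≡0; m+n≡0⇒n≡0; m<n⇒m<1+n;
    m^n>0; module ≤-Reasoning; m∸n+n≡m; m∸n≤m; m≤m*n; m≤m+n; m≤n+m; m≤n+o⇒m∸n≤o; m≤n⇒m<n∨m≡n;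
    m≤n⇒m∸n≡0; m≤n⇒m⊓n≡m; m≤n⇒∃[o]m+o≡n; m≥n⇒m⊓n≡n; m⊓n≤n; n≤0⇒n≡0; n≤1+n; suc-injective;
    ∸-monoʳ-≤; ∸-monoˡ-≤; ≤-refl; ≤-reflexive; ≤-total; ≤-trans; ≮⇒≥; ≰⇒>) renaming (_≟_ to _≟ⁿ_)
open import Data.Nat.Tactic.RingSolver using (solve-∀)
open import Data.Product using (_,_; _×_; proj₁; proj₂; ∃-syntax)
open import Data.Sum using ([_,_]′; _⊎_; inj₁; inj₂) renaming (map to ⊎-map; swap to ⊎-swap)
open import Data.Vec using (Vec; []; _∷_; lookup; tabulate)
open import Data.Vec.Properties using ([]=⇒lookup; lookup⇒[]=; lookup∘tabulate; tabulate-cong)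
open import Function using (_∘_; case_of_; id; mk⇔)
open import Relation.Binary.PropositionalEquality
  using (_≡_; _≢_; cong; cong₂; module ≡-Reasoning; refl; setoid; subst; subst₂; sym; trans;
    ≢-sym)
open import Relation.Nullary using (Dec; _×-dec_; contradiction; does; no; yes; ¬?; ¬_)
open import Relation.Nullary.Decidable using (True; dec-true; does-⇔; map′; toWitness)
open import Relation.Unary using (Decidable)
import Data.List.Relation.Binary.Permutation.Setoid.Properties as Permₛ
import Data.List.Relation.Unary.Any.Properties as Anyₚ
import Data.List.Relation.Unary.Unique.DecPropositional.Properties as DecUnique

open Colouring using (colour)

-- There is no vertex to waste. By Cockayne and Lorimer, `kp + kq + max kp kq ∸ 1` vertices coloured
-- with `p` and `q` force `kp` disjoint edges of colour `p` or `kq` of colour `q`. Covers also take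
-- partners from `C`, so the number of all missing edges replaces the maximum, and without heavy
-- vertices `C` has exactly the resulting size. This is why every vertex outside `C` has to
-- contribute a cover, and why a vertex that may be no cover has to be paid for in stars. There is
-- also little to waste among the factors of two. The minimum is compared with its term at r = n -
-- 6, which is about 4n². At n = 10 this term is 151, while one rainbow vertex together with 2^(n-3)
-- matchings gives 26 + 128 = 154. Two halvings below 2^(n-1) are affordable there, a third is not:
-- one is spent on the last light vertex, one on a heavy vertex.

private variable
  A B : Set
  k k′ N : ℕ

-- Counting with lists of distinct elements

does⇒ : (a? : Dec A) → does a? ≡ true → A
does⇒ (yes a) _ = a

length-⊆ : {xs ys : List A} → Unique xs → xs ⊆ ys → length xs ≤ length ys
length-⊆ [] _ = z≤n
length-⊆ {xs = x ∷ xs} (x∉ ∷ u) sub with ∈-∃++ (sub (here refl))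
... | as , bs , refl = ≤-trans (s≤s (length-⊆ u sub′)) (≤-reflexive (sym (↭-length (shift x as bs))))
  where
  sub′ : xs ⊆ as ++ bs
  sub′ y∈ with ∈-resp-↭ (shift x as bs) (sub (there y∈))
  ... | here refl = contradiction refl (All.lookup x∉ y∈)
  ... | there z∈  = z∈

-- A lower bound on a count is carried by a list of distinct witnesses. Disjoint families then add
-- by concatenation, and the comparison with the list of all copies is left to the end, in
-- `many-filter`.
record Many {A : Set} (P : A → Set) (k : ℕ) : Set where
  constructor many
  field
    list   : List A
    unique : Unique list
    sound  : All P list
    large  : k ≤ length list

many-one : {P : A → Set} {x : A} → P x → Many P 1
many-one {x = x} px = many (x ∷ []) ([] ∷ []) (px ∷ []) ≤-refl

many-map : {P Q : A → Set} → (∀ {x} → P x → Q x) → k′ ≤ k → Many P k → Many Q k′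
many-map f k′≤k (many xs u s g) = many xs u (All.map f s) (≤-trans k′≤k g)

many-⊎ : {P Q : A → Set} → (∀ {x} → P x → Q x → ⊥) →
         Many P k → Many Q k′ → Many (λ x → P x ⊎ Q x) (k + k′)
many-⊎ disj (many xs u s g) (many ys u′ s′ g′) =
  many (xs ++ ys)
       (Uniqueₚ.++⁺ u u′ λ (x∈ , y∈) → disj (All.lookup s x∈) (All.lookup s′ y∈))
       (Allₚ.++⁺ (All.map inj₁ s) (All.map inj₂ s′))
       (≤-trans (+-mono-≤ g g′) (≤-reflexive (sym (length-++ xs))))

many-filter : {P : A → Set} {R : A → Set} (R? : ∀ x → Dec (R x)) {zs : List A} →
              (∀ {x} → P x → x ∈ˡ zs × R x) → Many P k → k ≤ length (filter R? zs)
many-filter R? f (many xs u s g) =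
  ≤-trans g (length-⊆ u λ x∈ → let z∈ , r = f (All.lookup s x∈) in ∈-filter⁺ R? z∈ r)

-- Copies of graphs

module _ (G : Graph) where
  open Graph G

  vertex? : (f : Fin order → Fin N) → ∀ i → Dec (∃[ u ] f u ≡ i)
  vertex? f i = any? λ u → f u ≟ i

  edge? : (f : Fin order → Fin N) → ∀ i j → Dec (∃[ u ] ∃[ v ] (Adj u v × f u ≡ i × f v ≡ j))
  edge? f i j = any? λ u → any? λ v → adj? u v ×-dec (f u ≟ i) ×-dec (f v ≟ j)

  -- Needed because `finToFun (funToFin f)` agrees with `f` only pointwise, while membership in
  -- `copies` is about equal images.
  image-cong : {f g : Fin order → Fin N} → (∀ u → f u ≡ g u) → image G f ≡ image G g
  image-cong {f = f} {g} f≗g = cong₂ _,_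
    (tabulate-cong λ i → does-⇔
      (mk⇔ (λ (u , p) → u , trans (sym (f≗g u)) p) (λ (u , p) → u , trans (f≗g u) p))
      (vertex? f i) (vertex? g i))
    (tabulate-cong λ i → tabulate-cong λ j → does-⇔
      (mk⇔ (λ (u , v , a , p , q) → u , v , a , trans (sym (f≗g u)) p , trans (sym (f≗g v)) q)
           (λ (u , v , a , p , q) → u , v , a , trans (f≗g u) p , trans (f≗g v) q))
      (edge? f i j) (edge? g i j))

  edge⁻ : (f : Fin order → Fin N) → ∀ {i j} → EdgeOf (image G f) i j →
          ∃[ u ] ∃[ v ] (Adj u v × f u ≡ i × f v ≡ j)
  edge⁻ f {i} {j} e = does⇒ (edge? f i j)
      (trans (sym (trans (cong (λ r → lookup r j) (lookup∘tabulate _ i))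
                                               (lookup∘tabulate _ j)))
                                  ([]=⇒lookup e))

  edge⁺ : (f : Fin order → Fin N) → ∀ {u v} → Adj u v → EdgeOf (image G f) (f u) (f v)
  edge⁺ f {u} {v} a = lookup⇒[]= (f v) _
    (trans (trans (cong (λ r → lookup r (f v)) (lookup∘tabulate _ (f u))) (lookup∘tabulate _ (f v)))
           (dec-true (edge? f (f u) (f v)) (u , v , a , refl , refl)))

  ∈copies⁺ : {f : Fin order → Fin N} → Injective f → image G f ∈ˡ copies G N
  ∈copies⁺ {N = N} {f} inj = ∈-deduplicate⁺ _≟ˢ_
    (subst (_∈ˡ map (image G) (filter injective? (allMaps order N))) (image-cong f′≗f)
      (∈-map⁺ (image G) (∈-filter⁺ injective? (∈-map⁺ finToFun (∈-allFin (funToFin f)))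
        λ u v e → inj u v (trans (sym (f′≗f u)) (trans e (f′≗f v))))))
    where
    f′≗f : ∀ u → finToFun (funToFin f) u ≡ f u
    f′≗f = finToFun-funToFin f

  ∈copies⁻ : ∀ {S} → S ∈ˡ copies G N →
             ∃[ f ] (Injective {order} {N} f × S ≡ image G f)
  ∈copies⁻ {N = N} S∈ with ∈-map⁻ (image G)
      (∈-deduplicate⁻ _≟ˢ_ (map (image G) (filter injective? (allMaps order N))) S∈)
  ... | f , f∈ , refl = f , proj₂ (∈-filter⁻ injective? {xs = allMaps order N} f∈) , refl

  copies-unique : Unique (copies G N)
  copies-unique = DecUnique.deduplicate-! _≟ˢ_ _

-- Matchings as lists of edges

half-pair : ∀ {n} (u v w : Fin (n * 2)) → quotient {n} 2 u ≡ quotient 2 v → u ≢ v →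
            quotient {n} 2 u ≡ quotient 2 w → u ≢ w → v ≡ w
half-pair {suc n} zero zero w p q r s = contradiction refl q
half-pair {suc n} zero (suc zero) zero p q r s = contradiction refl s
half-pair {suc n} zero (suc zero) (suc zero) p q r s = refl
half-pair {suc n} (suc zero) zero zero p q r s = refl
half-pair {suc n} (suc zero) zero (suc zero) p q r s = contradiction refl s
half-pair {suc n} (suc zero) (suc zero) w p q r s = contradiction refl q
half-pair {suc n} (suc (suc u)) (suc (suc v)) (suc (suc w)) p q r s =
  cong (λ w → Fin.suc (Fin.suc w))
      (half-pair {n} u v w (suc-inj p) (q ∘ cong (λ w → Fin.suc (Fin.suc w))) (suc-inj r)
      (s ∘ cong (λ w → Fin.suc (Fin.suc w))))
  where
  suc-inj : ∀ {a b : Fin n} → Fin.suc a ≡ suc b → a ≡ b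
  suc-inj refl = refl

matching : ∀ n {S} {v a b : Fin N} → S ∈ˡ copies (n K₂) N → EdgeOf S v a → EdgeOf S v b → a ≡ b
matching n S∈ va vb with ∈copies⁻ (n K₂) S∈
... | f , inj , refl with edge⁻ (n K₂) f va | edge⁻ (n K₂) f vb
... | u , w , (h , ne) , refl , refl | u′ , w′ , (h′ , ne′) , e , refl with inj u′ u e
... | refl = cong f (half-pair {n} u w w′ h ne h′ ne′)

-- The flattened order is that of the vertices of `n K₂`, so `endpoint` reads off an embedding, and
-- `Unique (ends es)` says that `es` is a matching.
ends : List (A × A) → List A
ends []             = []
ends ((a , b) ∷ es) = a ∷ b ∷ ends es

length-ends : (es : List (A × A)) → length (ends es) ≡ length es * 2
length-ends []       = refl
length-ends (_ ∷ es) = cong (λ m → ℕ.suc (ℕ.suc m)) (length-ends es)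

endpoint : (es : List (A × A)) → Fin (length es * 2) → A
endpoint ((a , b) ∷ es) zero          = a
endpoint ((a , b) ∷ es) (suc zero)    = b
endpoint ((a , b) ∷ es) (suc (suc u)) = endpoint es u

endpoint∈ : (es : List (A × A)) (u : Fin (length es * 2)) → endpoint es u ∈ˡ ends es
endpoint∈ (_ ∷ es) zero          = here refl
endpoint∈ (_ ∷ es) (suc zero)    = there (here refl)
endpoint∈ (_ ∷ es) (suc (suc u)) = there (there (endpoint∈ es u))

endpoint-injective : {es : List (A × A)} → Unique (ends es) →
                     ∀ u v → endpoint es u ≡ endpoint es v → u ≡ v
endpoint-injective {es = _ ∷ es} _ zero zero _ = refl
endpoint-injective {es = _ ∷ es} ((a≢b ∷ _) ∷ _) zero (suc zero) e = contradiction e a≢b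
endpoint-injective {es = _ ∷ es} ((_ ∷ a∉) ∷ _) zero (suc (suc v)) e =
    contradiction e (All.lookup a∉ (endpoint∈ es v))
endpoint-injective {es = _ ∷ es} ((a≢b ∷ _) ∷ _) (suc zero) zero e = contradiction (sym e) a≢b
endpoint-injective {es = _ ∷ es} _ (suc zero) (suc zero) _ = refl
endpoint-injective {es = _ ∷ es} (_ ∷ b∉ ∷ _) (suc zero) (suc (suc v)) e =
    contradiction e (All.lookup b∉ (endpoint∈ es v))
endpoint-injective {es = _ ∷ es} ((_ ∷ a∉) ∷ _) (suc (suc u)) zero e =
    contradiction (sym e) (All.lookup a∉ (endpoint∈ es u))
endpoint-injective {es = _ ∷ es} (_ ∷ b∉ ∷ _) (suc (suc u)) (suc zero) e =
    contradiction (sym e) (All.lookup b∉ (endpoint∈ es u))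
endpoint-injective {es = _ ∷ es} (_ ∷ _ ∷ un) (suc (suc u)) (suc (suc v)) e =
  cong (λ w → Fin.suc (Fin.suc w)) (endpoint-injective un u v e)

Fin-suc-injective : ∀ {n} {a b : Fin n} → Fin.suc a ≡ suc b → a ≡ b
Fin-suc-injective refl = refl

endpoint-edge⁻ : (es : List (A × A)) (u v : Fin (length es * 2)) →
  quotient {length es} 2 u ≡ quotient 2 v → u ≢ v →
  (endpoint es u , endpoint es v) ∈ˡ es ⊎ (endpoint es v , endpoint es u) ∈ˡ es
endpoint-edge⁻ (_ ∷ es) zero zero h ne = contradiction refl ne
endpoint-edge⁻ (_ ∷ es) zero (suc zero) h ne = inj₁ (here refl)
endpoint-edge⁻ (_ ∷ es) (suc zero) zero h ne = inj₂ (here refl)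
endpoint-edge⁻ (_ ∷ es) (suc zero) (suc zero) h ne = contradiction refl ne
endpoint-edge⁻ (_ ∷ es) (suc (suc u)) (suc (suc v)) h ne
  with endpoint-edge⁻ es u v (Fin-suc-injective h) (ne ∘ cong (λ w → Fin.suc (Fin.suc w)))
... | inj₁ m = inj₁ (there m)
... | inj₂ m = inj₂ (there m)

endpoint-edge⁺ : (es : List (A × A)) {a b : A} → (a , b) ∈ˡ es →
  ∃[ u ] ∃[ v ] (quotient {length es} 2 u ≡ quotient 2 v × u ≢ v × endpoint es u ≡ a × endpoint es v ≡ b)
endpoint-edge⁺ (_ ∷ es) (here refl) = zero , suc zero , refl , (λ ()) , refl , refl
endpoint-edge⁺ (_ ∷ es) (there m) with endpoint-edge⁺ es m
... | u , v , h , ne , p , q =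
  suc (suc u) , suc (suc v) , cong suc h , ne ∘ (λ { refl → refl }) , p , q

module _ {k N : ℕ} (c : Colouring k N) where

  record Good (n : ℕ) (es : List (Fin N × Fin N)) (S : Subgraph N) : Set where
    constructor good
    field
      copy  : S ∈ˡ copies (n K₂) N
      mono  : Monochromatic c S
      edges : ∀ {a b} → (a , b) ∈ˡ es → EdgeOf S a b

  ColouredBy : Fin k → List (Fin N × Fin N) → Set
  ColouredBy i = All λ (a , b) → colour c a b ≡ i

  matching-good : ∀ {i n es} → ColouredBy i es → Unique (ends es) → length es ≡ n → Many (Good n es) 1
  matching-good {i} {es = es} col un refl = many-one {x = image (length es K₂) (endpoint es)} (good
    (∈copies⁺ (length es K₂) (endpoint-injective un))
    (λ a b a′ b′ e e′ → trans (colour-edge e) (sym (colour-edge e′)))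
    λ m → edge m)
    where
    f = endpoint es
    colour-edge : ∀ {a b} → EdgeOf (image (length es K₂) f) a b → colour c a b ≡ i
    colour-edge e with edge⁻ (length es K₂) f e
    ... | u , v , (h , ne) , refl , refl with endpoint-edge⁻ es u v h ne
    ... | inj₁ m = All.lookup col m
    ... | inj₂ m = trans (Colouring.symm c _ _) (All.lookup col m)
    edge : ∀ {a b} → (a , b) ∈ˡ es → EdgeOf (image (length es K₂) f) a b
    edge m with endpoint-edge⁺ es m
    ... | u , v , h , ne , refl , refl = edge⁺ (length es K₂) f {u} {v} (h , ne)

  good-⊆ : ∀ {n es fs S} → (∀ {e} → e ∈ˡ fs → e ∈ˡ es) → Good n es S → Good n fs S
  good-⊆ sub (good cp m e) = good cp m (e ∘ sub)

  -- No matching contains both `va` and `vb`. Branching on the partner of `v` therefore gives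
  -- disjoint families of copies, and this is the source of all factors of two.
  good-disjoint : ∀ {n es fs v a b S} → a ≢ b → (v , a) ∈ˡ es → (v , b) ∈ˡ fs →
                  Good n es S → Good n fs S → ⊥
  good-disjoint {n} a≢b va vb (good cp _ e) (good _ _ e′) = a≢b (matching n cp (e va) (e′ vb))

-- Counting rainbow stars

-- The second hypothesis makes the index a function of the witness, so families over distinct
-- indices are disjoint.
many-Σ : ∀ {A B : Set} {k} {xs : List A} {P : A → B → Set} → Unique xs →
         (∀ {x y b} → P x b → P y b → x ≡ y) →
         (∀ {x} → x ∈ˡ xs → Many (P x) k) →
         Many (λ b → ∃[ x ] (x ∈ˡ xs × P x b)) (length xs * k)
many-Σ [] inj f = many [] [] [] z≤n
many-Σ (x∉ ∷ u) inj f = many-map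
  (λ { (inj₁ p) → _ , here refl , p ; (inj₂ (y , y∈ , p)) → y , there y∈ , p }) ≤-refl
  (many-⊎ (λ { p (y , y∈ , q) → All.lookup x∉ y∈ (inj p q) }) (f (here refl)) (many-Σ u inj (f ∘ there)))

module _ (c : Colouring 3 N) where

  nbrs : Fin 3 → Fin N → List (Fin N)
  nbrs i v = filter (λ u → (colour c v u ≟ i) ×-dec ¬? (u ≟ v)) (allFin N)

  degree : Fin 3 → Fin N → ℕ
  degree i v = length (nbrs i v)

  ∈nbrs⁺ : ∀ {i v u} → colour c v u ≡ i → u ≢ v → u ∈ˡ nbrs i v
  ∈nbrs⁺ e ne = ∈-filter⁺ _ (∈-allFin _) (e , ne)

  ∈nbrs⁻ : ∀ {i v u} → u ∈ˡ nbrs i v → colour c v u ≡ i × u ≢ v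
  ∈nbrs⁻ {i} {v} u∈ = proj₂ (∈-filter⁻ (λ u → (colour c v u ≟ i) ×-dec ¬? (u ≟ v)) {xs = allFin N} u∈)

  nbrs-unique : ∀ {i v} → Unique (nbrs i v)
  nbrs-unique = Uniqueₚ.filter⁺ _ (Uniqueₚ.allFin⁺ N)

  private
    star : Fin N → (Fin 3 → Fin N) → Fin 4 → Fin N
    star v l zero    = v
    star v l (suc i) = l i

  -- The leaf `l i` is the one joined in colour `i`. Indexing the leaves by colour removes the six
  -- symmetries of the star: a rainbow star determines `l`, so choices of leaves count copies
  -- directly.
  record Star (v : Fin N) (l : Fin 3 → Fin N) (S : Subgraph N) : Set where
    constructor mkStar
    field
      leaf : ∀ i → l i ∈ˡ nbrs i v
      isImage : S ≡ image K₁,₃ (star v l)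

  private
    leaf-injective : ∀ {v l S} → Star v l S → ∀ i j → l i ≡ l j → i ≡ j
    leaf-injective st i j e = trans (sym (proj₁ (∈nbrs⁻ (Star.leaf st i))))
      (trans (cong (colour c _) e) (proj₁ (∈nbrs⁻ (Star.leaf st j))))

    star-edge⁻ : ∀ {v l S x y} → Star v l S → EdgeOf S x y →
                 (x ≡ v × ∃[ i ] y ≡ l i) ⊎ (y ≡ v × ∃[ i ] x ≡ l i)
    star-edge⁻ {v} {l} (mkStar _ refl) e with edge⁻ K₁,₃ (star v l) e
    ... | zero , zero , inj₁ (_ , q) , _ = contradiction refl q
    ... | zero , zero , inj₂ (q , _) , _ = contradiction refl q
    ... | zero , suc i , _ , refl , refl = inj₁ (refl , i , refl)
    ... | suc i , zero , _ , refl , refl = inj₂ (refl , i , refl)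
    ... | suc i , suc j , inj₁ (() , _) , _
    ... | suc i , suc j , inj₂ (_ , ()) , _

    star-edge⁺ : ∀ {v l S} → Star v l S → ∀ i → EdgeOf S v (l i)
    star-edge⁺ {v} {l} (mkStar _ refl) i = edge⁺ K₁,₃ (star v l) {zero} {suc i} (inj₁ (refl , λ ()))

    -- If `v` were a leaf of the second star, both `l zero` and `l (suc zero)` would be its hub, but
    -- they are distinct.
    hub-unique : ∀ {v l v′ l′ S} → Star v l S → Star v′ l′ S → v ≡ v′
    hub-unique {v} {l} {v′} {l′} st st′
      with star-edge⁻ st′ (star-edge⁺ st zero) | star-edge⁻ st′ (star-edge⁺ st (suc zero))
    ... | inj₁ (e , _) | _ = e
    ... | inj₂ _ | inj₁ (e , _) = e
    ... | inj₂ (e , _) | inj₂ (e′ , _) with leaf-injective st zero (suc zero) (trans e (sym e′))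
    ... | ()

    leaf-unique : ∀ {v l l′ S} → Star v l S → Star v l′ S → ∀ i → l i ≡ l′ i
    leaf-unique {v} {l} {l′} st st′ i with star-edge⁻ st′ (star-edge⁺ st i)
    ... | inj₂ (e , _) = contradiction e (proj₂ (∈nbrs⁻ (Star.leaf st i)))
    ... | inj₁ (_ , j , e) = trans e (cong l′ (trans (sym (proj₁ (∈nbrs⁻ (Star.leaf st′ j))))
                              (trans (cong (colour c v) (sym e)) (proj₁ (∈nbrs⁻ (Star.leaf st i))))))

    star-copy : ∀ {v l S} → Star v l S → S ∈ˡ copies K₁,₃ N
    star-copy {v} {l} st@(mkStar lf refl) = ∈copies⁺ K₁,₃ inj
      where
      inj : Injective (star v l)
      inj zero zero _ = refl
      inj zero (suc j) e = contradiction (sym e) (proj₂ (∈nbrs⁻ (lf j)))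
      inj (suc i) zero e = contradiction e (proj₂ (∈nbrs⁻ (lf i)))
      inj (suc i) (suc j) e = cong suc (leaf-injective st i j e)

    star-rainbow : ∀ {v l S} → Star v l S → Rainbow c S
    star-rainbow {v} {l} st x y x′ y′ e e′ eq with star-edge⁻ st e | star-edge⁻ st e′
    ... | inj₁ (refl , i , refl) | inj₁ (refl , j , refl) =
      inj₁ (refl , cong l (trans (sym (col i)) (trans eq (col j))))
      where col = λ i → proj₁ (∈nbrs⁻ (Star.leaf st i))
    ... | inj₁ (refl , i , refl) | inj₂ (refl , j , refl) =
      inj₂ (refl , cong l (trans (sym (col i)) (trans eq (trans (Colouring.symm c _ _) (col j)))))
      where col = λ i → proj₁ (∈nbrs⁻ (Star.leaf st i))
    ... | inj₂ (refl , i , refl) | inj₁ (refl , j , refl) =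
      inj₂ (cong l (trans (sym (col i)) (trans (Colouring.symm c _ _) (trans eq (col j)))) , refl)
      where col = λ i → proj₁ (∈nbrs⁻ (Star.leaf st i))
    ... | inj₂ (refl , i , refl) | inj₂ (refl , j , refl) =
      inj₁ (cong l (trans (sym (col i))
          (trans (Colouring.symm c _ _) (trans eq (trans (Colouring.symm c _ _) (col j))))) , refl)
      where col = λ i → proj₁ (∈nbrs⁻ (Star.leaf st i))

    leaves : Fin N → Fin N → Fin N → Fin 3 → Fin N
    leaves x y z zero             = x
    leaves x y z (suc zero)       = y
    leaves x y z (suc (suc zero)) = z

  stars-at : ∀ v → Many (λ S → ∃[ l ] Star v l S)
                   (degree zero v * (degree (suc zero) v * degree (suc (suc zero)) v))
  stars-at v = many-map (λ { (x , _ , y , _ , z , _ , st) → leaves x y z , st })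
    (≤-reflexive (cong (λ d → degree zero v * (degree (suc zero) v * d)) (sym (*-identityʳ _))))
    (many-Σ nbrs-unique (λ { (y , _ , z , _ , st) (_ , _ , _ , _ , st′) → leaf-unique st st′ zero })
        λ {x} x∈ →
     many-Σ nbrs-unique (λ { (z , _ , st) (_ , _ , st′) → leaf-unique st st′ (suc zero) }) λ {y} y∈ →
     many-Σ {P = λ z → Star v (leaves x y z)} nbrs-unique
         (λ st st′ → leaf-unique st st′ (suc (suc zero))) λ {z} z∈ →
     many-one (mkStar (λ { zero → x∈ ; (suc zero) → y∈ ; (suc (suc zero)) → z∈ }) refl))

  rainbow-stars : ∀ {K vs} → Unique vs →
    (∀ {v} → v ∈ˡ vs → K ≤ degree zero v * (degree (suc zero) v * degree (suc (suc zero)) v)) →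
    length vs * K ≤ length (filter (rainbow? c) (copies K₁,₃ N))
  rainbow-stars u f = many-filter (rainbow? c)
    (λ { (v , _ , l , st) → star-copy st , star-rainbow st })
    (many-Σ u (λ { (_ , st) (_ , st′) → hub-unique st st′ }) λ v∈ → many-map id (f v∈) (stars-at _))

-- Permutations of lists of distinct elements

Unique-resp-↭ : {xs ys : List A} → xs ↭ ys → Unique xs → Unique ys
Unique-resp-↭ p = Permₛ.Unique-resp-↭ (setoid _) (↭⇒↭ₛ p)

Unique-++⁻ʳ : (xs : List A) {ys : List A} → Unique (xs ++ ys) → Unique ys
Unique-++⁻ʳ []       u       = u
Unique-++⁻ʳ (_ ∷ xs) (_ ∷ u) = Unique-++⁻ʳ xs u

Unique-++⁻ˡ : (xs : List A) {ys : List A} → Unique (xs ++ ys) → Unique xs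
Unique-++⁻ˡ xs {ys} u = Unique-++⁻ʳ ys (Unique-resp-↭ (++-comm xs ys) u)

extract : ∀ xs {ys : List A} → Unique xs → xs ⊆ ys → ∃[ zs ] ys ↭ xs ++ zs
extract [] u sub = _ , ↭-refl
extract (x ∷ xs) (x∉ ∷ u) sub with ∈-∃++ (sub (here refl))
... | as , bs , refl with extract xs {as ++ bs} u sub′
  where
  sub′ : xs ⊆ as ++ bs
  sub′ y∈ with ∈-resp-↭ (shift x as bs) (sub (there y∈))
  ... | here refl = contradiction refl (All.lookup x∉ y∈)
  ... | there z∈  = z∈
... | zs , p = zs , ↭-trans (shift x as bs) (↭-prep x p)

length-filter-¬ : ∀ {P : A → Set} (P? : Decidable P) xs →
                  length xs ≡ length (filter P? xs) + length (filter (¬? ∘ P?) xs)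
length-filter-¬ P? [] = refl
length-filter-¬ P? (x ∷ xs) with P? x
... | yes _ = cong suc (length-filter-¬ P? xs)
... | no  _ = trans (cong suc (length-filter-¬ P? xs)) (sym (+-suc _ _))

length-filter-∉ : ∀ {xs} us → Unique xs →
  length xs ≤ length us + length (filter (λ x → ¬? (mem? (_≟_ {N}) x us)) xs)
length-filter-∉ {xs = xs} us u =
  ≤-trans (≤-reflexive (length-filter-¬ (λ x → mem? _≟_ x us) xs))
          (+-monoˡ-≤ _ (length-⊆ (Uniqueₚ.filter⁺ _ u) λ x∈ →
             proj₂ (∈-filter⁻ (λ x → mem? _≟_ x us) {xs = xs} x∈)))

-- Cliques in two colours

module TwoColours (c : Colouring 3 N) {C : List (Fin N)} (C! : Unique C) where

  Two : Fin 3 → Fin 3 → Set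
  Two p q = ∀ {x y} → x ∈ˡ C → y ∈ˡ C → x ≢ y → colour c x y ≡ p ⊎ colour c x y ≡ q

  -- Each case is a move of `core-reduce`. At a pivot either of the paths x-v-y and x′-v-y′ can be
  -- deleted; a vertex joined to the rest in one colour becomes a cover; twins become two covers,
  -- whatever the colour of the edge between them.
  data Reducible (p q : Fin 3) : Set where
    pivot : ∀ {v x x′ y y′ R} → C ↭ v ∷ x ∷ x′ ∷ y ∷ y′ ∷ R →
            colour c v x ≡ p → colour c v x′ ≡ p → colour c v y ≡ q → colour c v y′ ≡ q → Reducible p q
    exact : ∀ {v R} → C ↭ v ∷ R → (∀ {u} → u ∈ˡ R → colour c v u ≡ p) → Reducible p q
    twin  : ∀ {v w R} → C ↭ v ∷ w ∷ R → (∀ {u} → u ∈ˡ R → colour c v u ≡ p) →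
            (∀ {u} → u ∈ˡ R → colour c w u ≡ p) → Reducible p q
    flip  : Reducible q p → Reducible p q

  private
    symm = Colouring.symm c

    data Neighbours (i : Fin 3) (v : Fin N) : Set where
      none : (∀ {u} → u ∈ˡ C → u ≢ v → colour c v u ≢ i) → Neighbours i v
      one  : ∀ y → y ∈ˡ C → y ≢ v → colour c v y ≡ i →
             (∀ {u} → u ∈ˡ C → u ≢ v → u ≢ y → colour c v u ≢ i) → Neighbours i v
      two  : ∀ {y y′} → y ∈ˡ C → y′ ∈ˡ C → y ≢ v → y′ ≢ v → y ≢ y′ →
             colour c v y ≡ i → colour c v y′ ≡ i → Neighbours i v

    neighbours : ∀ i v → Neighbours i v
    neighbours i v = go (filter near? C) refl
      where
      near? : Decidable (λ u → colour c v u ≡ i × u ≢ v)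
      near? u = (colour c v u ≟ i) ×-dec ¬? (u ≟ v)
      mem : ∀ {u L} → filter near? C ≡ L → u ∈ˡ L → u ∈ˡ C × colour c v u ≡ i × u ≢ v
      mem refl u∈ = ∈-filter⁻ near? u∈
      go : ∀ L → filter near? C ≡ L → Neighbours i v
      go [] e = none λ u∈ ne eq → contradiction (subst (_ ∈ˡ_) e (∈-filter⁺ near? u∈ (eq , ne))) λ ()
      go (y ∷ []) e = let y∈ , eq , ne = mem e (here refl) in
        one y y∈ ne eq λ u∈ ne′ ne″ eq′ → case (subst (_ ∈ˡ_) e (∈-filter⁺ near? u∈ (eq′ , ne′))) ne″
        where
        case : ∀ {u} → u ∈ˡ y ∷ [] → u ≢ y → ⊥
        case (here refl) ne = ne refl
      go (y ∷ y′ ∷ L) e with subst Unique e (Uniqueₚ.filter⁺ near? C!)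
      ... | (y≢y′ ∷ _) ∷ _ =
        let y∈ , eq , ne = mem e (here refl); y′∈ , eq′ , ne′ = mem e (there (here refl)) in
        two y∈ y′∈ ne ne′ y≢y′ eq eq′

  module _ {p q : Fin 3} (p≢q : p ≢ q) (col : Two p q) where

    private
      not-q : ∀ {x y} → x ∈ˡ C → y ∈ˡ C → y ≢ x → colour c x y ≢ q → colour c x y ≡ p
      not-q x∈ y∈ ne nq with col x∈ y∈ (≢-sym ne)
      ... | inj₁ e = e
      ... | inj₂ e = contradiction e nq

      apart : ∀ {v x y} → colour c v x ≡ p → colour c v y ≡ q → x ≢ y
      apart e e′ refl = p≢q (trans (sym e) e′)

    mkPivot : ∀ {v x x′ y y′} → v ∈ˡ C → x ∈ˡ C → x′ ∈ˡ C → y ∈ˡ C → y′ ∈ˡ C →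
              x ≢ v → x′ ≢ v → y ≢ v → y′ ≢ v → x ≢ x′ → y ≢ y′ →
              colour c v x ≡ p → colour c v x′ ≡ p → colour c v y ≡ q → colour c v y′ ≡ q → Reducible p q
    mkPivot {v} {x} {x′} {y} {y′} v∈ x∈ x′∈ y∈ y′∈ xv x′v yv y′v xx yy a a′ b b′ = pivot
      (proj₂ (extract (v ∷ x ∷ x′ ∷ y ∷ y′ ∷ [])
        ((≢-sym xv ∷ ≢-sym x′v ∷ ≢-sym yv ∷ ≢-sym y′v ∷ []) ∷ (xx ∷ apart a b ∷ apart a b′ ∷ []) ∷
         (apart a′ b ∷ apart a′ b′ ∷ []) ∷ (yy ∷ []) ∷ [] ∷ [])
        (All.lookup (v∈ ∷ x∈ ∷ x′∈ ∷ y∈ ∷ y′∈ ∷ []))))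
      a a′ b b′

    mkExact : ∀ {v} → v ∈ˡ C → (∀ {u} → u ∈ˡ C → u ≢ v → colour c v u ≢ q) → Reducible p q
    mkExact {v} v∈ no-q with extract (v ∷ []) ([] ∷ []) (All.lookup (v∈ ∷ []))
    ... | R , perm with Unique-resp-↭ perm C!
    ... | v∉ ∷ _ = exact perm λ u∈ →
      let u∈C = ∈-resp-↭ (↭-sym perm) (there u∈); u≢v = ≢-sym (All.lookup v∉ u∈) in
      not-q v∈ u∈C u≢v (no-q u∈C u≢v)

    mkTwin : ∀ {v w} → v ∈ˡ C → w ∈ˡ C → w ≢ v →
             (∀ {u} → u ∈ˡ C → u ≢ v → u ≢ w → colour c v u ≢ q) →
             (∀ {u} → u ∈ˡ C → u ≢ w → u ≢ v → colour c w u ≢ q) → Reducible p q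
    mkTwin {v} {w} v∈ w∈ w≢v f g
      with extract (v ∷ w ∷ []) ((≢-sym w≢v ∷ []) ∷ [] ∷ []) (All.lookup (v∈ ∷ w∈ ∷ []))
    ... | R , perm with Unique-resp-↭ perm C!
    ... | (_ ∷ v∉) ∷ w∉ ∷ _ = twin perm
      (λ u∈ → let u∈C = ∈-resp-↭ (↭-sym perm) (there (there u∈)); u≢v = ≢-sym (All.lookup v∉ u∈) in
              not-q v∈ u∈C u≢v (f u∈C u≢v (≢-sym (All.lookup w∉ u∈))))
      (λ u∈ → let u∈C = ∈-resp-↭ (↭-sym perm) (there (there u∈)); u≢w = ≢-sym (All.lookup w∉ u∈) in
              not-q w∈ u∈C u≢w (g u∈C u≢w (≢-sym (All.lookup v∉ u∈))))

  swap-two : ∀ {p q} → Two p q → Two q p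
  swap-two col x∈ y∈ ne = ⊎-swap (col x∈ y∈ ne)

  module _ (large : 5 ≤ length C) where

    -- Following vertices with a single neighbour in some colour either ends in a reduction or
    -- forces v-y-w-z to be a path in `q` and w-v-z-y a path in `p`. A `K₄` split in this way is
    -- irreducible, whence the five vertices of `large`: a fifth vertex `u` sees `v` and `z` in `p`,
    -- `y` and `w` in `q`, and is a pivot.
    reduce₁ : ∀ {p q} → p ≢ q → Two p q → ∀ {v y} → v ∈ˡ C → y ∈ˡ C → y ≢ v → colour c v y ≡ q →
              (∀ {u} → u ∈ˡ C → u ≢ v → u ≢ y → colour c v u ≢ q) → Reducible p q
    reduce₁ {p} {q} p≢q col {v} {y} v∈ y∈ y≢v vy v-only with neighbours q y
    ... | none f = mkExact p≢q col y∈ f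
    -- As `y` sees `v` in colour `q`, the vertex `y′` is `v`: neither of `v` and `y` sees `q`
    -- outside the pair.
    ... | one y′ _ _ _ f = mkTwin p≢q col v∈ y∈ y≢v v-only y-only
      where
      y-only : ∀ {u} → u ∈ˡ C → u ≢ y → u ≢ v → colour c y u ≢ q
      y-only {u} u∈ u≢y u≢v with u ≟ y′
      ... | no u≢y′ = f u∈ u≢y u≢y′
      ... | yes refl with v ≟ y′
      ...   | yes refl = contradiction refl u≢v
      ...   | no v≢y′ = contradiction (trans (symm y v) vy) (f v∈ (≢-sym y≢v) v≢y′)
    ... | two a∈ b∈ a≢ b≢ a≢b ya yb with neighbours p y
    ...   | none f = flip (mkExact (≢-sym p≢q) (swap-two col) y∈ f)
    ...   | two a′∈ b′∈ a′≢ b′≢ a′≢b′ ya′ yb′ =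
            mkPivot p≢q col y∈ a′∈ b′∈ a∈ b∈ a′≢ b′≢ a≢ b≢ a′≢b′ a≢b ya′ yb′ ya yb
    ...   | one z z∈ z≢y yz y-only = reduce₂ (neighbours q z)
      where
      to-p : ∀ {x y} → x ∈ˡ C → y ∈ˡ C → y ≢ x → colour c x y ≢ q → colour c x y ≡ p
      to-p x∈ y∈ ne nq with col x∈ y∈ (≢-sym ne)
      ... | inj₁ e = e
      ... | inj₂ e = contradiction e nq
      to-q : ∀ {x y} → x ∈ˡ C → y ∈ˡ C → y ≢ x → colour c x y ≢ p → colour c x y ≡ q
      to-q x∈ y∈ ne np with col x∈ y∈ (≢-sym ne)
      ... | inj₁ e = contradiction e np
      ... | inj₂ e = e
      z≢v : z ≢ v
      z≢v refl = p≢q (trans (sym yz) (trans (symm y z) vy))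
      zv : colour c z v ≡ p
      zv = trans (symm z v) (to-p v∈ z∈ z≢v (v-only z∈ z≢v z≢y))
      zy : colour c z y ≡ p
      zy = trans (symm z y) yz
      reduce₂ : Neighbours q z → Reducible p q
      reduce₂ (none f) = mkExact p≢q col z∈ f
      reduce₂ (two a∈ b∈ a≢ b≢ a≢b za zb) =
        mkPivot p≢q col z∈ v∈ y∈ a∈ b∈ (≢-sym z≢v) (≢-sym z≢y) a≢ b≢ (≢-sym y≢v) a≢b zv zy za zb
      reduce₂ (one w w∈ w≢z zw z-only) = reduce₃ (neighbours p w)
        where
        w≢v : w ≢ v
        w≢v refl = p≢q (trans (sym zv) zw)
        w≢y : w ≢ y
        w≢y refl = p≢q (trans (sym zy) zw)
        wz : colour c w z ≡ q
        wz = trans (symm w z) zw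
        wy : colour c w y ≡ q
        wy = trans (symm w y) (to-q y∈ w∈ w≢y (y-only w∈ w≢y w≢z))
        wv : colour c w v ≡ p
        wv = trans (symm w v) (to-p v∈ w∈ w≢v (v-only w∈ w≢v w≢y))
        reduce₃ : Neighbours p w → Reducible p q
        reduce₃ (none f) = flip (mkExact (≢-sym p≢q) (swap-two col) w∈ f)
        reduce₃ (two a∈ b∈ a≢ b≢ a≢b wa wb) =
          mkPivot p≢q col w∈ a∈ b∈ y∈ z∈ a≢ b≢ (≢-sym w≢y) (≢-sym w≢z) a≢b (≢-sym z≢y) wa wb wy wz
        reduce₃ (one v′ v′∈ v′≢w wv′ w-only)
          with extract (v ∷ y ∷ z ∷ w ∷ [])
                 ((≢-sym y≢v ∷ ≢-sym z≢v ∷ ≢-sym w≢v ∷ []) ∷ (≢-sym z≢y ∷ ≢-sym w≢y ∷ []) ∷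
                     (≢-sym w≢z ∷ []) ∷ [] ∷ [])
                 (All.lookup (v∈ ∷ y∈ ∷ z∈ ∷ w∈ ∷ []))
        ... | [] , perm = contradiction (≤-trans large (≤-reflexive (↭-length perm)))
            λ { (s≤s (s≤s (s≤s (s≤s ())))) }
        ... | u ∷ R , perm with Unique-resp-↭ perm C!
        ... | (_ ∷ _ ∷ _ ∷ v≢u ∷ _) ∷ (_ ∷ _ ∷ y≢u ∷ _) ∷ (_ ∷ z≢u ∷ _) ∷ (w≢u ∷ _) ∷ _ =
          mkPivot p≢q col u∈ v∈ z∈ y∈ w∈ v≢u z≢u y≢u w≢u (≢-sym z≢v) (≢-sym w≢y)
            (trans (symm u v) (to-p v∈ u∈ (≢-sym v≢u) (v-only u∈ (≢-sym v≢u) (≢-sym y≢u))))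
            (trans (symm u z) (to-p z∈ u∈ (≢-sym z≢u) (z-only u∈ (≢-sym z≢u) (≢-sym w≢u))))
            (trans (symm u y) (to-q y∈ u∈ (≢-sym y≢u) (y-only u∈ (≢-sym y≢u) (≢-sym z≢u))))
            (trans (symm u w) (to-q w∈ u∈ (≢-sym w≢u) (w-only u∈ (≢-sym w≢u) u≢v′)))
          where
          u∈ : u ∈ˡ C
          u∈ = ∈-resp-↭ (↭-sym perm) (there (there (there (there (here refl)))))
          u≢v′ : u ≢ v′
          u≢v′ refl = w-only v∈ (≢-sym w≢v) v≢u wv

    reduce : ∀ {p q} → p ≢ q → Two p q → ∀ {v} → v ∈ˡ C → Reducible p q
    reduce {p} {q} p≢q col {v} v∈ with neighbours p v | neighbours q v
    ... | _ | none f = mkExact p≢q col v∈ f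
    ... | none f | _ = flip (mkExact (≢-sym p≢q) (swap-two col) v∈ f)
    ... | _ | one y y∈ y≢v vy f = reduce₁ p≢q col v∈ y∈ y≢v vy f
    ... | one y y∈ y≢v vy f | _ = flip (reduce₁ (≢-sym p≢q) (swap-two col) v∈ y∈ y≢v vy f)
    ... | two a∈ b∈ a≢ b≢ a≢b va vb | two a′∈ b′∈ a′≢ b′≢ a′≢b′ va′ vb′ =
      mkPivot p≢q col v∈ a∈ b∈ a′∈ b′∈ a≢ b≢ a′≢ b′≢ a≢b a′≢b′ va vb va′ vb′

module _ {A : Set} where
  open import Algebra.Solver.CommutativeMonoid (++-commutativeMonoid {A = A}) using (solve; _⊕_; _⊜_)

  ↭-edge : (a b : A) (xs E R D X : List A) →
           E ++ (a ∷ b ∷ xs ++ R) ++ D ++ X ↭ xs ++ E ++ R ++ D ++ a ∷ b ∷ X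
  ↭-edge a b xs E R D X = solve 7
    (λ a b xs E R D X → E ⊕ ((a ⊕ (b ⊕ (xs ⊕ R))) ⊕ (D ⊕ X)) ⊜ xs ⊕ (E ⊕ (R ⊕ (D ⊕ (a ⊕ (b ⊕ X))))))
    ↭-refl [ a ] [ b ] xs E R D X

  ↭-match : (a b : A) (E F D X : List A) →
            a ∷ E ++ (b ∷ F) ++ D ++ X ↭ E ++ F ++ D ++ a ∷ b ∷ X
  ↭-match a b E F D X = solve 6
    (λ a b E F D X → a ⊕ (E ⊕ ((b ⊕ F) ⊕ (D ⊕ X))) ⊜ E ⊕ (F ⊕ (D ⊕ (a ⊕ (b ⊕ X)))))
    ↭-refl [ a ] [ b ] E F D X

  ↭-cover : (vs E R D X : List A) → E ++ (vs ++ R) ++ D ++ X ↭ (vs ++ E) ++ R ++ D ++ X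
  ↭-cover vs E R D X = solve 5
    (λ vs E R D X → E ⊕ ((vs ⊕ R) ⊕ (D ⊕ X)) ⊜ (vs ⊕ E) ⊕ (R ⊕ (D ⊕ X))) ↭-refl vs E R D X

  ↭-drop : (E xs R D X : List A) → E ++ (xs ++ R) ++ D ++ X ↭ xs ++ E ++ R ++ D ++ X
  ↭-drop E xs R D X = solve 5
    (λ E xs R D X → E ⊕ ((xs ⊕ R) ⊕ (D ⊕ X)) ⊜ xs ⊕ (E ⊕ (R ⊕ (D ⊕ X)))) ↭-refl E xs R D X

-- Completing partial matchings

2^-suc : ∀ x → 2 ^ suc x ≡ 2 ^ x + 2 ^ x
2^-suc x = cong (2 ^ x +_) (+-identityʳ _)

2^-double : ∀ {x y} → x ≤ suc y → 2 ^ x ≤ 2 ^ y + 2 ^ y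
2^-double {x} {y} x≤ = ≤-trans (^-monoʳ-≤ 2 x≤) (≤-reflexive (2^-suc y))

suc∸≤ : ∀ x y → suc x ∸ y ≤ suc (x ∸ y)
suc∸≤ x zero    = ≤-refl
suc∸≤ zero (suc y) = ≤-trans (≤-reflexive (0∸n≡0 y)) z≤n
suc∸≤ (suc x) (suc y) = suc∸≤ x y

-- The `e` covers contribute `2 ^ (e ∸ τ)` and the `d` light vertices `2 ^ (d ∸ 1)`. The loss in the
-- second factor occurs only when light vertices exist, and is then charged to `δ`.
∸-exponent : ∀ e d {τ δ} → τ ≤ 1 → d ≡ 0 ⊎ 1 ≤ δ → e + d ∸ τ ∸ δ ≤ (e ∸ τ) + (d ∸ 1)
∸-exponent e d {τ} {δ} _ (inj₁ refl) = ≤-trans (m∸n≤m (e + 0 ∸ τ) δ)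
  (≤-reflexive (trans (cong (_∸ τ) (+-identityʳ e)) (sym (+-identityʳ _))))
∸-exponent e d {τ} {δ} τ≤1 (inj₂ 1≤δ) = ≤-trans (∸-monoʳ-≤ (e + d ∸ τ) 1≤δ) (go e d τ≤1)
  where
  go : ∀ e d {τ} → τ ≤ 1 → e + d ∸ τ ∸ 1 ≤ (e ∸ τ) + (d ∸ 1)
  go zero d {τ} _ = ≤-trans (∸-monoˡ-≤ 1 (m∸n≤m d τ)) (m≤n+m (d ∸ 1) _)
  go (suc e) zero z≤n = ≤-trans (m∸n≤m (suc e + 0) 1) (≤-refl)
  go (suc e) (suc d) z≤n = ≤-reflexive (+-suc e d)
  go (suc e) zero (s≤s z≤n) = m∸n≤m (e + 0) 1
  go (suc e) (suc d) (s≤s z≤n) = ≤-reflexive (cong (_∸ 1) (+-suc e d))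

module Matchings (c : Colouring 3 N) (n : ℕ) where

  Edges : Set
  Edges = List (Fin N × Fin N)

  Light : Fin 3 → List (Fin N) → Set
  Light i D = ∀ {d} → d ∈ˡ D → 2 * n ≤ suc (degree c i d)

  -- A vertex of large degree always has an unmatched neighbour left, so the
  -- light vertices can be matched one after the other.
  lights : ∀ {i es} D → ColouredBy c i es → Unique (D ++ ends es) → length es + length D ≡ n →
           Light i D → Many (Good c n es) (2 ^ (length D ∸ 1))
  lights [] col un len light = matching-good c col un (trans (sym (+-identityʳ _)) len)
  lights {i} {es} (d ∷ D) col (d∉ ∷ un) len light = go (length D) refl options refl
    where
    used : List (Fin N)
    used = D ++ ends es
    options : List (Fin N)
    options = filter (λ x → ¬? (mem? _≟_ x used)) (nbrs c i d)
    many-options : suc (length D) ≤ length options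
    -- Here `n` is `length es + 1 + length D`. Of at least 2n - 1 neighbours at most
    -- `length D + 2 * length es` are used, which leaves `length D + 1`: two choices, unless `d` is
    -- the last light vertex.
    many-options = +-cancelˡ-≤ (length used) _ _ (s≤s⁻¹ (begin
      suc (length used + suc (length D))            ≡⟨ cong (λ l → suc (l + suc (length D)))
          (trans (length-++ D) (cong (length D +_) (length-ends es))) ⟩
      suc (length D + length es * 2 + suc (length D)) ≡⟨ arith (length D) (length es) ⟩
      2 * (length es + suc (length D))              ≡⟨ cong (2 *_) len ⟩
      2 * n                                         ≤⟨ light (here refl) ⟩
      suc (degree c i d)                            ≤⟨ s≤s (length-filter-∉ used (nbrs-unique c)) ⟩
      suc (length used + length options)            ∎))
      where
      open ≤-Reasoning
      arith : ∀ x y → suc (x + y * 2 + suc x) ≡ 2 * (y + suc x)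
      arith = solve-∀
    option : ∀ {o} → o ∈ˡ options → colour c d o ≡ i × o ≢ d × o ∉ used
    option o∈ with ∈-filter⁻ (λ x → ¬? (mem? _≟_ x used)) {xs = nbrs c i d} o∈
    ... | o∈nbrs , o∉ = proj₁ (∈nbrs⁻ c o∈nbrs) , proj₂ (∈nbrs⁻ c o∈nbrs) , o∉
    next : ∀ {o} → o ∈ˡ options → Many (Good c n ((d , o) ∷ es)) (2 ^ (length D ∸ 1))
    next {o} o∈ with option o∈
    ... | co , o≢d , o∉ = lights D (co ∷ col)
      (Unique-resp-↭ (↭-sym (↭-trans (shift d D (o ∷ ends es)) (↭-prep d (shift o D (ends es)))))
        ((≢-sym o≢d ∷ d∉) ∷ ¬Any⇒All¬ _ o∉ ∷ un))
      (trans (sym (+-suc _ _)) len) (light ∘ there)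
    go : ∀ l → length D ≡ l → ∀ os → options ≡ os → Many (Good c n es) (2 ^ l)
    go _ _ [] eq = contradiction (subst (λ os → suc (length D) ≤ length os) eq many-options) λ ()
    go zero len₀ (o ∷ os) eq = many-map (good-⊆ c there)
        (≤-reflexive (cong (λ l → 2 ^ (l ∸ 1)) (sym len₀)))
      (next (subst (o ∈ˡ_) (sym eq) (here refl)))
    go (suc l) lenₛ (o ∷ []) eq = contradiction
      (subst₂ (λ l os → suc l ≤ length os) lenₛ eq many-options) λ { (s≤s ()) }
    go (suc l) lenₛ (o ∷ o′ ∷ os) eq with subst Unique eq
        (Uniqueₚ.filter⁺ (λ x → ¬? (mem? _≟_ x used)) (nbrs-unique c {i} {d}))
    ... | (o≢o′ ∷ _) ∷ _ = many-map (λ { (inj₁ g) → good-⊆ c there g ; (inj₂ g) → good-⊆ c there g })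
      (≤-trans (≤-reflexive (2^-suc l))
          (≤-reflexive (cong (λ l → 2 ^ (l ∸ 1) + 2 ^ (l ∸ 1)) (sym lenₛ))))
      (many-⊎ (good-disjoint c o≢o′ (here refl) (here refl))
        (next (subst (o ∈ˡ_) (sym eq) (here refl))) (next (subst (o′ ∈ˡ_) (sym eq) (there (here refl)))))

  -- τ = 0 records a spare vertex in F, which keeps even the last choice free.
  covers : ∀ {i es τ} E F D → ColouredBy c i es → Unique (E ++ F ++ D ++ ends es) →
           length es + (length E + length D) ≡ n → (∀ {e f} → e ∈ˡ E → f ∈ˡ F → colour c e f ≡ i) →
           Light i D → τ ≤ 1 → suc (length E) ≤ length F + τ →
           Many (Good c n es) (2 ^ (length E ∸ τ) * 2 ^ (length D ∸ 1))
  covers {τ = τ} [] F D col un len exact light τ≤1 room = many-map id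
    (≤-reflexive (trans (cong (λ x → 2 ^ x * 2 ^ (length D ∸ 1)) (0∸n≡0 τ)) (*-identityˡ _)))
    (lights D col (Unique-++⁻ʳ F un) len light)
  covers {i} {es} {τ} (e ∷ E) F D col un len exact light τ≤1 room = go F refl
    where
    next : ∀ {f F′} → f ∷ F′ ↭ F → length F ≡ suc (length F′) →
           Many (Good c n ((e , f) ∷ es)) (2 ^ (length E ∸ τ) * 2 ^ (length D ∸ 1))
    next {f} {F′} perm lenF = covers E F′ D
      (exact (here refl) (∈-resp-↭ perm (here refl)) ∷ col)
      (Unique-resp-↭ (↭-match e f E F′ D (ends es))
        (Unique-resp-↭ (↭-prep e (++⁺ˡ E (++⁺ʳ (D ++ ends es) (↭-sym perm)))) un))
      (trans (sym (+-suc _ _)) len)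
      (λ e∈ f∈ → exact (there e∈) (∈-resp-↭ perm (there f∈))) light τ≤1
      (s≤s⁻¹ (subst (λ l → suc (suc (length E)) ≤ l + τ) lenF room))
    go : ∀ F′ → F ≡ F′ → Many (Good c n es) (2 ^ (suc (length E) ∸ τ) * 2 ^ (length D ∸ 1))
    go [] refl = contradiction (≤-trans room τ≤1) λ { (s≤s ()) }
    -- A single vertex in `F` leaves only the case of empty `E` and `τ = 1`, where both exponents
    -- vanish: the last choice is forced.
    go (f ∷ []) refl = many-map (good-⊆ c there) (short E room τ≤1) (next {f} {[]} ↭-refl refl)
      where
      short : ∀ E {τ d} → suc (suc (length E)) ≤ suc τ → τ ≤ 1 →
              2 ^ (suc (length E) ∸ τ) * d ≤ 2 ^ (length E ∸ τ) * d
      short [] (s≤s (s≤s z≤n)) (s≤s z≤n) = ≤-refl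
      short (_ ∷ _) (s≤s (s≤s ())) (s≤s z≤n)
    go (f ∷ f′ ∷ F′) refl with Unique-++⁻ʳ E (Unique-resp-↭ ↭-refl (tail un))
      where
      tail : ∀ {x : Fin N} {xs} → Unique (x ∷ xs) → Unique xs
      tail (_ ∷ u) = u
    ... | (f≢f′ ∷ _) ∷ _ = many-map (λ { (inj₁ g) → good-⊆ c there g ; (inj₂ g) → good-⊆ c there g })
      (≤-trans (*-monoˡ-≤ (2 ^ (length D ∸ 1)) (2^-double (suc∸≤ (length E) τ)))
               (≤-reflexive (*-distribʳ-+ (2 ^ (length D ∸ 1)) (2 ^ (length E ∸ τ))
                   (2 ^ (length E ∸ τ)))))
      (many-⊎ (good-disjoint c f≢f′ (here refl) (here refl))
        (next {f} {f′ ∷ F′} ↭-refl refl) (next {f′} {f ∷ F′} (↭-swap f′ f ↭-refl) refl))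

  -- δ = 1 permits light vertices, whose last choice may be forced a second time:
  -- this costs a factor of two.
  module Core (δ : ℕ) where

    -- A partial matching es in colour i, to be completed by m edges: k edges
    -- inside C, and one edge at each vertex of E (joined to all of C in
    -- colour i) and of D.
    record Side (i : Fin 3) (C : List (Fin N)) (m k : ℕ) : Set where
      constructor side
      field
        {es}     : Edges
        {E D}    : List (Fin N)
        coloured : ColouredBy c i es
        disjoint : Unique (E ++ C ++ D ++ ends es)
        size     : length es + m ≡ n
        split    : k + (length E + length D) ≡ m
        exact    : ∀ {e x} → e ∈ˡ E → x ∈ˡ C → colour c e x ≡ i
        light    : Light i D
        few      : length D ≡ 0 ⊎ 1 ≤ δ

    open Side using (es; split)

    side-unique : ∀ {i C m k} → Side i C m k → Unique C
    side-unique {C = C} S = Unique-++⁻ˡ C (Unique-++⁻ʳ (Side.E S) (Side.disjoint S))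

    -- The list `xs` holds the vertices that the other colour consumes in the same move, so that
    -- both sides continue on the same `R`.
    side-edge : ∀ {i C m k a b} xs {R} → (S : Side i C (suc m) (suc k)) → C ↭ a ∷ b ∷ xs ++ R →
                colour c a b ≡ i → Side i R m k
    side-edge {a = a} {b} xs {R} (side {es} {E} {D} col dis size split exact light few) perm ab = side
      {es = (a , b) ∷ es} {E} {D} (ab ∷ col)
      (Unique-++⁻ʳ xs (Unique-resp-↭ (↭-trans (++⁺ˡ E (++⁺ʳ _ perm))
          (↭-edge a b xs E R D (ends es))) dis))
      (trans (sym (+-suc _ _)) size) (suc-injective split)
      (λ e∈ x∈ → exact e∈ (∈-resp-↭ (↭-sym perm) (there (there (∈-++⁺ʳ xs x∈))))) light few

    -- Only `k` drops, not `m`: the edges at `vs` are still to be chosen, and postponing this to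
    -- `terminal` keeps all remaining vertices of `C` available as partners.
    side-cover : ∀ {i C m k} vs {R} → Side i C m (length vs + k) → C ↭ vs ++ R →
                 (∀ {v u} → v ∈ˡ vs → u ∈ˡ R → colour c v u ≡ i) → Side i R m k
    side-cover {k = k} vs {R} (side {es} {E} {D} col dis size split exact light few) perm vR = side
      {es = es} {vs ++ E} {D} col
      (Unique-resp-↭ (↭-trans (++⁺ˡ E (++⁺ʳ _ perm)) (↭-cover vs E R D (ends es))) dis)
      size (trans (cong (λ l → k + (l + length D)) (length-++ vs))
          (trans (arith k (length vs) _ _) split))
      (λ e∈ x∈ → case (∈-++⁻ vs e∈) x∈) light few
      where
      arith : ∀ k v e d → k + (v + e + d) ≡ v + k + (e + d)
      arith = solve-∀
      case : ∀ {e x} → e ∈ˡ vs ⊎ e ∈ˡ E → x ∈ˡ R → colour c e x ≡ _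
      case (inj₁ e∈) x∈ = vR e∈ x∈
      case (inj₂ e∈) x∈ = exact e∈ (∈-resp-↭ (↭-sym perm) (∈-++⁺ʳ vs x∈))

    side-drop : ∀ {i C m k} xs {R} → Side i C m k → C ↭ xs ++ R → Side i R m k
    side-drop xs {R} (side {es} {E} {D} col dis size split exact light few) perm = side
      {es = es} {E} {D} col
      (Unique-++⁻ʳ xs (Unique-resp-↭ (↭-trans (++⁺ˡ E (++⁺ʳ _ perm)) (↭-drop E xs R D (ends es))) dis))
      size split (λ e∈ x∈ → exact e∈ (∈-resp-↭ (↭-sym perm) (∈-++⁺ʳ xs x∈))) light few

    -- Nothing is left to be found inside `C`, so all of `C` serves as the supply of partners for
    -- `E`, which has at most `m` vertices.
    terminal : ∀ {i C m τ} (S : Side i C m 0) → τ ≤ 1 → suc m ≤ length C + τ →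
               Many (Good c n (es S)) (2 ^ (m ∸ τ ∸ δ))
    terminal {C = C} {τ = τ} (side {es} {E} {D} col dis size refl exact light few) τ≤1 room = many-map id
      (≤-trans (^-monoʳ-≤ 2 (∸-exponent (length E) (length D) τ≤1 few))
               (≤-reflexive (^-distribˡ-+-* 2 (length E ∸ τ) (length D ∸ 1))))
      (covers E C D col dis size exact light τ≤1 (≤-trans (s≤s (m≤m+n _ _)) room))

    Two : Fin 3 → Fin 3 → List (Fin N) → Set
    Two p q C = ∀ {x y} → x ∈ˡ C → y ∈ˡ C → x ≢ y → colour c x y ≡ p ⊎ colour c x y ≡ q

    Either : Edges → Edges → Subgraph N → Set
    Either es fs X = Good c n es X ⊎ Good c n fs X

    -- Each side lacks just one edge inside `C`, so `vx` completes the side of its own colour,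
    -- whichever that is.
    one-edge : ∀ {p q C m v x R} (S : Side p C (suc m) 1) (T : Side q C (suc m) 1) →
               C ↭ v ∷ x ∷ R → colour c v x ≡ p ⊎ colour c v x ≡ q → m ≤ length R →
               Many (Either ((v , x) ∷ es S) ((v , x) ∷ es T)) (2 ^ (m ∸ 1 ∸ δ))
    one-edge S T perm (inj₁ e) room = many-map inj₁ ≤-refl
      (terminal (side-edge [] S perm e) ≤-refl (≤-trans (s≤s room) (≤-reflexive (+-comm 1 _))))
    one-edge S T perm (inj₂ e) room = many-map inj₂ ≤-refl
      (terminal (side-edge [] T perm e) ≤-refl (≤-trans (s≤s room) (≤-reflexive (+-comm 1 _))))

    either-⊆ : ∀ {e f es fs X} → Either (e ∷ es) (f ∷ fs) X → Either es fs X
    either-⊆ = ⊎-map (good-⊆ c there) (good-⊆ c there)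

    -- The partner of `v` is `x` or `y` in one family and `x′` or `y′` in the other, so the families
    -- are disjoint even when copies of both colours occur in them.
    either-disjoint : ∀ {v x x′ y y′ es fs es′ fs′ X} → x ≢ x′ → x ≢ y′ → y ≢ x′ → y ≢ y′ →
      Either ((v , x) ∷ es) ((v , y) ∷ fs) X → Either ((v , x′) ∷ es′) ((v , y′) ∷ fs′) X → ⊥
    either-disjoint a b a′ b′ (inj₁ g) (inj₁ h) = good-disjoint c a (here refl) (here refl) g h
    either-disjoint a b a′ b′ (inj₁ g) (inj₂ h) = good-disjoint c b (here refl) (here refl) g h
    either-disjoint a b a′ b′ (inj₂ g) (inj₁ h) = good-disjoint c a′ (here refl) (here refl) g h
    either-disjoint a b a′ b′ (inj₂ g) (inj₂ h) = good-disjoint c b′ (here refl) (here refl) g h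

    double : ∀ {v x x′ y y′ es fs es′ fs′ gs hs k l} → x ≢ x′ → x ≢ y′ → y ≢ x′ → y ≢ y′ →
      l ≤ suc k → (∀ {X} → Either es fs X ⊎ Either es′ fs′ X → Either gs hs X) →
      Many (Either ((v , x) ∷ es) ((v , y) ∷ fs)) (2 ^ k) →
      Many (Either ((v , x′) ∷ es′) ((v , y′) ∷ fs′)) (2 ^ k) → Many (Either gs hs) (2 ^ l)
    double a b a′ b′ l≤ f M M′ = many-map (f ∘ ⊎-map either-⊆ either-⊆) (2^-double l≤)
      (many-⊎ (either-disjoint a b a′ b′) M M′)

    merge : ∀ {es fs X} → Either es fs X ⊎ Either es fs X → Either es fs X
    merge (inj₁ e) = e
    merge (inj₂ e) = e

    -- Any edge at `v` completes one of the sides, so two edges at `v` give the factor of two that a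
    -- pivot gives elsewhere.
    both-one : ∀ {p q C m} (S : Side p C m 1) (T : Side q C m 1) → Two p q C →
               2 + m ≤ suc (length C) → Many (Either (es S) (es T)) (2 ^ (m ∸ 1 ∸ δ))
    both-one {m = zero} S T col h = contradiction (split S) λ ()
    both-one {C = []} {suc m} S T col (s≤s ())
    both-one {C = _ ∷ []} {suc m} S T col (s≤s (s≤s ()))
    both-one {C = v ∷ x ∷ R} {suc zero} S T col h with side-unique S
    ... | (v≢x ∷ _) ∷ _ = many-map either-⊆ ≤-refl
      (one-edge S T ↭-refl (col (here refl) (there (here refl)) v≢x) z≤n)
    both-one {C = v ∷ x ∷ []} {suc (suc m)} S T col (s≤s (s≤s (s≤s ())))
    both-one {C = v ∷ x ∷ x′ ∷ R} {suc (suc m)} S T col h with side-unique S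
    ... | (v≢x ∷ v≢x′ ∷ _) ∷ (x≢x′ ∷ _) ∷ _ = double x≢x′ x≢x′ x≢x′ x≢x′ (suc∸≤ m δ) merge
      (one-edge S T ↭-refl (col (here refl) (there (here refl)) v≢x) room)
      (one-edge S T (↭-prep v (↭-swap x x′ ↭-refl))
          (col (here refl) (there (there (here refl))) v≢x′) room)
      where
      room : suc m ≤ suc (length R)
      room = s≤s⁻¹ (s≤s⁻¹ (s≤s⁻¹ h))

    mutual
      -- Induction on `kp + kq`, which `fuel` bounds. The size hypothesis survives every move:
      -- deleting a path removes three vertices and lowers `kp`, `kq` and `m` by one each, while a
      -- new cover removes one vertex and lowers one of `kp`, `kq` by one. Only the path lowers the
      -- exponent, and it comes with two disjoint branches.
      core : ∀ fuel {p q C m kp kq} (S : Side p C m kp) (T : Side q C m kq) → p ≢ q → Two p q C →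
             kp + kq ≤ fuel → kp + kq + m ≤ suc (length C) → m ≤ length C →
             Many (Either (es S) (es T)) (2 ^ (m ∸ 1 ∸ δ))
      core _ {kp = zero} S T _ _ _ _ h = many-map inj₁ ≤-refl
        (terminal S ≤-refl (≤-trans (s≤s h) (≤-reflexive (+-comm 1 _))))
      core _ {kp = suc _} {zero} S T _ _ _ _ h = many-map inj₂ ≤-refl
        (terminal T ≤-refl (≤-trans (s≤s h) (≤-reflexive (+-comm 1 _))))
      core _ {kp = 1} {1} S T _ col _ g _ = both-one S T col g
      core (suc fuel) {kp = 1} {suc (suc b)} S T ne col f g h = core-one fuel S T ne col (s≤s⁻¹ f) g h
      core (suc fuel) {m = m} {suc (suc a)} {1} S T ne col f g h = many-map ⊎-swap ≤-refl
        (core-one fuel T S (≢-sym ne) (λ x∈ y∈ x≢y → ⊎-swap (col x∈ y∈ x≢y))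
          (≤-trans (≤-reflexive (+-comm 1 (suc a))) (s≤s⁻¹ f))
          (≤-trans (≤-reflexive (cong (_+ m) (+-comm 1 (suc (suc a))))) g) h)
      core (suc fuel) {p} {q} {C} {m} {suc (suc a)} {suc (suc b)} S T ne col f g h =
        core-reduce fuel S T ne col (s≤s⁻¹ f) g h
            (TwoColours.reduce c (side-unique S) five ne col (proj₂ (nonempty five)))
        where
        arith : ∀ a b m → 5 + (a + b + m) ≡ suc (suc a) + suc (suc b) + suc m
        arith = solve-∀
        large : ∀ m → suc (suc b) + (length (Side.E T) + length (Side.D T)) ≡ m → 2 ≤ m
        large _ refl = s≤s (s≤s z≤n)
        -- From `kp ≥ 2`, `kq ≥ 2` and `m ≥ kq` the size bound gives 2 + 2 + 2 - 1 vertices, just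
        -- the number that `reduce` asks for.
        five : 5 ≤ length C
        five = s≤s⁻¹ (≤-trans (s≤s (s≤s (s≤s (s≤s (large m (split T))))))
               (≤-trans (≤-trans (m≤n+m (4 + m) (a + b)) (≤-reflexive (arith′ a b m))) g))
          where
          arith′ : ∀ a b m → a + b + (4 + m) ≡ suc (suc a) + suc (suc b) + m
          arith′ = solve-∀
        nonempty : ∀ {C} → 5 ≤ length C → ∃[ v ] v ∈ˡ C
        nonempty {v ∷ _} _ = v , here refl

      -- Twins may lower a number by two, so `kp = 1` is kept apart. Either some edge of colour `p`
      -- at `v` finishes the first side, or `v` is a cover in colour `q`.
      core-one : ∀ fuel {p q C m b} (S : Side p C m 1) (T : Side q C m (suc (suc b))) → p ≢ q →
          Two p q C →
                 2 + b ≤ fuel → 3 + b + m ≤ suc (length C) → m ≤ length C →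
                 Many (Either (es S) (es T)) (2 ^ (m ∸ 1 ∸ δ))
      core-one fuel {C = []} S T ne col f (s≤s ()) h
      core-one fuel {m = zero} S T ne col f g h = contradiction (split S) λ ()
      core-one fuel {p} {q} {v ∷ R} {suc m} {b} S T ne col f g h with Any.any? (λ u → colour c v u ≟ p) R
      ... | yes any with Any.satisfied any | ∈-∃++ (lookup-∈ any)
        where
        lookup-∈ : ∀ {xs} (a : Any.Any (λ u → colour c v u ≡ p) xs) → Any.lookup a ∈ˡ xs
        lookup-∈ (here _)  = here refl
        lookup-∈ (there a) = there (lookup-∈ a)
      -- Since `kq ≥ 2`, a spare partner remains in `C`. Hence `τ = 0`, and the exponent is reached
      -- without a second branch.
      ...   | _ | as , bs , eq = many-map (inj₁ ∘ good-⊆ c there) ≤-refl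
        (terminal {τ = 0} (side-edge [] S perm (Anyₚ.lookup-result any)) z≤n
          (≤-trans room (≤-reflexive (sym (+-identityʳ _)))))
        where
        perm : v ∷ R ↭ v ∷ Any.lookup any ∷ (as ++ bs)
        perm = ↭-prep v (subst (_↭ Any.lookup any ∷ (as ++ bs)) (sym eq) (shift _ as bs))
        room : suc m ≤ length (as ++ bs)
        room = s≤s⁻¹ (s≤s⁻¹ (s≤s⁻¹ (≤-trans (≤-trans (m≤n+m (4 + m) b) (≤-reflexive (arith b m)))
                 (≤-trans g (≤-reflexive (cong suc (↭-length perm)))))))
          where
          arith : ∀ b m → b + (4 + m) ≡ 3 + b + suc m
          arith = solve-∀
      core-one fuel {p} {q} {v ∷ R} {suc m} {b} S T ne col f g h | no none =
        core fuel (side-drop [ v ] S ↭-refl) (side-cover [ v ] T ↭-refl λ { (here refl) → all-q }) ne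
          (λ x∈ y∈ → col (there x∈) (there y∈)) f (s≤s⁻¹ g)
          (s≤s⁻¹ (s≤s⁻¹ (≤-trans (≤-trans (m≤n+m (3 + m) (suc b)) (≤-reflexive (arith b m))) g)))
        where
        arith : ∀ b m → suc b + (3 + m) ≡ 3 + b + suc m
        arith = solve-∀
        all-q : ∀ {u} → u ∈ˡ R → colour c v u ≡ q
        all-q u∈ with side-unique S
        ... | v∉ ∷ _ with col (here refl) (there u∈) (All.lookup v∉ u∈)
        ...   | inj₁ e = contradiction (lose u∈ e) none
        ...   | inj₂ e = e

      core-reduce : ∀ fuel {p q C m a b} (S : Side p C m (suc (suc a)))
          (T : Side q C m (suc (suc b))) → p ≢ q →
        Two p q C → suc a + suc (suc b) ≤ fuel → suc (suc a) + suc (suc b) + m ≤ suc (length C) →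
            m ≤ length C →
        ∀ {C! : Unique C} → TwoColours.Reducible c C! p q → Many (Either (es S) (es T)) (2 ^ (m ∸ 1 ∸ δ))
      core-reduce fuel {m = zero} S T ne col f g h _ = contradiction (split S) λ ()
      core-reduce fuel {m = m} {a} {b} S T ne col f g h (TwoColours.flip r) = many-map ⊎-swap ≤-refl
        (core-reduce fuel T S (≢-sym ne) (λ x∈ y∈ x≢y → ⊎-swap (col x∈ y∈ x≢y))
          (≤-trans (≤-reflexive (arith a b)) f)
          (≤-trans (≤-reflexive (cong (_+ m) (+-comm (suc (suc b)) (suc (suc a))))) g) h r)
        where
        arith : ∀ a b → suc b + suc (suc a) ≡ suc a + suc (suc b)
        arith = solve-∀
      core-reduce fuel {p} {q} {C} {suc m} {a} {b} S T ne col f g h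
        (TwoColours.pivot {v} {x} {x′} {y} {y′} {R} perm vx vx′ vy vy′) with Unique-resp-↭ perm
            (side-unique S)
      ... | (_ ∷ _) ∷ (x≢x′ ∷ _ ∷ x≢y′ ∷ _) ∷ (x′≢y ∷ _) ∷ (y≢y′ ∷ _) ∷ _ =
        double x≢x′ x≢y′ (≢-sym x′≢y) y≢y′ (suc∸≤′ m) merge
          (core fuel (side-edge [ y ] S (perm₁ perm) vx) (side-edge [ x ] T (perm₂ perm) vy) ne
            (λ x∈ y∈ → col (∈-resp-↭ (↭-sym perm) (sub x∈)) (∈-resp-↭ (↭-sym perm) (sub y∈)))
                fuel-ok size-ok room)
          (core fuel (side-edge [ y′ ] S (perm₁ perm′) vx′) (side-edge [ x′ ] T (perm₂ perm′) vy′) ne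
            (λ x∈ y∈ → col (∈-resp-↭ (↭-sym perm′) (sub x∈)) (∈-resp-↭ (↭-sym perm′) (sub y∈)))
                fuel-ok size-ok room)
        where
        perm′ : C ↭ v ∷ x′ ∷ x ∷ y′ ∷ y ∷ R
        perm′ = ↭-trans perm (↭-prep v (↭-swap x x′ (↭-swap y y′ ↭-refl)))
        perm₁ : ∀ {v x x′ y y′ R} → C ↭ v ∷ x ∷ x′ ∷ y ∷ y′ ∷ R → C ↭ v ∷ x ∷ y ∷ x′ ∷ y′ ∷ R
        perm₁ perm = ↭-trans perm (↭-prep _ (↭-prep _ (↭-swap _ _ ↭-refl)))
        perm₂ : ∀ {v x x′ y y′ R} → C ↭ v ∷ x ∷ x′ ∷ y ∷ y′ ∷ R → C ↭ v ∷ y ∷ x ∷ x′ ∷ y′ ∷ R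
        perm₂ perm = ↭-trans (perm₁ perm) (↭-prep _ (↭-swap _ _ ↭-refl))
        sub : ∀ {v x x′ y y′ u : Fin N} {R} → u ∈ˡ x′ ∷ y′ ∷ R → u ∈ˡ v ∷ x ∷ x′ ∷ y ∷ y′ ∷ R
        sub (here e) = there (there (here e))
        sub (there u∈) = there (there (there (there u∈)))
        suc∸≤′ : ∀ m → m ∸ δ ≤ suc (m ∸ 1 ∸ δ)
        suc∸≤′ zero = ≤-trans (≤-reflexive (0∸n≡0 δ)) z≤n
        suc∸≤′ (suc m) = suc∸≤ m δ
        fuel-ok : suc a + suc b ≤ fuel
        fuel-ok = ≤-trans (+-monoʳ-≤ (suc a) (n≤1+n (suc b))) f
        size-ok : suc a + suc b + m ≤ suc (2 + length R)
        size-ok = s≤s⁻¹ (s≤s⁻¹ (s≤s⁻¹ (≤-trans (≤-reflexive (arith a b m))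
            (≤-trans g (≤-reflexive (cong suc (↭-length perm)))))))
          where
          arith : ∀ a b m → 3 + (suc a + suc b + m) ≡ suc (suc a) + suc (suc b) + suc m
          arith = solve-∀
        room : m ≤ 2 + length R
        room = s≤s⁻¹ (≤-trans (s≤s (≤-trans (m≤n+m m (a + suc b)) ≤-refl)) size-ok)
      core-reduce fuel {p} {q} {C} {m} {a} {b} S T ne col f g h (TwoColours.exact {v} {R} perm all-p) =
        core fuel (side-cover [ v ] S perm λ { (here refl) → all-p }) (side-drop [ v ] T perm) ne
          (λ x∈ y∈ → col (∈-resp-↭ (↭-sym perm) (there x∈)) (∈-resp-↭ (↭-sym perm) (there y∈)))
          f size-ok (s≤s⁻¹ (≤-trans (s≤s (≤-trans (m≤n+m m (a + suc (suc b))) ≤-refl)) size-ok))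
        where
        size-ok : suc a + suc (suc b) + m ≤ suc (length R)
        size-ok = s≤s⁻¹ (≤-trans g (≤-reflexive (cong suc (↭-length perm))))
      core-reduce fuel {p} {q} {C} {m} {a} {b} S T ne col f g h
          (TwoColours.twin {v} {w} {R} perm v-p w-p) =
        core fuel (side-cover (v ∷ w ∷ []) S perm λ { (here refl) → v-p ; (there (here refl)) → w-p })
          (side-drop (v ∷ w ∷ []) T perm) ne
          (λ x∈ y∈ → col (∈-resp-↭ (↭-sym perm) (there (there x∈)))
              (∈-resp-↭ (↭-sym perm) (there (there y∈))))
          (≤-trans (n≤1+n _) f) size-ok
          (s≤s⁻¹ (≤-trans (s≤s (m≤n+m m (a + suc b))) (≤-trans (≤-reflexive (arith a b m)) size-ok)))
        where
        size-ok : a + suc (suc b) + m ≤ suc (length R)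
        size-ok = s≤s⁻¹ (s≤s⁻¹ (≤-trans g (≤-reflexive (cong suc (↭-length perm)))))
        arith : ∀ a b m → suc (a + suc b + m) ≡ a + suc (suc b) + m
        arith = solve-∀

+≤*+1 : ∀ {a b} → 1 ≤ a → 1 ≤ b → a + b ≤ suc (a * b)
+≤*+1 {suc a} {suc b} _ _ = ≤-trans (m≤m+n _ (a * b)) (≤-reflexive (arith a b))
  where
  arith : ∀ a b → suc a + suc b + a * b ≡ suc (suc a * suc b)
  arith = solve-∀

-- Roles of the vertices

-- Among positive numbers with sum `k + 2` the product is least at 1, 1, `k`; two uses of `+≤*+1`
-- show it.
rainbow-cost : ∀ {k x y z} → 1 ≤ x → 1 ≤ y → 1 ≤ z → k + 2 ≤ x + (y + z) → k ≤ x * (y * z)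
rainbow-cost {k} {x} {y} {z} x≥ y≥ z≥ h = s≤s⁻¹ (s≤s⁻¹ (begin
  2 + k                 ≡⟨ +-comm 2 k ⟩
  k + 2                 ≤⟨ h ⟩
  x + (y + z)           ≤⟨ +-monoʳ-≤ x (+≤*+1 y≥ z≥) ⟩
  x + suc (y * z)       ≡⟨ +-suc x (y * z) ⟩
  suc (x + y * z)       ≤⟨ s≤s (+≤*+1 x≥ (*-mono-≤ y≥ z≥)) ⟩
  2 + x * (y * z)       ∎))
  where open ≤-Reasoning

-- For m ≤ x ≤ 2m one has x (3m − x) ≥ 2m², written with x = m + k and 2m = x + l.
balanced-cost : ∀ {m x y z} → m ≤ x → x ≤ 2 * m → 1 ≤ y → 1 ≤ z → 1 + 3 * m ≤ x + (y + z) →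
                m * (2 * m) ≤ x * (y * z)
balanced-cost {m} {x} {y} {z} m≤x x≤2m y≥ z≥ h with m≤n⇒∃[o]m+o≡n m≤x
... | k , refl with m≤n⇒∃[o]m+o≡n x≤2m
... | l , e = begin
  m * (2 * m)             ≡⟨ cong (m *_) (cong (m +_) (+-identityʳ m)) ⟩
  m * (m + m)             ≡⟨ *-distribˡ-+ m m m ⟩
  m * m + m * m           ≡⟨ cong (λ w → m * m + m * w) (sym k+l) ⟩
  m * m + m * (k + l)     ≤⟨ m≤m+n _ (k * l) ⟩
  m * m + m * (k + l) + k * l ≡⟨ arith m k l ⟩
  (m + k) * (m + l)       ≤⟨ *-monoʳ-≤ (m + k) (s≤s⁻¹ (≤-trans y+z (+≤*+1 y≥ z≥))) ⟩
  (m + k) * (y * z)       ∎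
  where
  open ≤-Reasoning
  arith : ∀ m k l → m * m + m * (k + l) + k * l ≡ (m + k) * (m + l)
  arith = solve-∀
  k+l : k + l ≡ m
  k+l = +-cancelˡ-≡ m _ _ (trans (sym (+-assoc m k l)) (trans e (cong (m +_) (+-identityʳ m))))
  y+z : suc (m + l) ≤ y + z
  y+z = +-cancelˡ-≤ (m + k) _ _ (≤-trans
      (≤-reflexive (trans (arith′ m k l) (cong (λ w → suc (m + (m + w))) k+l)))
          (≤-trans (≤-reflexive (arith″ m)) h))
    where
    arith′ : ∀ m k l → m + k + suc (m + l) ≡ suc (m + (m + (k + l)))
    arith′ = solve-∀
    arith″ : ∀ m → suc (m + (m + m)) ≡ 1 + 3 * m
    arith″ = solve-∀

-- If `x ≥ 2 * m`, the factor `u` comes from `y * z ≥ y + z ∸ 1`. Otherwise all three degrees are at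
-- most 2m, one of them is at least `m` because of their sum, and `balanced-cost` gives 2m².
heavy-cost : ∀ {m u x y z} → u ≤ m → 1 ≤ x → 1 ≤ y → 1 ≤ z → y ≤ 2 * m → z ≤ 2 * m →
             1 + 3 * m ≤ x + (y + z) → suc u ≤ y + z → u * (2 * m) ≤ x * (y * z)
heavy-cost {m} {u} {x} {y} {z} u≤m x≥ y≥ z≥ y≤ z≤ h hu with 2 * m ≤? x
... | yes 2m≤x = ≤-trans (≤-reflexive (*-comm u (2 * m)))
    (*-mono-≤ 2m≤x (s≤s⁻¹ (≤-trans hu (+≤*+1 y≥ z≥))))
... | no x<2m = ≤-trans (*-monoˡ-≤ (2 * m) u≤m) go
  where
  go : m * (2 * m) ≤ x * (y * z)
  go with m ≤? x | m ≤? y | m ≤? z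
  ... | yes m≤x | _ | _ = balanced-cost m≤x (<⇒≤ (≰⇒> x<2m)) y≥ z≥ h
  ... | _ | yes m≤y | _ = ≤-trans (balanced-cost m≤y y≤ x≥ z≥ (≤-trans h (≤-reflexive (arith x y z))))
                                  (≤-reflexive (arith′ x y z))
    where
    arith : ∀ x y z → x + (y + z) ≡ y + (x + z)
    arith = solve-∀
    arith′ : ∀ x y z → y * (x * z) ≡ x * (y * z)
    arith′ = solve-∀
  ... | _ | _ | yes m≤z = ≤-trans (balanced-cost m≤z z≤ x≥ y≥ (≤-trans h (≤-reflexive (arith x y z))))
                                  (≤-reflexive (arith′ x y z))
    where
    arith : ∀ x y z → x + (y + z) ≡ z + (x + y)
    arith = solve-∀
    arith′ : ∀ x y z → z * (x * y) ≡ x * (y * z)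
    arith′ = solve-∀
  ... | no a | no b | no d = contradiction (≤-trans h (≤-trans
      (+-mono-≤ (<⇒≤ (≰⇒> a)) (+-mono-≤ (<⇒≤ (≰⇒> b)) (<⇒≤ (≰⇒> d)))) (≤-reflexive (arith m)))) 1+n≰n
    where
    arith : ∀ m → m + (m + m) ≡ 3 * m
    arith = solve-∀

-- The fields `product` and `addition` lead back to the order 0, 1, 2 in which stars and degrees are
-- counted. The roles of `p` and `q` are symmetric, so one arrangement for each `o` is enough.
record Arrangement (o p q : Fin 3) : Set where
  field
    o≢p      : o ≢ p
    o≢q      : o ≢ q
    p≢q      : p ≢ q
    cover    : ∀ i → i ≡ o ⊎ i ≡ p ⊎ i ≡ q
    product  : (f : Fin 3 → ℕ) → f o * (f p * f q) ≡ f zero * (f (suc zero) * f (suc (suc zero)))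
    addition : (f : Fin 3 → ℕ) → f o + (f p + f q) ≡ f zero + (f (suc zero) + f (suc (suc zero)))

arrangement₀ : Arrangement zero (suc zero) (suc (suc zero))
arrangement₀ = record
  { o≢p = λ () ; o≢q = λ () ; p≢q = λ ()
  ; cover = λ { zero → inj₁ refl ; (suc zero) → inj₂ (inj₁ refl) ; (suc (suc zero)) → inj₂ (inj₂ refl) }
  ; product = λ f → refl ; addition = λ f → refl }

arrangement₁ : Arrangement (suc zero) zero (suc (suc zero))
arrangement₁ = record
  { o≢p = λ () ; o≢q = λ () ; p≢q = λ ()
  ; cover = λ { zero → inj₂ (inj₁ refl) ; (suc zero) → inj₁ refl ; (suc (suc zero)) → inj₂ (inj₂ refl) }
  ; product = λ f → *-left-comm (f (suc zero)) (f zero) _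
  ; addition = λ f → +-left-comm (f (suc zero)) (f zero) _ }
  where
  *-left-comm : ∀ a b c → a * (b * c) ≡ b * (a * c)
  *-left-comm = solve-∀
  +-left-comm : ∀ a b c → a + (b + c) ≡ b + (a + c)
  +-left-comm = solve-∀

arrangement₂ : Arrangement (suc (suc zero)) zero (suc zero)
arrangement₂ = record
  { o≢p = λ () ; o≢q = λ () ; p≢q = λ ()
  ; cover = λ { zero → inj₂ (inj₁ refl) ; (suc zero) → inj₂ (inj₂ refl) ; (suc (suc zero)) → inj₁ refl }
  ; product = λ f → *-rotate (f (suc (suc zero))) (f zero) _
  ; addition = λ f → +-rotate (f (suc (suc zero))) (f zero) _ }
  where
  *-rotate : ∀ a b c → a * (b * c) ≡ b * (c * a)
  *-rotate = solve-∀
  +-rotate : ∀ a b c → a + (b + c) ≡ b + (c + a)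
  +-rotate = solve-∀

arrange : (f : Fin 3 → ℕ) → ∃[ o ] ∃[ p ] ∃[ q ] (Arrangement o p q × f p ≤ f o × f q ≤ f o)
arrange f with ≤-total (f zero) (f (suc zero)) | ≤-total (f zero) (f (suc (suc zero))) | ≤-total
    (f (suc zero)) (f (suc (suc zero)))
... | inj₁ a | _ | inj₁ b = _ , _ , _ , arrangement₂ , ≤-trans a b , b
... | inj₁ a | _ | inj₂ b = _ , _ , _ , arrangement₁ , a , b
... | inj₂ a | inj₁ b | _ = _ , _ , _ , arrangement₂ , b , ≤-trans a b
... | inj₂ a | inj₂ b | _ = _ , _ , _ , arrangement₀ , a , b

module _ {N : ℕ} (c : Colouring 3 N) where

  degree-sum : ∀ v → N ≤ suc (degree c zero v + (degree c (suc zero) v + degree c (suc (suc zero)) v))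
  degree-sum v = ≤-trans (≤-reflexive
      (trans (sym (length-tabulate (λ (i : Fin N) → i))) (split (allFin N))))
    (+-monoˡ-≤ _ (length-⊆ {ys = v ∷ []} (Uniqueₚ.filter⁺ (_≟ v) (Uniqueₚ.allFin⁺ N))
      λ x∈ → here (proj₂ (∈-filter⁻ (_≟ v) {xs = allFin N} x∈))))
    where
    count : Fin 3 → List (Fin N) → ℕ
    count i xs = length (filter (λ u → (colour c v u ≟ i) ×-dec ¬? (u ≟ v)) xs)
    split : ∀ xs → length xs ≡ length (filter (_≟ v) xs) +
        (count zero xs + (count (suc zero) xs + count (suc (suc zero)) xs))
    split [] = refl
    split (x ∷ xs) with split xs | x ≟ v | colour c v x
    ... | ih | yes refl | zero = cong suc ih
    ... | ih | yes refl | suc zero = cong suc ih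
    ... | ih | yes refl | suc (suc zero) = cong suc ih
    ... | ih | no _ | zero = trans (cong suc ih) (sym (+-suc _ _))
    ... | ih | no _ | suc zero = trans (cong suc ih)
        (arith (length (filter (_≟ v) xs)) (count zero xs) (count (suc zero) xs)
        (count (suc (suc zero)) xs))
      where
      arith : ∀ a b c d → suc (a + (b + (c + d))) ≡ a + (b + (suc c + d))
      arith = solve-∀
    ... | ih | no _ | suc (suc zero) =
        trans (cong suc ih) (arith (length (filter (_≟ v) xs)) (count zero xs) (count (suc zero) xs)
        (count (suc (suc zero)) xs))
      where
      arith : ∀ a b c d → suc (a + (b + (c + d))) ≡ a + (b + (c + suc d))
      arith = solve-∀

  RainbowVertex : Fin N → Set
  RainbowVertex v = ∀ i → 1 ≤ degree c i v

  Misses : Fin 3 → Fin N → Set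
  Misses i v = ∀ {u} → u ≢ v → colour c v u ≢ i

  private
    classify : ∀ v → (∃[ i ] Misses i v) ⊎ RainbowVertex v
    classify v with sees zero | sees (suc zero) | sees (suc (suc zero))
      where
      sees : ∀ i → Misses i v ⊎ 1 ≤ degree c i v
      sees i with nbrs c i v in eq
      ... | []    = inj₁ λ ne e → contradiction (subst (_ ∈ˡ_) eq (∈nbrs⁺ c e ne)) λ ()
      ... | _ ∷ _ = inj₂ (s≤s z≤n)
    ... | inj₁ a | _ | _ = inj₁ (_ , a)
    ... | _ | inj₁ a | _ = inj₁ (_ , a)
    ... | _ | _ | inj₁ a = inj₁ (_ , a)
    ... | inj₂ a | inj₂ b | inj₂ d = inj₂ λ { zero → a ; (suc zero) → b ; (suc (suc zero)) → d }

  -- A vertex may miss two colours; `classify` settles on the first one, which keeps the three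
  -- classes disjoint.
  missing : Fin N → Maybe (Fin 3)
  missing v = [ just ∘ proj₁ , (λ _ → nothing) ]′ (classify v)

  missing-just : ∀ {v i} → missing v ≡ just i → Misses i v
  missing-just {v} e with classify v
  missing-just refl | inj₁ (i , m) = m

  missing-nothing : ∀ {v} → missing v ≡ nothing → RainbowVertex v
  missing-nothing {v} e with classify v
  ... | inj₂ r = r

-- The roles partition all vertices, so `role-sum` is an equality. A rainbow vertex that is light in
-- both colours is assigned to `p`.
pattern core    = zero
pattern cover-p = suc zero
pattern cover-q = suc (suc zero)
pattern light-p = suc (suc (suc zero))
pattern light-q = suc (suc (suc (suc zero)))
pattern heavy   = suc (suc (suc (suc (suc zero))))

module _ {N : ℕ} (role : Fin N → Fin 6) where

  with-role : Fin 6 → List (Fin N)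
  with-role ρ = filter (λ v → role v ≟ ρ) (allFin N)

  with-role-unique : ∀ ρ → Unique (with-role ρ)
  with-role-unique ρ = Uniqueₚ.filter⁺ (λ v → role v ≟ ρ) (Uniqueₚ.allFin⁺ N)

  ∈with-role : ∀ {ρ v} → v ∈ˡ with-role ρ → role v ≡ ρ
  ∈with-role {ρ} v∈ = proj₂ (∈-filter⁻ (λ v → role v ≟ ρ) {xs = allFin N} v∈)

  disjoint-roles : ∀ {ρ σ} {xs ys : List (Fin N)} → ρ ≢ σ → (∀ {v} → v ∈ˡ xs → role v ≡ ρ) →
    (∀ {v} → v ∈ˡ ys → role v ≡ σ) → ∀ {v} → ¬ (v ∈ˡ xs × v ∈ˡ ys)
  disjoint-roles ne f g (v∈ , v∈′) = ne (trans (sym (f v∈)) (g v∈′))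

  role-sum : N ≡ length (with-role core) + (length (with-role cover-p) + (length (with-role cover-q) +
             (length (with-role light-p) + (length (with-role light-q) + length (with-role heavy)))))
  role-sum = trans (sym (length-tabulate (λ (i : Fin N) → i))) (split (allFin N))
    where
    count : Fin 6 → List (Fin N) → ℕ
    count ρ xs = length (filter (λ v → role v ≟ ρ) xs)
    split : ∀ xs → length xs ≡ count core xs + (count cover-p xs + (count cover-q xs +
            (count light-p xs + (count light-q xs + count heavy xs))))
    split [] = refl
    split (x ∷ xs) with split xs | role x
    ... | ih | core = cong suc ih
    ... | ih | cover-p = trans (cong suc ih) (sym (+-suc a _))
      where a = count core xs
    ... | ih | cover-q = trans (cong suc ih) (arith (count core xs) (count cover-p xs) _)
      where
      arith : ∀ a b r → suc (a + (b + r)) ≡ a + (b + suc r)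
      arith = solve-∀
    ... | ih | light-p = trans (cong suc ih)
        (arith (count core xs) (count cover-p xs) (count cover-q xs) _)
      where
      arith : ∀ a b d r → suc (a + (b + (d + r))) ≡ a + (b + (d + suc r))
      arith = solve-∀
    ... | ih | light-q = trans (cong suc ih)
        (arith (count core xs) (count cover-p xs) (count cover-q xs) (count light-p xs) _)
      where
      arith : ∀ a b d e r → suc (a + (b + (d + (e + r)))) ≡ a + (b + (d + (e + suc r)))
      arith = solve-∀
    ... | ih | heavy = trans (cong suc ih)
        (arith (count core xs) (count cover-p xs) (count cover-q xs) (count light-p xs)
        (count light-q xs) _)
      where
      arith : ∀ a b d e f r → suc (a + (b + (d + (e + (f + r))))) ≡ a + (b + (d + (e + (f + suc r))))
      arith = solve-∀

module _ {A : Set} where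
  open import Algebra.Solver.CommutativeMonoid (++-commutativeMonoid {A = A}) using (solve; _⊕_; _⊜_)

  ↭-last : (x : A) (E F D : List A) → E ++ F ++ D ++ [ x ] ↭ x ∷ E ++ F ++ D ++ []
  ↭-last x E F D = ↭-trans
    (solve 4 (λ x E F D → E ⊕ (F ⊕ (D ⊕ x)) ⊜ x ⊕ (E ⊕ (F ⊕ D))) ↭-refl [ x ] E F D)
    (↭-prep x (++⁺ˡ E (++⁺ˡ F (↭-trans (solve 1 (λ D → D ⊜ D) ↭-refl D) (++-comm [] D)))))

  ↭-last-edge : (x y : A) (xs E R D : List A) →
    E ++ (y ∷ xs ++ R) ++ D ++ [ x ] ↭ xs ++ E ++ R ++ D ++ x ∷ y ∷ []
  ↭-last-edge x y xs E R D = solve 6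
    (λ x y xs E R D → E ⊕ ((y ⊕ (xs ⊕ R)) ⊕ (D ⊕ x)) ⊜ xs ⊕ (E ⊕ (R ⊕ (D ⊕ (x ⊕ y)))))
    ↭-refl [ x ] [ y ] xs E R D

-- The lower bound

module LowerBound (m : ℕ) (m≥1 : 1 ≤ m) {N : ℕ} (N≡2+3m : N ≡ 2 + 3 * m) (c : Colouring 3 N) where

  n : ℕ
  n = suc m

  rainbows monos : ℕ
  rainbows = length (filter (rainbow? c) (copies K₁,₃ N))
  monos    = length (filter (monochromatic? c) (copies (n K₂) N))

  -- In `local` no vertex is rainbow. In `mixed` one is, and the two units taken off the exponent
  -- `m` stand for the last light vertex and for a heavy vertex. In `many₁` there are two heavy
  -- vertices; in `many₂` the core is so small that all but six vertices are rainbow.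
  data Outcome : Set where
    local : 2 ^ m ≤ monos → Outcome
    mixed : 3 * m ∸ 1 ≤ rainbows → 2 ^ (m ∸ 1 ∸ 1) ≤ monos → Outcome
    many₁ : 3 * m ∸ 1 ≤ rainbows → (2 * m ∸ 2) * (2 * m) ≤ rainbows → Outcome
    many₂ : 3 * m ∸ 1 ≤ rainbows → (3 * m ∸ 4) * (3 * m ∸ 1) ≤ rainbows → Outcome

  private
    V : Set
    V = Fin N

  good⇒monos : ∀ {es k} → Many (Good c n es) k → k ≤ monos
  good⇒monos = many-filter (monochromatic? c) λ g → Good.copy g , Good.mono g

  open Matchings c n

  module Arranged {o p q : Fin 3} (arr : Arrangement o p q) where
    open Arrangement arr

    role : V → Fin 6
    role v with missing c v
    role v | just i with i ≟ o | i ≟ p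
    ... | yes _ | _     = core
    ... | no _  | yes _ = cover-q
    ... | no _  | no _  = cover-p
    role v | nothing with 2 * n ≤? suc (degree c p v) | 2 * n ≤? suc (degree c q v)
    ... | yes _ | _     = light-p
    ... | no _  | yes _ = light-q
    ... | no _  | no _  = heavy

    role-core : ∀ {v} → role v ≡ core → missing c v ≡ just o
    role-core {v} e with missing c v
    role-core {v} e | just i with i ≟ o | i ≟ p
    ... | yes refl | _ = refl
    role-core {v} () | just i | no _ | yes _
    role-core {v} () | just i | no _ | no _
    role-core {v} e | nothing with 2 * n ≤? suc (degree c p v) | 2 * n ≤? suc (degree c q v)
    role-core {v} () | nothing | yes _ | _
    role-core {v} () | nothing | no _ | yes _
    role-core {v} () | nothing | no _ | no _

    role-core⁺ : ∀ {v} → missing c v ≡ just o → role v ≡ core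
    role-core⁺ {v} e with missing c v
    role-core⁺ refl | just i with i ≟ i | i ≟ p
    ... | yes _ | _ = refl
    ... | no ne | _ = contradiction refl ne

    role-cover-p : ∀ {v} → role v ≡ cover-p → missing c v ≡ just q
    role-cover-p {v} e with missing c v
    role-cover-p {v} e | just i with i ≟ o | i ≟ p
    role-cover-p {v} () | just i | yes _ | _
    role-cover-p {v} () | just i | no _ | yes _
    role-cover-p {v} e | just i | no i≢o | no i≢p with cover i
    ... | inj₁ i≡o = contradiction i≡o i≢o
    ... | inj₂ (inj₁ i≡p) = contradiction i≡p i≢p
    ... | inj₂ (inj₂ refl) = refl
    role-cover-p {v} e | nothing with 2 * n ≤? suc (degree c p v) | 2 * n ≤? suc (degree c q v)
    role-cover-p {v} () | nothing | yes _ | _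
    role-cover-p {v} () | nothing | no _ | yes _
    role-cover-p {v} () | nothing | no _ | no _

    role-cover-q : ∀ {v} → role v ≡ cover-q → missing c v ≡ just p
    role-cover-q {v} e with missing c v
    role-cover-q {v} e | just i with i ≟ o | i ≟ p
    role-cover-q {v} () | just i | yes _ | _
    role-cover-q {v} e | just i | no _ | yes refl = refl
    role-cover-q {v} () | just i | no _ | no _
    role-cover-q {v} e | nothing with 2 * n ≤? suc (degree c p v) | 2 * n ≤? suc (degree c q v)
    role-cover-q {v} () | nothing | yes _ | _
    role-cover-q {v} () | nothing | no _ | yes _
    role-cover-q {v} () | nothing | no _ | no _

    role-light-p : ∀ {v} → role v ≡ light-p → missing c v ≡ nothing × 2 * n ≤ suc (degree c p v)
    role-light-p {v} e with missing c v
    role-light-p {v} e | just i with i ≟ o | i ≟ p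
    role-light-p {v} () | just i | yes _ | _
    role-light-p {v} () | just i | no _ | yes _
    role-light-p {v} () | just i | no _ | no _
    role-light-p {v} e | nothing with 2 * n ≤? suc (degree c p v) | 2 * n ≤? suc (degree c q v)
    role-light-p {v} e | nothing | yes h | _ = refl , h
    role-light-p {v} () | nothing | no _ | yes _
    role-light-p {v} () | nothing | no _ | no _

    role-light-q : ∀ {v} → role v ≡ light-q → missing c v ≡ nothing × 2 * n ≤ suc (degree c q v)
    role-light-q {v} e with missing c v
    role-light-q {v} e | just i with i ≟ o | i ≟ p
    role-light-q {v} () | just i | yes _ | _
    role-light-q {v} () | just i | no _ | yes _
    role-light-q {v} () | just i | no _ | no _
    role-light-q {v} e | nothing with 2 * n ≤? suc (degree c p v) | 2 * n ≤? suc (degree c q v)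
    role-light-q {v} () | nothing | yes h | _
    role-light-q {v} e | nothing | no _ | yes h = refl , h
    role-light-q {v} () | nothing | no _ | no _

    role-heavy : ∀ {v} → role v ≡ heavy →
      missing c v ≡ nothing × degree c p v ≤ 2 * m × degree c q v ≤ 2 * m
    role-heavy {v} e with missing c v
    role-heavy {v} e | just i with i ≟ o | i ≟ p
    role-heavy {v} () | just i | yes _ | _
    role-heavy {v} () | just i | no _ | yes _
    role-heavy {v} () | just i | no _ | no _
    role-heavy {v} e | nothing with 2 * n ≤? suc (degree c p v) | 2 * n ≤? suc (degree c q v)
    role-heavy {v} () | nothing | yes h | _
    role-heavy {v} () | nothing | no _ | yes h
    role-heavy {v} e | nothing | no h | no h′ = refl , small h , small h′
      where
      arith : ∀ m → 2 * suc m ≡ suc (suc (2 * m))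
      arith = solve-∀
      small : ∀ {d} → ¬ 2 * n ≤ suc d → d ≤ 2 * m
      small h = s≤s⁻¹ (s≤s⁻¹ (≤-trans (≰⇒> h) (≤-reflexive (arith m))))

    L : Fin 6 → List V
    L = with-role role

    l : Fin 6 → ℕ
    l ρ = length (L ρ)

    C : List V
    C = L core

    ∈L : ∀ {ρ v} → v ∈ˡ L ρ → role v ≡ ρ
    ∈L = ∈with-role role

    C-misses : ∀ {v} → v ∈ˡ C → Misses c o v
    C-misses v∈ = missing-just c (role-core (∈L v∈))

    to-C : ∀ {u v} → v ∈ˡ C → u ≢ v → colour c u v ≡ p ⊎ colour c u v ≡ q
    to-C {u} {v} v∈ ne with cover (colour c u v)
    ... | inj₁ e = contradiction (trans (Colouring.symm c v u) e) (C-misses v∈ ne)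
    ... | inj₂ e = e

    apart : ∀ {ρ σ u v} → ρ ≢ σ → u ∈ˡ L ρ → v ∈ˡ L σ → u ≢ v
    apart ne u∈ v∈ refl = ne (trans (sym (∈L u∈)) (∈L v∈))

    record Cover (i : Fin 3) (ρ σ : Fin 6) (δ : ℕ) : Set where
      field
        ρ≢core  : ρ ≢ core
        core≢σ  : core ≢ σ
        ρ≢σ     : ρ ≢ σ
        ρ≢heavy : ρ ≢ heavy
        σ≢heavy : σ ≢ heavy
        exact   : ∀ {e x} → e ∈ˡ L ρ → x ∈ˡ C → colour c e x ≡ i
        light   : Light i (L σ)
        few     : l σ ≡ 0 ⊎ 1 ≤ δ

      unique : ∀ {E D X} → Unique E → Unique D → Unique X → (∀ {v} → v ∈ˡ E → role v ≡ ρ) →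
        (∀ {v} → v ∈ˡ D → role v ≡ σ) → (∀ {v} → v ∈ˡ X → role v ≡ heavy) → Unique (E ++ C ++ D ++ X)
      unique {E} {D} {X} E! D! X! E-ρ D-σ X-h =
        Uniqueₚ.++⁺ E! (Uniqueₚ.++⁺ (with-role-unique role core)
            (Uniqueₚ.++⁺ D! X! (disjoint-roles role σ≢heavy D-σ X-h))
          λ (x∈ , y∈) → [ (λ z∈ → disjoint-roles role core≢σ ∈L D-σ (x∈ , z∈))
                        , (λ z∈ → disjoint-roles role {core} {heavy} (λ ()) ∈L X-h (x∈ , z∈)) ]′
                            (∈-++⁻ D y∈))
        λ (x∈ , y∈) → [ (λ z∈ → disjoint-roles role ρ≢core E-ρ ∈L (x∈ , z∈))
                      , (λ y∈′ → [ (λ z∈ → disjoint-roles role ρ≢σ E-ρ D-σ (x∈ , z∈))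
                                 , (λ z∈ → disjoint-roles role ρ≢heavy E-ρ X-h (x∈ , z∈)) ]′
                                     (∈-++⁻ D y∈′)) ]′ (∈-++⁻ C y∈)

      full : ∀ {X} → Unique X → (∀ {v} → v ∈ˡ X → role v ≡ heavy) → Unique (L ρ ++ C ++ L σ ++ X)
      full X! X-h = unique (with-role-unique role ρ) (with-role-unique role σ) X! ∈L ∈L X-h

      -- With `n` covers the matching takes no edge inside `C`. The maximality of the class `C`
      -- enters through `l ρ ≤ l core`, which supplies enough partners.
      enough-covers : l ρ ≤ l core → n ≤ l ρ + l σ → 2 ^ (m ∸ δ) ≤ monos
      enough-covers ρ≤core h = ≤-trans
        (≤-trans (^-monoʳ-≤ 2 (≤-trans (≤-reflexive (cong (λ w → w ∸ 1 ∸ δ) (sym n-covers)))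
            (∸-exponent (length E) (length D) ≤-refl few′)))
                 (≤-reflexive (^-distribˡ-+-* 2 (length E ∸ 1) (length D ∸ 1))))
        (good⇒monos (covers E C D [] (unique (Uniqueₚ.take⁺ n (with-role-unique role ρ))
            (Uniqueₚ.take⁺ (n ∸ l ρ) (with-role-unique role σ)) [] (∈L ∘ take-∈ n)
                (∈L ∘ take-∈ (n ∸ l ρ)) λ ())
          n-covers (λ e∈ x∈ → exact (take-∈ n e∈) x∈) (light ∘ take-∈ (n ∸ l ρ)) ≤-refl
          (≤-trans (s≤s (≤-trans (≤-reflexive (length-take n (L ρ))) (≤-trans (m⊓n≤n n (l ρ)) ρ≤core)))
                   (≤-reflexive (+-comm 1 _)))))
        where
        take-∈ : ∀ k {xs : List V} {x} → x ∈ˡ take k xs → x ∈ˡ xs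
        take-∈ (suc k) {_ ∷ _} (here e) = here e
        take-∈ (suc k) {_ ∷ _} (there x∈) = there (take-∈ k x∈)
        E D : List V
        E = take n (L ρ)
        D = take (n ∸ l ρ) (L σ)
        n-covers : length E + length D ≡ n
        n-covers = trans (cong₂ _+_ (length-take n (L ρ)) (length-take (n ∸ l ρ) (L σ)))
            (go (≤-total n (l ρ)))
          where
          go : n ≤ l ρ ⊎ l ρ ≤ n → n ⊓ l ρ + (n ∸ l ρ) ⊓ l σ ≡ n
          go (inj₁ n≤) = trans (cong₂ _+_ (m≤n⇒m⊓n≡m n≤) (cong (_⊓ l σ) (m≤n⇒m∸n≡0 n≤))) (+-identityʳ n)
          go (inj₂ ≤n) = trans (cong₂ _+_ (m≥n⇒m⊓n≡n ≤n) (m≤n⇒m⊓n≡m (m≤n+o⇒m∸n≤o n (l ρ) h)))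
              (m+[n∸m]≡n ≤n)
        few′ : length D ≡ 0 ⊎ 1 ≤ δ
        few′ with few
        ... | inj₂ 1≤δ = inj₂ 1≤δ
        ... | inj₁ e = inj₁ (n≤0⇒n≡0 (≤-trans (≤-reflexive (length-take (n ∸ l ρ) (L σ)))
            (≤-trans (m⊓n≤n _ _) (≤-reflexive e))))

      open Core δ

      base : ∀ {a} → a + (l ρ + l σ) ≡ m → Side i C n (suc a)
      base e = side {es = []} {L ρ} {L σ} [] (full [] λ ()) refl (cong suc e) exact light few

      -- A heavy vertex that sees `C` in one colour only acts as one more cover, so one edge fewer
      -- is wanted inside `C`.
      adjoin : ∀ {a x} → a + (l ρ + l σ) ≡ m → x ∈ˡ L heavy → (∀ {y} → y ∈ˡ C → colour c x y ≡ i) →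
          Side i C n a
      adjoin {a} {x} e x∈ xC = side {es = []} {x ∷ L ρ} {L σ} []
        (Unique-resp-↭ (↭-last x (L ρ) C (L σ)) (full ([] ∷ []) λ { (here refl) → ∈L x∈ }))
        refl (trans (+-suc a _) (cong suc e)) (λ { (here refl) → xC ; (there e∈) → exact e∈ }) light few

      -- A heavy vertex can also open the matching with an edge into `C`. Done in both colours at
      -- once, this makes it the middle of a deleted path.
      join : ∀ {a x y} xs {R} → a + (l ρ + l σ) ≡ m → x ∈ˡ L heavy → C ↭ y ∷ xs ++ R →
          colour c x y ≡ i → Side i R m a
      join {x = x} {y} xs {R} e x∈ perm xy = side {es = (x , y) ∷ []} {L ρ} {L σ} (xy ∷ [])
        (Unique-++⁻ʳ xs (Unique-resp-↭ (↭-trans (++⁺ˡ (L ρ) (++⁺ʳ _ perm))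
            (↭-last-edge x y xs (L ρ) R (L σ)))
          (full ([] ∷ []) λ { (here refl) → ∈L x∈ })))
        refl e (λ e∈ z∈ → exact e∈ (∈-resp-↭ (↭-sym perm) (there (∈-++⁺ʳ xs z∈)))) light few

    module _ {δ : ℕ} (light-p-few : l light-p ≡ 0 ⊎ 1 ≤ δ) (light-q-few : l light-q ≡ 0 ⊎ 1 ≤ δ) where

      P : Cover p cover-p light-p δ
      P = record { ρ≢core = λ () ; core≢σ = λ () ; ρ≢σ = λ () ; ρ≢heavy = λ () ; σ≢heavy = λ ()
        ; exact = exact ; light = λ d∈ → proj₂ (role-light-p (∈L d∈)) ; few = light-p-few }
        where
        exact : ∀ {e x} → e ∈ˡ L cover-p → x ∈ˡ C → colour c e x ≡ p
        exact e∈ x∈ with to-C x∈ (apart (λ ()) e∈ x∈)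
        ... | inj₁ eq = eq
        ... | inj₂ eq = contradiction eq (missing-just c (role-cover-p (∈L e∈)) (apart (λ ()) x∈ e∈))

      Q : Cover q cover-q light-q δ
      Q = record { ρ≢core = λ () ; core≢σ = λ () ; ρ≢σ = λ () ; ρ≢heavy = λ () ; σ≢heavy = λ ()
        ; exact = exact ; light = λ d∈ → proj₂ (role-light-q (∈L d∈)) ; few = light-q-few }
        where
        exact : ∀ {e x} → e ∈ˡ L cover-q → x ∈ˡ C → colour c e x ≡ q
        exact e∈ x∈ with to-C x∈ (apart (λ ()) e∈ x∈)
        ... | inj₂ eq = eq
        ... | inj₁ eq = contradiction eq (missing-just c (role-cover-q (∈L e∈)) (apart (λ ()) x∈ e∈))

      two : ∀ {x y} → x ∈ˡ C → y ∈ˡ C → x ≢ y → colour c x y ≡ p ⊎ colour c x y ≡ q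
      two _ y∈ ne = to-C y∈ ne

      either⇒monos : ∀ {es fs k} → Many (Core.Either δ es fs) k → k ≤ monos
      either⇒monos = many-filter (monochromatic? c)
        λ { (inj₁ g) → Good.copy g , Good.mono g ; (inj₂ g) → Good.copy g , Good.mono g }

      module _ {a b} (ea : a + (l cover-p + l light-p) ≡ m) (eb : b + (l cover-q + l light-q) ≡ m) where

        core-size : l core + l heavy ≡ 2 + m + (a + b)
        core-size = +-cancelʳ-≡ (l cover-p + l light-p + (l cover-q + l light-q)) _ _
          (trans (arith (l core) (l cover-p) (l cover-q) (l light-p) (l light-q) (l heavy))
            (trans (sym (role-sum role)) (trans (trans N≡2+3m (arith′ m))
                (trans (cong₂ (λ x y → 2 + m + (x + y)) (sym ea) (sym eb))
              (arith″ m a b (l cover-p + l light-p) (l cover-q + l light-q))))))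
          where
          arith : ∀ k cp cq lp lq h → k + h + (cp + lp + (cq + lq)) ≡ k + (cp + (cq + (lp + (lq + h))))
          arith = solve-∀
          arith′ : ∀ m → 2 + 3 * m ≡ 2 + m + (m + m)
          arith′ = solve-∀
          arith″ : ∀ m a b x y → 2 + m + ((a + x) + (b + y)) ≡ 2 + m + (a + b) + (x + y)
          arith″ = solve-∀

        no-heavy : l heavy ≡ 0 → 2 ^ (m ∸ δ) ≤ monos
        no-heavy e = either⇒monos (Core.core δ (suc a + suc b) (Cover.base P {a} ea)
            (Cover.base Q {b} eb) p≢q two ≤-refl
          -- With `kp = a + 1`, `kq = b + 1` and `n` missing edges the size bound of `core` is an
          -- equality.
          (≤-reflexive (trans (arith a b m) (cong suc (sym size))))
          (≤-trans (≤-trans (n≤1+n n) (m≤m+n _ (a + b))) (≤-reflexive (sym size))))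
          where
          size : l core ≡ 2 + m + (a + b)
          size = trans (sym (+-identityʳ _)) (trans (cong (l core +_) (sym e)) core-size)
          arith : ∀ a b m → suc a + suc b + suc m ≡ suc (2 + m + (a + b))
          arith = solve-∀

        -- The core is one vertex smaller than in `no-heavy`, and `x` makes up for it: as a cover,
        -- if it sees `C` in one colour, and otherwise as the middle of a path y-x-y′, whose removal
        -- costs `C` two vertices instead of three. Having no alternative path costs one in the
        -- exponent.
        one-heavy : ∀ {x} → x ∈ˡ L heavy → l heavy ≡ 1 → 2 ^ (m ∸ 1 ∸ δ) ≤ monos
        one-heavy {x} x∈ e = go (filter (λ y → colour c x y ≟ p) C) refl
            (filter (λ y → colour c x y ≟ q) C) refl
          where
          size : l core ≡ 1 + m + (a + b)
          size = suc-injective (trans (+-comm 1 _) (trans (cong (l core +_) (sym e)) core-size))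
          x≢ : ∀ {y} → y ∈ˡ C → x ≢ y
          x≢ = apart (λ ()) x∈
          weaken : 2 ^ (m ∸ δ) ≤ monos → 2 ^ (m ∸ 1 ∸ δ) ≤ monos
          weaken = ≤-trans (^-monoʳ-≤ 2 (∸-monoˡ-≤ δ (m∸n≤m m 1)))
          room : n ≤ l core
          room = ≤-trans (m≤m+n n (a + b)) (≤-reflexive (sym size))
          go : ∀ ps → filter (λ y → colour c x y ≟ p) C ≡ ps → ∀ qs →
              filter (λ y → colour c x y ≟ q) C ≡ qs →
               2 ^ (m ∸ 1 ∸ δ) ≤ monos
          go [] no-p _ _ = weaken (either⇒monos
              (Core.core δ (suc a + b) (Cover.base P {a} ea) (Cover.adjoin Q {b} eb x∈ all-q)
            p≢q two ≤-refl (≤-reflexive (trans (arith a b m) (cong suc (sym size)))) room))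
            where
            arith : ∀ a b m → suc a + b + suc m ≡ suc (1 + m + (a + b))
            arith = solve-∀
            all-q : ∀ {y} → y ∈ˡ C → colour c x y ≡ q
            all-q y∈ with to-C y∈ (x≢ y∈)
            ... | inj₂ eq = eq
            ... | inj₁ eq = contradiction (subst (_ ∈ˡ_) no-p
                (∈-filter⁺ (λ y → colour c x y ≟ p) y∈ eq)) λ ()
          go (_ ∷ _) _ [] no-q = weaken (either⇒monos
              (Core.core δ (a + suc b) (Cover.adjoin P {a} ea x∈ all-p) (Cover.base Q {b} eb)
            p≢q two ≤-refl (≤-reflexive (trans (arith a b m) (cong suc (sym size)))) room))
            where
            arith : ∀ a b m → a + suc b + suc m ≡ suc (1 + m + (a + b))
            arith = solve-∀
            all-p : ∀ {y} → y ∈ˡ C → colour c x y ≡ p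
            all-p y∈ with to-C y∈ (x≢ y∈)
            ... | inj₁ eq = eq
            ... | inj₂ eq = contradiction (subst (_ ∈ˡ_) no-q
                (∈-filter⁺ (λ y → colour c x y ≟ q) y∈ eq)) λ ()
          go (y ∷ _) yes-p (y′ ∷ _) yes-q
            with ∈-filter⁻ (λ y → colour c x y ≟ p) {xs = C} (subst (y ∈ˡ_) (sym yes-p) (here refl))
               | ∈-filter⁻ (λ y → colour c x y ≟ q) {xs = C} (subst (y′ ∈ˡ_) (sym yes-q) (here refl))
          ... | y∈ , xy | y′∈ , xy′
            with extract (y ∷ y′ ∷ []) (((λ { refl → p≢q (trans (sym xy) xy′) }) ∷ []) ∷ [] ∷ [])
                (All.lookup (y∈ ∷ y′∈ ∷ []))
          ... | R , perm with a + b in ab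
          -- Now `a = b = 0`, so the edge `xy` leaves only covers to be matched. Removing `y′` as
          -- well would leave `m ∸ 1` vertices for up to `m` covers; only `y` is removed, and
          -- `τ = 1` fits exactly.
          ...   | zero = good⇒monos (Core.terminal δ {τ = 1} (Cover.join P [] ea′ x∈ perm xy) ≤-refl
                    (≤-reflexive (trans (sym (trans (cong (suc m +_) ab) (+-identityʳ n)))
                        (trans (sym size) (trans (↭-length perm) (+-comm 1 _))))))
            where
            ea′ : 0 + (l cover-p + l light-p) ≡ m
            ea′ = trans (cong (_+ _) (sym (m+n≡0⇒m≡0 a ab))) ea
          ...   | suc s = either⇒monos (Core.core δ (a + b) (Cover.join P {a} [ y′ ] ea x∈ perm xy)
                    (Cover.join Q {b} [ y ] eb x∈ (↭-trans perm (↭-swap y y′ ↭-refl)) xy′) p≢q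
                    (λ u∈ v∈ → two (∈-resp-↭ (↭-sym perm) (there (there u∈)))
                        (∈-resp-↭ (↭-sym perm) (there (there v∈))))
                    ≤-refl (≤-trans (≤-reflexive (cong (_+ m) ab))
                        (s≤s (≤-reflexive (trans (+-comm s m) (sym R-size)))))
                    (≤-trans (m≤m+n m s) (≤-reflexive (sym R-size))))
            where
            R-size : length R ≡ m + s
            R-size = suc-injective (suc-injective
                (trans (sym (↭-length perm)) (trans size
                (cong suc (trans (cong (m +_) ab) (+-suc m s))))))

    rainbow-vertex : ∀ {v ρ} → ρ ≡ light-p ⊎ ρ ≡ light-q ⊎ ρ ≡ heavy → v ∈ˡ L ρ → RainbowVertex c v
    rainbow-vertex (inj₁ refl)        v∈ = missing-nothing c (proj₁ (role-light-p (∈L v∈)))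
    rainbow-vertex (inj₂ (inj₁ refl)) v∈ = missing-nothing c (proj₁ (role-light-q (∈L v∈)))
    rainbow-vertex (inj₂ (inj₂ refl)) v∈ = missing-nothing c (proj₁ (role-heavy (∈L v∈)))

    degrees : ∀ v → 1 + 3 * m ≤ degree c zero v + (degree c (suc zero) v + degree c (suc (suc zero)) v)
    degrees v = s≤s⁻¹ (≤-trans (≤-reflexive (sym N≡2+3m)) (degree-sum c v))

    3m : 3 * m ∸ 1 + 2 ≡ 1 + 3 * m
    3m = trans (+-suc _ 1) (cong suc (m∸n+n≡m (≤-trans m≥1 (m≤m+n m _))))

    R : List V
    R = L light-p ++ L light-q ++ L heavy

    R-unique : Unique R
    R-unique = Uniqueₚ.++⁺ (with-role-unique role light-p)
      (Uniqueₚ.++⁺ (with-role-unique role light-q) (with-role-unique role heavy)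
        λ (x∈ , y∈) → disjoint-roles role {light-q} {heavy} (λ ()) ∈L ∈L (x∈ , y∈))
      λ (x∈ , y∈) → [ (λ z∈ → disjoint-roles role {light-p} {light-q} (λ ()) ∈L ∈L (x∈ , z∈))
                    , (λ z∈ → disjoint-roles role {light-p} {heavy} (λ ()) ∈L ∈L (x∈ , z∈)) ]′
                        (∈-++⁻ (L light-q) y∈)

    R-rainbow : ∀ {v} → v ∈ˡ R → RainbowVertex c v
    R-rainbow v∈ with ∈-++⁻ (L light-p) v∈
    ... | inj₁ v∈p = rainbow-vertex (inj₁ refl) v∈p
    ... | inj₂ v∈′ with ∈-++⁻ (L light-q) v∈′
    ...   | inj₁ v∈q = rainbow-vertex (inj₂ (inj₁ refl)) v∈q
    ...   | inj₂ v∈h = rainbow-vertex (inj₂ (inj₂ refl)) v∈h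

    R-cost : length R * (3 * m ∸ 1) ≤ rainbows
    R-cost = rainbow-stars c R-unique λ {v} v∈ → let r = R-rainbow v∈ in
      rainbow-cost (r zero) (r (suc zero)) (r (suc (suc zero))) (≤-trans (≤-reflexive 3m) (degrees v))

    R-length : length R ≡ l light-p + (l light-q + l heavy)
    R-length = trans (length-++ (L light-p)) (cong (l light-p +_) (length-++ (L light-q)))

    one-rainbow : 1 ≤ length R → 3 * m ∸ 1 ≤ rainbows
    one-rainbow h = ≤-trans (≤-reflexive (sym (*-identityˡ _)))
        (≤-trans (*-monoˡ-≤ (3 * m ∸ 1) h) R-cost)

    -- A heavy vertex sees all of `C` in the colours `p` and `q`, so its degrees in these two
    -- colours add up to at least `l core`.
    heavy-stars : ∀ {u} → u ≤ m → suc u ≤ l core → l heavy * (u * (2 * m)) ≤ rainbows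
    heavy-stars {u} u≤m u<C = rainbow-stars c (with-role-unique role heavy) λ {x} x∈ →
      let r = rainbow-vertex (inj₂ (inj₂ refl)) x∈ ; _ , dp , dq = role-heavy (∈L x∈) ; f = λ i → degree c i x in
      ≤-trans (heavy-cost u≤m (r o) (r p) (r q) dp dq
                (≤-trans (degrees x) (≤-reflexive (sym (addition f))))
                (≤-trans u<C (≤-trans (length-⊆ (with-role-unique role core) (seen x∈))
                    (≤-reflexive (length-++ (nbrs c p x))))))
              (≤-reflexive (product f))
      where
      seen : ∀ {x} → x ∈ˡ L heavy → ∀ {y} → y ∈ˡ C → y ∈ˡ nbrs c p x ++ nbrs c q x
      seen x∈ y∈ with to-C y∈ (apart (λ ()) x∈ y∈)
      ... | inj₁ e = ∈-++⁺ˡ (∈nbrs⁺ c e (apart (λ ()) y∈ x∈))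
      ... | inj₂ e = ∈-++⁺ʳ _ (∈nbrs⁺ c e (apart (λ ()) y∈ x∈))

    module _ (p≤o : l cover-p ≤ l core) (q≤o : l cover-q ≤ l core) where

      -- As `C` is the largest class, at most six of the 3m + 2 vertices are not rainbow.
      few-core : l core ≤ 2 → 1 ≤ length R → Outcome
      few-core C≤2 h = many₂ (one-rainbow h) (≤-trans (*-monoˡ-≤ (3 * m ∸ 1) R≥) R-cost)
        where
        regroup : ∀ a b d e → a + (b + (d + e)) ≡ (a + (b + d)) + e
        regroup = solve-∀
        R≥ : 3 * m ∸ 4 ≤ length R
        R≥ = m≤n+o⇒m∸n≤o (3 * m) 4 (s≤s⁻¹
            (s≤s⁻¹ (≤-trans (≤-reflexive (trans (sym N≡2+3m) (role-sum role)))
          (≤-trans (≤-reflexive (trans (cong (λ w → l core + (l cover-p + (l cover-q + w)))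
              (sym R-length))
                     (regroup (l core) (l cover-p) (l cover-q) (length R))))
            (+-monoˡ-≤ (length R) {_} {6} (+-mono-≤ C≤2
                (+-mono-≤ (≤-trans p≤o C≤2) (≤-trans q≤o C≤2))))))))

      -- From `(h ∸ 2) * (u ∸ 2) ≥ 0`: the product is least when one of the factors is 2.
      heavy-product : ∀ {h u} → 2 ≤ h → 2 ≤ u → 1 + m ≤ h + u → 2 * m ∸ 2 ≤ h * u
      heavy-product {suc (suc x)} {suc (suc y)} _ _ le = m≤n+o⇒m∸n≤o (2 * m) 2 (begin
        2 * m                         ≤⟨ *-monoʳ-≤ 2 (s≤s⁻¹ le) ⟩
        2 * (suc x + suc (suc y))     ≤⟨ m≤m+n _ (x * y) ⟩
        2 * (suc x + suc (suc y)) + x * y ≡⟨ arith x y ⟩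
        2 + suc (suc x) * suc (suc y) ∎)
        where
        open ≤-Reasoning
        arith : ∀ x y → 2 * (suc x + suc (suc y)) + x * y ≡ 2 + suc (suc x) * suc (suc y)
        arith = solve-∀
      heavy-product {suc zero} (s≤s ())
      heavy-product {_} {suc zero} _ (s≤s ())

      -- Take `u` to be the smaller of `l core ∸ 1` and `m`. Few heavy vertices mean a large core,
      -- so `l heavy * u` never falls below 2m - 2. Three core vertices are required for `u ≥ 2`.
      two-heavy : 2 ≤ l heavy → 2 + m ≤ l core + l heavy → Outcome
      two-heavy h≥2 size with 3 ≤? l core
      ... | no C<3 = few-core (s≤s⁻¹ (≰⇒> C<3)) one≤R
        where
        one≤R : 1 ≤ length R
        one≤R = ≤-trans (≤-trans (<⇒≤ h≥2) (≤-trans (m≤n+m _ (l light-q)) (m≤n+m _ (l light-p))))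
            (≤-reflexive (sym R-length))
      ... | yes C≥3 = many₁ (one-rainbow one≤R) (go (≤-total (suc m) (l core)))
        where
        one≤R : 1 ≤ length R
        one≤R = ≤-trans (≤-trans (<⇒≤ h≥2) (≤-trans (m≤n+m _ (l light-q)) (m≤n+m _ (l light-p))))
            (≤-reflexive (sym R-length))
        finish : ∀ {u} → u ≤ m → suc u ≤ l core → 2 * m ∸ 2 ≤ l heavy * u →
            (2 * m ∸ 2) * (2 * m) ≤ rainbows
        finish {u} u≤m u<C le = ≤-trans (*-monoˡ-≤ (2 * m) le)
          (≤-trans (≤-reflexive (*-assoc (l heavy) u (2 * m))) (heavy-stars u≤m u<C))
        below : ∀ k → 3 ≤ k → k ≤ suc m → k ≡ l core → (2 * m ∸ 2) * (2 * m) ≤ rainbows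
        below (suc u) (s≤s u≥2) (s≤s u≤m) e = finish u≤m (≤-reflexive e)
          (heavy-product h≥2 u≥2 (s≤s⁻¹ (≤-trans size
              (≤-reflexive (trans (cong (_+ l heavy) (sym e)) (cong suc (+-comm u _)))))))
        go : suc m ≤ l core ⊎ l core ≤ suc m → (2 * m ∸ 2) * (2 * m) ≤ rainbows
        go (inj₁ m<C) = finish ≤-refl m<C (≤-trans (m∸n≤m (2 * m) 2) (*-monoˡ-≤ m h≥2))
        go (inj₂ C≤m) = below (l core) C≥3 C≤m refl

      by-heavies : ∀ {δ} → l light-p ≡ 0 ⊎ 1 ≤ δ → l light-q ≡ 0 ⊎ 1 ≤ δ →
        (∀ {h} → l heavy ≡ h → 1 ≤ h → 2 ^ (m ∸ 1 ∸ δ) ≤ monos → Outcome) →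
            (2 ^ (m ∸ δ) ≤ monos → Outcome) → Outcome
      by-heavies fp fq one none with n ≤? l cover-p + l light-p | n ≤? l cover-q + l light-q
      ... | yes jp | _ = none (Cover.enough-covers (P fp fq) p≤o jp)
      ... | no _ | yes jq = none (Cover.enough-covers (Q fp fq) q≤o jq)
      ... | no jp | no jq with m≤n⇒∃[o]m+o≡n (s≤s⁻¹ (≰⇒> jp)) | m≤n⇒∃[o]m+o≡n (s≤s⁻¹ (≰⇒> jq))
      ... | a , ea | b , eb = go (L heavy) refl
        where
        ea′ = trans (+-comm a _) ea
        eb′ = trans (+-comm b _) eb
        go : ∀ hs → L heavy ≡ hs → Outcome
        go [] e = none (no-heavy fp fq {a} {b} ea′ eb′ (cong length e))
        go (x ∷ []) e = one (cong length e) ≤-refl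
          (one-heavy fp fq {a} {b} ea′ eb′ (subst (x ∈ˡ_) (sym e) (here refl)) (cong length e))
        go (_ ∷ _ ∷ _) e = two-heavy (≤-trans (s≤s (s≤s z≤n)) (≤-reflexive (cong length (sym e))))
          (≤-trans (m≤m+n _ (a + b)) (≤-reflexive (sym (core-size fp fq {a} {b} ea′ eb′))))

      arranged-outcome : Outcome
      arranged-outcome = go (length R) refl
        where
        go : ∀ r → length R ≡ r → Outcome
        -- Without rainbow vertices there are no light ones, so `δ = 0` and no factor of two is
        -- lost.
        go zero e = by-heavies {0} (inj₁ lp≡0) (inj₁ lq≡0)
            (λ eh h≥1 _ → contradiction (≤-trans h≥1 (≤-reflexive (trans (sym eh) lh≡0))) λ ()) local
          where
          all≡0 : l light-p + (l light-q + l heavy) ≡ 0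
          all≡0 = trans (sym R-length) e
          lp≡0 = m+n≡0⇒m≡0 (l light-p) all≡0
          lq≡0 = m+n≡0⇒m≡0 (l light-q) (m+n≡0⇒n≡0 (l light-p) all≡0)
          lh≡0 = m+n≡0⇒n≡0 (l light-q) (m+n≡0⇒n≡0 (l light-p) all≡0)
        go (suc r) e = by-heavies (inj₂ ≤-refl) (inj₂ ≤-refl) (λ _ _ → mixed S≥)
            (mixed S≥ ∘ ≤-trans (^-monoʳ-≤ 2 (∸-monoˡ-≤ 1 (m∸n≤m m 1))))
          where
          S≥ : 3 * m ∸ 1 ≤ rainbows
          S≥ = one-rainbow (≤-trans (s≤s z≤n) (≤-reflexive (sym e)))

  outcome : Outcome
  outcome with arrange (λ i → length (filter (λ v → Maybe-≡-dec _≟_ (missing c v) (just i)) (allFin N)))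
  ... | o , p , q , arr , p≤o , q≤o =
      arranged-outcome (compare q≤o role-cover-p) (compare p≤o role-cover-q)
    where
    open Arranged arr
    compare : ∀ {i ρ} → length (filter (λ v → Maybe-≡-dec _≟_ (missing c v) (just i)) (allFin N)) ≤
                        length (filter (λ v → Maybe-≡-dec _≟_ (missing c v) (just o)) (allFin N)) →
              (∀ {v} → role v ≡ ρ → missing c v ≡ just i) → l ρ ≤ l core
    compare le f = ≤-trans (length-⊆ (with-role-unique role _) λ v∈ →
        ∈-filter⁺ (λ v → Maybe-≡-dec _≟_ (missing c v) (just _)) (∈-allFin _) (f (∈L v∈)))
      (≤-trans le (length-⊆ (Uniqueₚ.filter⁺ (λ v → Maybe-≡-dec _≟_ (missing c v) (just o))
          (Uniqueₚ.allFin⁺ N)) λ {v} v∈ →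
        ∈-filter⁺ (λ v → role v ≟ core) (∈-allFin v)
          (role-core⁺ (proj₂ (∈-filter⁻ (λ v → Maybe-≡-dec _≟_ (missing c v) (just o))
              {xs = allFin N} v∈)))))

-- Edges of rainbow stars and of monochromatic matchings

module _ {k N : ℕ} (c : Colouring k N) where

  rainbow-leaves : HasRainbow c K₁,₃ →
    ∃[ v ] ∃[ x ] ∃[ y ] ∃[ z ] (colour c v x ≢ colour c v y × colour c v x ≢ colour c v z × colour
        c v y ≢ colour c v z)
  rainbow-leaves (S , S∈ , R) with ∈copies⁻ K₁,₃ S∈
  ... | f , inj , refl = f zero , f (suc zero) , f (suc (suc zero)) , f (suc (suc (suc zero))) ,
    apart (λ ()) , apart (λ ()) , apart (λ ())
    where
    apart : ∀ {i j} → i ≢ j → colour c (f zero) (f (suc i)) ≢ colour c (f zero) (f (suc j))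
    apart {i} {j} i≢j e with R _ _ _ _ (edge⁺ K₁,₃ f {zero} {suc i} (inj₁ (refl , λ ())))
                                       (edge⁺ K₁,₃ f {zero} {suc j} (inj₁ (refl , λ ()))) e
    ... | inj₁ (_ , e′) = i≢j (Fin-suc-injective (inj _ _ e′))
    ... | inj₂ (e′ , _) = contradiction (inj _ _ e′) λ ()

  monochromatic-pairs : ∀ n {f : Fin (n * 2) → Fin N} → Monochromatic c (image (n K₂) f) →
    ∀ i j → colour c (f (combine {n} {2} i zero)) (f (combine {n} {2} i (suc zero))) ≡ colour c
        (f (combine {n} {2} j zero)) (f (combine {n} {2} j (suc zero)))
  monochromatic-pairs n {f} M i j = M _ _ _ _ (edge⁺ (n K₂) f (pair i)) (edge⁺ (n K₂) f (pair j))
    where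
    pair : ∀ i → Graph.Adj (n K₂) (combine {n} {2} i zero) (combine {n} {2} i (suc zero))
    pair i = trans (cong proj₁ (remQuot-combine {n} {2} i zero))
        (sym (cong proj₁ (remQuot-combine {n} {2} i (suc zero))))
           , λ e → contradiction (proj₂ (combine-injective i zero i (suc zero) e)) λ ()

pair-edge⁻ : ∀ n {N} {f : Fin (n * 2) → Fin N} {x y} → EdgeOf (image (n K₂) f) x y →
  ∃[ i ] ((f (combine {n} {2} i zero) ≡ x × f (combine {n} {2} i (suc zero)) ≡ y)
      ⊎ (f (combine {n} {2} i zero) ≡ y × f (combine {n} {2} i (suc zero)) ≡ x))
pair-edge⁻ n {f = f} e with edge⁻ (n K₂) f e
... | u , v , (h , u≢v) , refl , refl =
    quotient 2 u , go (remainder {n} 2 u) refl (remainder {n} 2 v) refl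
  where
  at : ∀ w {b} → quotient {n} 2 u ≡ quotient 2 w → remainder {n} 2 w ≡ b →
      combine {n} {2} (quotient {n} 2 u) b ≡ w
  at w q refl = trans (cong (λ i → combine {n} {2} i (remainder {n} 2 w)) q) (combine-remQuot {n} 2 w)
  go : ∀ a → remainder {n} 2 u ≡ a → ∀ b → remainder {n} 2 v ≡ b →
    (f (combine {n} {2} (quotient {n} 2 u) zero) ≡ f u × f
        (combine {n} {2} (quotient {n} 2 u) (suc zero)) ≡ f v) ⊎
    (f (combine {n} {2} (quotient {n} 2 u) zero) ≡ f v × f
        (combine {n} {2} (quotient {n} 2 u) (suc zero)) ≡ f u)
  go zero a zero b = contradiction (trans (sym (at u refl a)) (at v h b)) u≢v
  go zero a (suc zero) b = inj₁ (cong f (at u refl a) , cong f (at v h b))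
  go (suc zero) a zero b = inj₂ (cong f (at v h b) , cong f (at u refl a))
  go (suc zero) a (suc zero) b = contradiction (trans (sym (at u refl a)) (at v h b)) u≢v

pair-edge⁺ : ∀ n {N} (f : Fin (n * 2) → Fin N) i →
  EdgeOf (image (n K₂) f) (f (combine {n} {2} i zero)) (f (combine {n} {2} i (suc zero))) ×
  EdgeOf (image (n K₂) f) (f (combine {n} {2} i (suc zero))) (f (combine {n} {2} i zero))
pair-edge⁺ n f i = edge⁺ (n K₂) f adj , edge⁺ (n K₂) f (Graph.symm (n K₂) adj)
  where
  adj : Graph.Adj (n K₂) (combine {n} {2} i zero) (combine {n} {2} i (suc zero))
  adj = trans (cong proj₁ (remQuot-combine {n} {2} i zero))
      (sym (cong proj₁ (remQuot-combine {n} {2} i (suc zero))))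
      , λ e → contradiction (proj₂ (combine-injective i zero i (suc zero) e)) λ ()

-- A perfect matching has no isolated vertex, so its edges determine it.
image-≡ : ∀ n {N} {f g : Fin (n * 2) → Fin N} →
  (∀ {x y} → EdgeOf (image (n K₂) f) x y → EdgeOf (image (n K₂) g) x y) →
  (∀ {x y} → EdgeOf (image (n K₂) g) x y → EdgeOf (image (n K₂) f) x y) →
  image (n K₂) f ≡ image (n K₂) g
image-≡ n {f = f} {g} fg gf = cong₂ _,_
  (tabulate-cong λ i → does-⇔ (mk⇔ (vertex fg) (vertex gf)) (vertex? (n K₂) f i) (vertex? (n K₂) g i))
  (tabulate-cong λ i → tabulate-cong λ j → does-⇔
    (mk⇔ (edge fg) (edge gf)) (edge? (n K₂) f i j) (edge? (n K₂) g i j))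
  where
  edge : ∀ {f g : Fin (n * 2) → Fin _} →
      (∀ {x y} → EdgeOf (image (n K₂) f) x y → EdgeOf (image (n K₂) g) x y) →
    ∀ {i j} → ∃[ u ] ∃[ v ] (Graph.Adj (n K₂) u v × f u ≡ i × f v ≡ j) →
        ∃[ u ] ∃[ v ] (Graph.Adj (n K₂) u v × g u ≡ i × g v ≡ j)
  edge {f} {g} fg (u , v , a , refl , refl) = edge⁻ (n K₂) g (fg (edge⁺ (n K₂) f {u} {v} a))
  partner : ∀ u → ∃[ v ] Graph.Adj (n K₂) u v
  partner u with remainder {n} 2 u in r
  ... | zero = combine {n} {2} (quotient {n} 2 u) (suc zero) ,
        sym (cong proj₁ (remQuot-combine {n} {2} (quotient 2 u) (suc zero))) ,
        λ e → contradiction (trans (sym r)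
            (trans (cong (remainder {n} 2) e)
            (cong proj₂ (remQuot-combine {n} {2} (quotient 2 u) (suc zero))))) λ ()
  ... | suc zero = combine {n} {2} (quotient {n} 2 u) zero ,
        sym (cong proj₁ (remQuot-combine {n} {2} (quotient 2 u) zero)) ,
        λ e → contradiction (trans (sym r)
            (trans (cong (remainder {n} 2) e)
            (cong proj₂ (remQuot-combine {n} {2} (quotient 2 u) zero)))) λ ()
  vertex : ∀ {f g : Fin (n * 2) → Fin _} →
      (∀ {x y} → EdgeOf (image (n K₂) f) x y → EdgeOf (image (n K₂) g) x y) →
    ∀ {i} → ∃[ u ] f u ≡ i → ∃[ u ] g u ≡ i
  vertex fg (u , refl) with partner u
  ... | v , a with edge fg (u , v , a , refl , refl)
  ...   | u′ , _ , _ , e , _ = u′ , e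

-- The extremal colouring

-- A perfect matching between A and C is a bijection, hence occurs as one of these sequences; their
-- number is the source of the bound n!.
arrangements : ∀ {n} k → List (Fin n) → List (Vec (Fin n) k)
arrangements zero    xs = [] ∷ []
arrangements (suc k) xs = concatMap (λ x → map (x ∷_) (arrangements k (filter (λ y → ¬? (y ≟ x)) xs))) xs

length-concatMap : ∀ {A B : Set} {f : A → List B} {b} xs → (∀ {x} → x ∈ˡ xs → length (f x) ≤ b) →
                   length (concatMap f xs) ≤ length xs * b
length-concatMap [] h = z≤n
length-concatMap {f = f} (x ∷ xs) h = ≤-trans (≤-reflexive (length-++ (f x)))
  (+-mono-≤ (h (here refl)) (length-concatMap xs (h ∘ there)))

length-arrangements : ∀ {n} k (xs : List (Fin n)) → length xs ≤ k → length (arrangements k xs) ≤ k !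
length-arrangements zero xs le = ≤-refl
length-arrangements (suc k) xs le = ≤-trans
  (length-concatMap xs λ {x} x∈ →
      ≤-trans (≤-reflexive (length-map (x ∷_) (arrangements k (filter (λ y → ¬? (y ≟ x)) xs))))
    (length-arrangements k (filter (λ y → ¬? (y ≟ x)) xs)
        (s≤s⁻¹ (≤-trans (filter-notAll (λ y → ¬? (y ≟ x)) xs (lose x∈ λ ne → ne refl)) le))))
  (*-monoˡ-≤ (k !) le)

∈arrangements : ∀ {n} k {xs : List (Fin n)} (σ : Fin k → Fin n) → (∀ {i j} → σ i ≡ σ j → i ≡ j) →
                (∀ i → σ i ∈ˡ xs) → tabulate σ ∈ˡ arrangements k xs
∈arrangements zero σ inj σ∈ = here refl
∈arrangements (suc k) {xs} σ inj σ∈ =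
  ∈-concatMap⁺ (λ x → map (x ∷_) (arrangements k (filter (λ y → ¬? (y ≟ x)) xs)))
    (lose (σ∈ zero) (∈-map⁺ (σ zero ∷_) (∈arrangements k (σ ∘ suc) (Fin-suc-injective ∘ inj)
      λ i → ∈-filter⁺ (λ y → ¬? (y ≟ σ zero)) (σ∈ (suc i)) λ e → contradiction (inj e) λ ())))

surjective : ∀ {n} {σ : Fin n → Fin n} → (∀ {i j} → σ i ≡ σ j → i ≡ j) → ∀ j → ∃[ i ] σ i ≡ j
surjective {n} {σ} inj j with any? (λ i → σ i ≟ j)
... | yes hit = hit
... | no miss = contradiction
  (≤-trans (≤-reflexive (sym (length-tabulate σ)))
    (length-⊆ {ys = filter (λ y → ¬? (y ≟ j)) (allFin n)} (Uniqueₚ.tabulate⁺ inj) λ x∈ →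
        ∈-filter⁺ (λ y → ¬? (y ≟ j)) (∈-allFin _) (λ e → miss (hits x∈ e))))
  (<⇒≱ (≤-trans (filter-notAll (λ y → ¬? (y ≟ j)) (allFin n) (lose (∈-allFin j) λ ne → ne refl))
               (≤-reflexive (length-tabulate (λ i → i)))))
  where
  hits : ∀ {x} → x ∈ˡ Data.List.tabulate σ → x ≡ j → ∃[ i ] σ i ≡ j
  hits x∈ refl with ∈-tabulate⁻ x∈
  ... | i , e = i , sym e

-- With s = n − 1 both configurations are avoided; s = n adds only the perfect
-- matchings between A and C.
module Construction (n m s : ℕ) where

  data Part : Set where
    𝔸 : Fin n → Part
    𝔹 : Fin m → Part
    ℂ : Fin s → Part

  part : Fin (n + (m + s)) → Part
  part v = [ 𝔸 , [ 𝔹 , ℂ ]′ ∘ splitAt m ]′ (splitAt n v)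

  inA : Fin n → Fin (n + (m + s))
  inA a = a ↑ˡ (m + s)
  inB : Fin m → Fin (n + (m + s))
  inB b = n ↑ʳ (b ↑ˡ s)
  inC : Fin s → Fin (n + (m + s))
  inC c = n ↑ʳ (m ↑ʳ c)

  part-A : ∀ a → part (inA a) ≡ 𝔸 a
  part-A a = cong [ 𝔸 , [ 𝔹 , ℂ ]′ ∘ splitAt m ]′ (splitAt-↑ˡ n a (m + s))
  part-B : ∀ b → part (inB b) ≡ 𝔹 b
  part-B b = trans (cong [ 𝔸 , [ 𝔹 , ℂ ]′ ∘ splitAt m ]′ (splitAt-↑ʳ n (m + s) (b ↑ˡ s)))
                   (cong [ 𝔹 , ℂ ]′ (splitAt-↑ˡ m b s))
  part-C : ∀ c → part (inC c) ≡ ℂ c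
  part-C c = trans (cong [ 𝔸 , [ 𝔹 , ℂ ]′ ∘ splitAt m ]′ (splitAt-↑ʳ n (m + s) (m ↑ʳ c)))
                   (cong [ 𝔹 , ℂ ]′ (splitAt-↑ʳ m s c))

  vertex : Part → Fin (n + (m + s))
  vertex (𝔸 a) = inA a
  vertex (𝔹 b) = inB b
  vertex (ℂ c) = inC c

  vertex-part : ∀ v → vertex (part v) ≡ v
  vertex-part v with splitAt n v in e
  ... | inj₁ a = splitAt⁻¹-↑ˡ e
  ... | inj₂ w with splitAt m w in e′
  ...   | inj₁ b = trans (cong (n ↑ʳ_) (splitAt⁻¹-↑ˡ e′)) (splitAt⁻¹-↑ʳ {m = n} e)
  ...   | inj₂ c = trans (cong (n ↑ʳ_) (splitAt⁻¹-↑ʳ {m = m} e′)) (splitAt⁻¹-↑ʳ {m = n} e)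

  -- The parts A, B, C miss the colours 2, 1, 0 respectively: the three classes of the lower bound,
  -- with no rainbow vertex.
  hue : Part → Part → Fin 3
  hue (𝔸 _) (ℂ _) = suc zero
  hue (ℂ _) (𝔸 _) = suc zero
  hue (𝔹 _) (ℂ _) = suc (suc zero)
  hue (ℂ _) (𝔹 _) = suc (suc zero)
  hue (ℂ _) (ℂ _) = suc (suc zero)
  hue (𝔸 _) (𝔸 _) = zero
  hue (𝔸 _) (𝔹 _) = zero
  hue (𝔹 _) (𝔸 _) = zero
  hue (𝔹 _) (𝔹 _) = zero

  hue-symm : ∀ x y → hue x y ≡ hue y x
  hue-symm (𝔸 _) (𝔸 _) = refl
  hue-symm (𝔸 _) (𝔹 _) = refl
  hue-symm (𝔸 _) (ℂ _) = refl
  hue-symm (𝔹 _) (𝔸 _) = refl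
  hue-symm (𝔹 _) (𝔹 _) = refl
  hue-symm (𝔹 _) (ℂ _) = refl
  hue-symm (ℂ _) (𝔸 _) = refl
  hue-symm (ℂ _) (𝔹 _) = refl
  hue-symm (ℂ _) (ℂ _) = refl

  parts : Colouring 3 (n + (m + s))
  parts = record { colour = λ u v → hue (part u) (part v) ; symm = λ u v → hue-symm (part u) (part v) }

  hue-two : ∀ x → ∃[ i ] ∃[ j ] (∀ y → hue x y ≡ i ⊎ hue x y ≡ j)
  hue-two (𝔸 _) = _ , _ , λ { (𝔸 _) → inj₁ refl ; (𝔹 _) → inj₁ refl ; (ℂ _) → inj₂ refl }
  hue-two (𝔹 _) = _ , _ , λ { (𝔸 _) → inj₁ refl ; (𝔹 _) → inj₁ refl ; (ℂ _) → inj₂ refl }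
  hue-two (ℂ _) = _ , _ , λ { (𝔸 _) → inj₁ refl ; (𝔹 _) → inj₂ refl ; (ℂ _) → inj₂ refl }

  no-rainbow : ¬ HasRainbow parts K₁,₃
  no-rainbow R with rainbow-leaves parts R
  ... | v , x , y , z , xy , xz , yz with hue-two (part v)
  ... | i , j , two with two (part x) | two (part y) | two (part z)
  ... | inj₁ a | inj₁ b | _      = xy (trans a (sym b))
  ... | inj₁ a | inj₂ _ | inj₁ b = xz (trans a (sym b))
  ... | inj₁ _ | inj₂ a | inj₂ b = yz (trans a (sym b))
  ... | inj₂ a | inj₂ b | _      = xy (trans a (sym b))
  ... | inj₂ a | inj₁ _ | inj₂ b = xz (trans a (sym b))
  ... | inj₂ _ | inj₁ a | inj₁ b = yz (trans a (sym b))

  private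
    AB : Fin (n + m) → Part
    AB w = [ 𝔸 , 𝔹 ]′ (splitAt n w)

    BC : Fin (m + s) → Part
    BC w = [ 𝔹 , ℂ ]′ (splitAt m w)

    hue₀ : ∀ x y → hue x y ≡ zero → ∃[ w ] AB w ≡ x
    hue₀ (𝔸 a) _ _ = a ↑ˡ m , cong [ 𝔸 , 𝔹 ]′ (splitAt-↑ˡ n a m)
    hue₀ (𝔹 b) _ _ = n ↑ʳ b , cong [ 𝔸 , 𝔹 ]′ (splitAt-↑ʳ n m b)
    hue₀ (ℂ _) (𝔸 _) ()
    hue₀ (ℂ _) (𝔹 _) ()
    hue₀ (ℂ _) (ℂ _) ()

    hue₁ : ∀ x y → hue x y ≡ suc zero → ∃[ a ] ∃[ c ] ((x ≡ 𝔸 a × y ≡ ℂ c) ⊎ (x ≡ ℂ c × y ≡ 𝔸 a))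
    hue₁ (𝔸 a) (ℂ c) _ = a , c , inj₁ (refl , refl)
    hue₁ (ℂ c) (𝔸 a) _ = a , c , inj₂ (refl , refl)
    hue₁ (𝔸 _) (𝔹 _) ()
    hue₁ (𝔹 _) (𝔹 _) ()
    hue₁ (ℂ _) (𝔹 _) ()

    hue₂ : ∀ x y → hue x y ≡ suc (suc zero) → ∃[ w ] BC w ≡ x
    hue₂ (𝔹 b) (ℂ _) _ = b ↑ˡ s , cong [ 𝔹 , ℂ ]′ (splitAt-↑ˡ m b s)
    hue₂ (ℂ c) _ _ = m ↑ʳ c , cong [ 𝔹 , ℂ ]′ (splitAt-↑ʳ m s c)

    fits : ∀ {a d} (D : Fin d → Part) {f : Fin a → Fin (n + (m + s))} → Injective f →
           (∀ u → ∃[ w ] D w ≡ part (f u)) → a ≤ d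
    fits D {f} inj h = injective⇒≤ {f = proj₁ ∘ h} λ {u} {v} e → inj u v
      (trans (sym (vertex-part (f u)))
          (trans (cong vertex (trans (sym (proj₂ (h u))) (trans (cong D e) (proj₂ (h v)))))
        (vertex-part (f v))))

  Cross : (Fin (n * 2) → Fin (n + (m + s))) → Fin n → Fin n → Fin s → Set
  Cross f i a c = (f (combine {n} {2} i zero) ≡ inA a × f (combine {n} {2} i (suc zero)) ≡ inC c) ⊎
                  (f (combine {n} {2} i zero) ≡ inC c × f (combine {n} {2} i (suc zero)) ≡ inA a)

  private
    cross-endpoints : ∀ {f i a c} → Cross f i a c →
        ∃[ x ] ∃[ y ] (f (combine {n} {2} i x) ≡ inA a × f (combine {n} {2} i y) ≡ inC c)
    cross-endpoints (inj₁ (e , e′)) = _ , _ , e , e′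
    cross-endpoints (inj₂ (e , e′)) = _ , _ , e′ , e

    inA-injective : ∀ {a a′} → inA a ≡ inA a′ → a ≡ a′
    inA-injective = ↑ˡ-injective (m + s) _ _

  module _ {f : Fin (n * 2) → Fin (n + (m + s))} (f-inj : Injective f) where

    cross-injectiveᴬ : ∀ {i j a c c′} → Cross f i a c → Cross f j a c′ → i ≡ j
    cross-injectiveᴬ {i} {j} X Y with cross-endpoints {f} X | cross-endpoints {f} Y
    ... | x , _ , e , _ | y , _ , e′ , _ =
        proj₁ (combine-injective i x j y (f-inj _ _ (trans e (sym e′))))

    cross-injectiveᶜ : ∀ {i j a a′ c} → Cross f i a c → Cross f j a′ c → i ≡ j
    cross-injectiveᶜ {i} {j} X Y with cross-endpoints {f} X | cross-endpoints {f} Y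
    ... | _ , x , _ , e | _ , y , _ , e′ =
        proj₁ (combine-injective i x j y (f-inj _ _ (trans e (sym e′))))

    -- In colours 0 and 2 the copy would not fit into A ∪ B or B ∪ C.
    crossing : m < n → s ≤ n → Monochromatic parts (image (n K₂) f) → ∀ i → ∃[ a ] ∃[ c ] Cross f i a c
    crossing m<n s≤n M i = go _ refl
      where
      pair-hue : ∀ j → hue (part (f (combine {n} {2} j zero)))
          (part (f (combine {n} {2} j (suc zero)))) ≡
                       hue (part (f (combine {n} {2} i zero))) (part (f (combine {n} {2} i (suc zero))))
      pair-hue j = monochromatic-pairs parts n M j i
      everywhere : ∀ {d} (D : Fin d → Part) κ → (∀ x y → hue x y ≡ κ → ∃[ w ] D w ≡ x) →
        hue (part (f (combine {n} {2} i zero))) (part (f (combine {n} {2} i (suc zero)))) ≡ κ →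
            ∀ u → ∃[ w ] D w ≡ part (f u)
      everywhere D κ h e u = subst (λ v → ∃[ w ] D w ≡ part (f v)) (combine-remQuot {n} 2 u)
          (at (remQuot 2 u))
        where
        at : ((j , b) : Fin n × Fin 2) → ∃[ w ] D w ≡ part (f (combine {n} {2} j b))
        at (j , zero) = h _ _ (trans (pair-hue j) e)
        at (j , suc zero) = h _ _ (trans (hue-symm _ (part (f (combine {n} {2} j zero))))
            (trans (pair-hue j) e))
      twice : n * 2 ≡ n + n
      twice = trans (*-comm n 2) (cong (n +_) (+-identityʳ n))
      go : ∀ κ → hue (part (f (combine {n} {2} i zero)))
          (part (f (combine {n} {2} i (suc zero)))) ≡ κ → ∃[ a ] ∃[ c ] Cross f i a c
      go zero e = contradiction (fits AB f-inj (everywhere AB zero hue₀ e))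
        (<⇒≱ (≤-trans (+-monoʳ-< n m<n) (≤-reflexive (sym twice))))
      go (suc (suc zero)) e = contradiction (fits BC f-inj (everywhere BC (suc (suc zero)) hue₂ e))
        (<⇒≱ (≤-trans (+-mono-<-≤ m<n s≤n) (≤-reflexive (sym twice))))
      go (suc zero) e with hue₁ (part (f (combine {n} {2} i zero)))
          (part (f (combine {n} {2} i (suc zero)))) e
      ... | a , c , inj₁ (p , q) = a , c , inj₁
          (trans (sym (vertex-part _)) (cong vertex p) , trans (sym (vertex-part _)) (cong vertex q))
      ... | a , c , inj₂ (p , q) = a , c , inj₂
          (trans (sym (vertex-part _)) (cong vertex p) , trans (sym (vertex-part _)) (cong vertex q))

  -- Each of the `n` edges of the matching would need its own vertex of C.
  no-monochromatic : m < n → s < n → ¬ HasMonochromatic parts (n K₂)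
  no-monochromatic m<n s<n (S , S∈ , M) with ∈copies⁻ (n K₂) S∈
  ... | f , inj , refl = <⇒≱ s<n (injective⇒≤ {f = λ i → proj₁ (proj₂ (X i))}
    λ {i} {j} e → cross-injectiveᶜ inj (proj₂ (proj₂ (X i)))
        (subst (Cross f j _) (sym e) (proj₂ (proj₂ (X j)))))
    where
    X = crossing inj m<n (<⇒≤ s<n) M

  exact : ∀ {a a′} → a ≢ a′ → Fin m → Fin s → Exact parts
  exact {a} {a′} a≢a′ b c zero = inA a , inA a′ , a≢a′ ∘ inA-injective , cong₂ hue (part-A a) (part-A a′)
  exact {a} {a′} a≢a′ b c (suc zero) = inA a , inC c ,
    (λ e → A≢C (trans (sym (part-A a)) (trans (cong part e) (part-C c)))) , cong₂ hue (part-A a)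
        (part-C c)
    where
    A≢C : ∀ {a c} → 𝔸 a ≢ ℂ c
    A≢C ()
  exact {a} {a′} a≢a′ b c (suc (suc zero)) = inB b , inC c ,
    (λ e → B≢C (trans (sym (part-B b)) (trans (cong part e) (part-C c)))) , cong₂ hue (part-B b)
        (part-C c)
    where
    B≢C : ∀ {b c} → 𝔹 b ≢ ℂ c
    B≢C ()

module Square (n m : ℕ) (m<n : m < n) where
  open Construction n m n

  bipartite : Vec (Fin n) n → Fin (n * 2) → Fin (n + (m + n))
  bipartite ys u = place (remQuot 2 u)
    where
    place : Fin n × Fin 2 → Fin (n + (m + n))
    place (a , zero)     = inA a
    place (a , suc zero) = inC (lookup ys a)

  private
    bipartite-A : ∀ ys a → bipartite ys (combine {n} {2} a zero) ≡ inA a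
    bipartite-A ys a rewrite remQuot-combine {n} {2} a zero = refl

    bipartite-C : ∀ ys a → bipartite ys (combine {n} {2} a (suc zero)) ≡ inC (lookup ys a)
    bipartite-C ys a rewrite remQuot-combine {n} {2} a (suc zero) = refl

  private
    Edge : (Fin (n * 2) → Fin (n + (m + n))) → Fin (n + (m + n)) → Fin (n + (m + n)) → Set
    Edge g = EdgeOf (image (n K₂) g)

    cross-edges : ∀ {f i a c} → Cross f i a c → Edge f (inA a) (inC c) × Edge f (inC c) (inA a)
    cross-edges {f} {i} (inj₁ (p , q)) =
        subst₂ (Edge f) p q (proj₁ (pair-edge⁺ n f i)) , subst₂ (Edge f) q p (proj₂ (pair-edge⁺ n f i))
    cross-edges {f} {i} (inj₂ (p , q)) =
        subst₂ (Edge f) q p (proj₂ (pair-edge⁺ n f i)) , subst₂ (Edge f) p q (proj₁ (pair-edge⁺ n f i))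

    edge-cross : ∀ {f x y} (g : Fin (n * 2) → Fin (n + (m + n))) {a : Fin n → Fin n}
        {c : Fin n → Fin n} →
      (∀ i → Cross f i (a i) (c i)) →
          (∀ i → Edge g (inA (a i)) (inC (c i)) × Edge g (inC (c i)) (inA (a i))) →
      ∃[ i ] ((f (combine {n} {2} i zero) ≡ x × f (combine {n} {2} i (suc zero)) ≡ y)
          ⊎ (f (combine {n} {2} i zero) ≡ y × f (combine {n} {2} i (suc zero)) ≡ x)) →
      Edge g x y
    edge-cross {f} {x} {y} g {a} {c} X E (i , pq) = go (X i) pq
      where
      go : Cross f i (a i) (c i) → (f (combine {n} {2} i zero) ≡ x × f
          (combine {n} {2} i (suc zero)) ≡ y)
          ⊎ (f (combine {n} {2} i zero) ≡ y × f (combine {n} {2} i (suc zero)) ≡ x) → Edge g x y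
      go (inj₁ (a , c)) (inj₁ (x , y)) =
          subst₂ (Edge g) (trans (sym a) x) (trans (sym c) y) (proj₁ (E i))
      go (inj₁ (a , c)) (inj₂ (y , x)) =
          subst₂ (Edge g) (trans (sym c) x) (trans (sym a) y) (proj₂ (E i))
      go (inj₂ (c , a)) (inj₁ (x , y)) =
          subst₂ (Edge g) (trans (sym c) x) (trans (sym a) y) (proj₂ (E i))
      go (inj₂ (c , a)) (inj₂ (y , x)) =
          subst₂ (Edge g) (trans (sym a) x) (trans (sym c) y) (proj₁ (E i))

  -- The edges of `f` come in any order and direction. Sending each to its end in A is a bijection
  -- `α`; sorting the edges along its inverse `β` turns the copy into the graph of a bijection `σ`
  -- from A to C.
  image-bipartite : ∀ {f} → Injective f → Monochromatic parts (image (n K₂) f) →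
    ∃[ σ ] ((∀ {i j} → σ i ≡ σ j → i ≡ j) × image (n K₂) f ≡ image (n K₂) (bipartite (tabulate σ)))
  image-bipartite {f} inj M = σ , σ-injective , image-≡ n
    (λ e → edge-cross {f} (bipartite ys) {α} {γ} (λ i → proj₂ (proj₂ (X i)))
        (λ i → subst (λ c → Edge (bipartite ys) (inA (α i)) (inC c) × Edge (bipartite ys) (inC c)
        (inA (α i))) (σα i) (cross-edges {bipartite ys} (Y (α i)))) (pair-edge⁻ n {f = f} e))
    (λ e → edge-cross {bipartite ys} f {λ a → a} {lookup ys} Y
        (λ a → subst₂ (λ a′ c → Edge f (inA a′) (inC c) × Edge f (inC c) (inA a′)) (αβ a)
        (sym (lookup∘tabulate σ a)) (cross-edges {f} (proj₂ (proj₂ (X (β a))))))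
        (pair-edge⁻ n {f = bipartite ys} e))
    where
    X : ∀ i → ∃[ a ] ∃[ c ] Cross f i a c
    X = crossing inj m<n ≤-refl M
    α γ : Fin n → Fin n
    α i = proj₁ (X i)
    γ i = proj₁ (proj₂ (X i))
    α-injective : ∀ {i j} → α i ≡ α j → i ≡ j
    α-injective {i} {j} e = cross-injectiveᴬ inj (proj₂ (proj₂ (X i)))
        (subst (λ a → Cross f j a (γ j)) (sym e) (proj₂ (proj₂ (X j))))
    γ-injective : ∀ {i j} → γ i ≡ γ j → i ≡ j
    γ-injective {i} {j} e = cross-injectiveᶜ inj (proj₂ (proj₂ (X i)))
        (subst (Cross f j (α j)) (sym e) (proj₂ (proj₂ (X j))))
    β : Fin n → Fin n
    β a = proj₁ (surjective {σ = α} α-injective a)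
    αβ : ∀ a → α (β a) ≡ a
    αβ a = proj₂ (surjective {σ = α} α-injective a)
    σ : Fin n → Fin n
    σ a = γ (β a)
    σ-injective : ∀ {i j} → σ i ≡ σ j → i ≡ j
    σ-injective {i} {j} e = trans (sym (αβ i)) (trans (cong α (γ-injective e)) (αβ j))
    ys : Vec (Fin n) n
    ys = tabulate σ
    σα : ∀ i → lookup ys (α i) ≡ γ i
    σα i = trans (lookup∘tabulate σ (α i)) (cong γ (α-injective (αβ (α i))))
    Y : ∀ a → Cross (bipartite ys) a a (lookup ys a)
    Y a = inj₁ (bipartite-A ys a , bipartite-C ys a)

  monochromatic-bipartite : ∀ {S} → S ∈ˡ copies (n K₂) (n + (m + n)) → Monochromatic parts S →
    S ∈ˡ map (image (n K₂) ∘ bipartite) (arrangements n (allFin n))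
  monochromatic-bipartite S∈ M =
    let f , inj , e = ∈copies⁻ (n K₂) S∈
        σ , σ-injective , e′ = image-bipartite inj (subst (Monochromatic parts) e M)
    in subst (_∈ˡ map (image (n K₂) ∘ bipartite) (arrangements n (allFin n))) (sym (trans e e′))
         (∈-map⁺ (image (n K₂) ∘ bipartite) (∈arrangements n σ σ-injective λ i → ∈-allFin _))

  total-parts : total parts K₁,₃ (n K₂) ≤ n !
  total-parts = ≤-trans (≤-reflexive (cong (λ l → length l + length monos) (filter-none (rainbow? parts)
      (All.tabulate λ {S} S∈ R → no-rainbow (S , S∈ , R)))))
    (≤-trans (length-⊆ (Uniqueₚ.filter⁺ (monochromatic? parts) (copies-unique (n K₂)))
        λ S∈ → let S∈copies , M = ∈-filter⁻ (monochromatic? parts) {xs = copies (n K₂) _} S∈ in monochromatic-bipartite S∈copies M)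
      (≤-trans (≤-reflexive (length-map _ (arrangements n (allFin n))))
               (length-arrangements n (allFin n) (≤-reflexive (length-tabulate (λ i → i))))))
    where
    monos : List (Subgraph (n + (m + n)))
    monos = filter (monochromatic? parts) (copies (n K₂) (n + (m + n)))

-- Numerical bounds

minUpTo-≤ : ∀ m f {r} → r ≤ m → minUpTo m f ≤ f r
minUpTo-≤ m f r≤m = min≤v⁺ (f 0) (map f (upTo (suc m)))
    (inj₂ (lose (∈-map⁺ f (∈-upTo⁺ (s≤s r≤m))) ≤-refl))

lowerBound-≤ : ∀ n r → r ≤ 4 * n ∸ 2 → lowerBound n ≤ (((4 * n ∸ 1) ∸ r) / 3) choose n + r * (4 * n ∸ 5)
lowerBound-≤ n r = minUpTo-≤ (4 * n ∸ 2) (λ r → (((4 * n ∸ 1) ∸ r) / 3) choose n + r * (4 * n ∸ 5))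

-- For small m the 3m − 1 stars at a single rainbow vertex already suffice.
record Suffices (m L : ℕ) : Set where
  field
    local : L ≤ 2 ^ m
    mixed : L ≤ 3 * m ∸ 1 + 2 ^ (m ∸ 1 ∸ 1)
    many₁ : L ≤ 3 * m ∸ 1 ⊎ L ≤ (2 * m ∸ 2) * (2 * m)
    many₂ : L ≤ 3 * m ∸ 1 ⊎ L ≤ (3 * m ∸ 4) * (3 * m ∸ 1)

private
  le : ∀ {a b} {t : True (a ≤? b)} → a ≤ b
  le {t = t} = toWitness t

  -- For m = 9 + j the left side is the term 151 + 52j + 4j² of `large-n` less the 3m - 1 stars at
  -- one vertex, and the right side is 2^(m-2): this is what `mixed` needs.
  exponential : ∀ j → 125 + 49 * j + 4 * (j * j) ≤ 2 ^ (7 + j)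
  exponential zero    = le
  exponential (suc j) = begin
    125 + 49 * suc j + 4 * (suc j * suc j)                                    ≤⟨ m≤m+n _
        (72 + 41 * j + 4 * (j * j)) ⟩
    125 + 49 * suc j + 4 * (suc j * suc j) + (72 + 41 * j + 4 * (j * j))      ≡⟨ arith j ⟩
    2 * (125 + 49 * j + 4 * (j * j))                                          ≤⟨ *-monoʳ-≤ 2
        (exponential j) ⟩
    2 ^ (8 + j)                                                               ∎
    where
    open ≤-Reasoning
    arith : ∀ j → 125 + 49 * suc j + 4 * (suc j * suc j) + (72 + 41 * j + 4 * (j * j)) ≡ 2 *
        (125 + 49 * j + 4 * (j * j))
    arith = solve-∀

  thirds : ∀ k → (2 + k * 3) / 3 ≡ k
  thirds k = trans (+-distrib-/-∣ʳ 2 {k * 3} {3} (divides-refl k)) (m*n/n≡m k 3)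

  -- The term r = n − 6, for n = 10 + j.
  large-n : ∀ j → lowerBound (10 + j) ≤ 151 + 52 * j + 4 * (j * j)
  large-n j = ≤-trans (lowerBound-≤ (10 + j) (4 + j) r≤) (≤-reflexive (begin
    (((4 * (10 + j) ∸ 1) ∸ (4 + j)) / 3) choose (10 + j) + (4 + j) * (4 * (10 + j) ∸ 5)
      ≡⟨ cong (λ k → (((k ∸ 1) ∸ (4 + j)) / 3) choose (10 + j) + (4 + j) * (k ∸ 5)) 4n ⟩
    ((35 + 4 * j ∸ j) / 3) choose (10 + j) + (4 + j) * (35 + 4 * j)
      ≡⟨ cong (λ k → (k / 3) choose (10 + j) + (4 + j) * (35 + 4 * j))
          (trans (cong (_∸ j) (split j)) (m+n∸m≡n j _)) ⟩
    ((2 + (11 + j) * 3) / 3) choose (10 + j) + (4 + j) * (35 + 4 * j)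
      ≡⟨ cong (λ k → k choose (10 + j) + (4 + j) * (35 + 4 * j)) (thirds (11 + j)) ⟩
    (11 + j) choose (10 + j) + (4 + j) * (35 + 4 * j)
      ≡⟨ cong (_+ (4 + j) * (35 + 4 * j))
          (trans (nCk≡nC[n∸k] (n≤1+n (10 + j)))
          (trans (cong ((11 + j) choose_) (m+n∸n≡m 1 (10 + j))) (nC1≡n (11 + j)))) ⟩
    11 + j + (4 + j) * (35 + 4 * j)
      ≡⟨ expand j ⟩
    151 + 52 * j + 4 * (j * j) ∎))
    where
    open ≡-Reasoning
    4n : 4 * (10 + j) ≡ 40 + 4 * j
    4n = *-distribˡ-+ 4 10 j
    split : ∀ j → 35 + 4 * j ≡ j + (2 + (11 + j) * 3)
    split = solve-∀
    expand : ∀ j → 11 + j + (4 + j) * (35 + 4 * j) ≡ 151 + 52 * j + 4 * (j * j)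
    expand = solve-∀
    r≤ : 4 + j ≤ 4 * (10 + j) ∸ 2
    r≤ = subst (λ k → 4 + j ≤ k ∸ 2) (sym 4n) (+-mono-≤ {4} {38} le (m≤m+n j _))

  -- From n = 10 on the term r = n - 6 serves, the least `r` at which the binomial coefficient has
  -- fallen to n + 1. For smaller `n` the terms at r = 0 or r = 1 are small enough.
  sufficient : ∀ m → 1 ≤ m → ∃[ L ] (lowerBound (suc m) ≤ L × Suffices m L)
  sufficient 1 _ = 1 , lowerBound-≤ 2 0 z≤n , record
      { local = le ; mixed = le ; many₁ = inj₁ le ; many₂ = inj₁ le }
  sufficient 2 _ = 1 , lowerBound-≤ 3 0 z≤n , record
      { local = le ; mixed = le ; many₁ = inj₁ le ; many₂ = inj₁ le }
  sufficient 3 _ = 5 , lowerBound-≤ 4 0 z≤n , record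
      { local = le ; mixed = le ; many₁ = inj₁ le ; many₂ = inj₁ le }
  sufficient 4 _ = 6 , lowerBound-≤ 5 0 z≤n , record
      { local = le ; mixed = le ; many₁ = inj₁ le ; many₂ = inj₁ le }
  sufficient 5 _ = 7 , lowerBound-≤ 6 0 z≤n , record
      { local = le ; mixed = le ; many₁ = inj₁ le ; many₂ = inj₁ le }
  -- For n = 7 the term r = 0 is 36, more than the 17 + 16 available in `mixed`; r = 1 gives 8 + 23.
  sufficient 6 _ = 31 , lowerBound-≤ 7 1 le , record
      { local = le ; mixed = le ; many₁ = inj₂ le ; many₂ = inj₂ le }
  sufficient 7 _ = 45 , lowerBound-≤ 8 0 z≤n , record
      { local = le ; mixed = le ; many₁ = inj₂ le ; many₂ = inj₂ le }
  sufficient 8 _ = 55 , lowerBound-≤ 9 0 z≤n , record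
      { local = le ; mixed = le ; many₁ = inj₂ le ; many₂ = inj₂ le }
  sufficient (suc (suc (suc (suc (suc (suc (suc (suc (suc j))))))))) _ = _ , large-n j , record
    { local = begin
        151 + 52 * j + 4 * (j * j)                      ≤⟨ m≤m+n _ (349 + 144 * j + 12 * (j * j)) ⟩
        151 + 52 * j + 4 * (j * j) + (349 + 144 * j + 12 * (j * j)) ≡⟨ arith₁ j ⟩
        2 * (2 * (125 + 49 * j + 4 * (j * j)))          ≤⟨ *-monoʳ-≤ 2 (*-monoʳ-≤ 2 (exponential j)) ⟩
        2 ^ (9 + j)                                     ∎
    ; mixed = begin
        151 + 52 * j + 4 * (j * j)                      ≡⟨ arith₂ j ⟩
        26 + 3 * j + (125 + 49 * j + 4 * (j * j))       ≤⟨ +-monoʳ-≤ (26 + 3 * j) (exponential j) ⟩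
        26 + 3 * j + 2 ^ (7 + j)                        ≡⟨ cong (λ k → k ∸ 1 + 2 ^ (7 + j))
            (sym (*-distribˡ-+ 3 9 j)) ⟩
        3 * (9 + j) ∸ 1 + 2 ^ (7 + j)                   ∎
    ; many₁ = inj₂ (begin
        151 + 52 * j + 4 * (j * j)                      ≤⟨ m≤m+n _ (137 + 16 * j) ⟩
        151 + 52 * j + 4 * (j * j) + (137 + 16 * j)     ≡⟨ arith₃ j ⟩
        (16 + 2 * j) * (18 + 2 * j)                     ≡⟨ cong (λ k → (k ∸ 2) * k)
            (sym (*-distribˡ-+ 2 9 j)) ⟩
        (2 * (9 + j) ∸ 2) * (2 * (9 + j))               ∎)
    ; many₂ = inj₂ (begin
        151 + 52 * j + 4 * (j * j)                      ≤⟨ m≤m+n _ (447 + 95 * j + 5 * (j * j)) ⟩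
        151 + 52 * j + 4 * (j * j) + (447 + 95 * j + 5 * (j * j)) ≡⟨ arith₄ j ⟩
        (23 + 3 * j) * (26 + 3 * j)                     ≡⟨ cong (λ k → (k ∸ 4) * (k ∸ 1))
            (sym (*-distribˡ-+ 3 9 j)) ⟩
        (3 * (9 + j) ∸ 4) * (3 * (9 + j) ∸ 1)           ∎)
    }
    where
    open ≤-Reasoning
    arith₁ : ∀ j → 151 + 52 * j + 4 * (j * j) + (349 + 144 * j + 12 * (j * j)) ≡ 2 *
        (2 * (125 + 49 * j + 4 * (j * j)))
    arith₁ = solve-∀
    arith₂ : ∀ j → 151 + 52 * j + 4 * (j * j) ≡ 26 + 3 * j + (125 + 49 * j + 4 * (j * j))
    arith₂ = solve-∀
    arith₃ : ∀ j → 151 + 52 * j + 4 * (j * j) + (137 + 16 * j) ≡ (16 + 2 * j) * (18 + 2 * j)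
    arith₃ = solve-∀
    arith₄ : ∀ j → 151 + 52 * j + 4 * (j * j) + (447 + 95 * j + 5 * (j * j)) ≡ (23 + 3 * j) *
        (26 + 3 * j)
    arith₄ = solve-∀

-- Colourings of the complete graph on 3n - 1 vertices

module Bounds {m N : ℕ} (m≥1 : 1 ≤ m) (N≡ : N ≡ 2 + 3 * m) (c : Colouring 3 N) where
  open LowerBound m m≥1 N≡ c

  lowerBound≤total : lowerBound (suc m) ≤ total c K₁,₃ (suc m K₂)
  lowerBound≤total = let L , bound , suffices = sufficient m m≥1 in ≤-trans bound (go suffices outcome)
    where
    either : ∀ {L a b} → L ≤ a ⊎ L ≤ b → a ≤ rainbows → b ≤ rainbows → L ≤ rainbows + monos
    either (inj₁ L≤a) a≤ _ = ≤-trans L≤a (≤-trans a≤ (m≤m+n _ _))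
    either (inj₂ L≤b) _ b≤ = ≤-trans L≤b (≤-trans b≤ (m≤m+n _ _))
    go : ∀ {L} → Suffices m L → Outcome → L ≤ rainbows + monos
    go s (local h)    = ≤-trans (Suffices.local s) (≤-trans h (m≤n+m _ _))
    go s (mixed h h′) = ≤-trans (Suffices.mixed s) (+-mono-≤ h h′)
    go s (many₁ h h′) = either (Suffices.many₁ s) h h′
    go s (many₂ h h′) = either (Suffices.many₂ s) h h′

  private
    nonempty : ∀ {G : Graph} {P : Subgraph N → Set} (P? : Decidable P) →
               1 ≤ length (filter P? (copies G N)) → ∃[ S ] (S ∈ˡ copies G N × P S)
    nonempty {G} P? h = go (filter P? (copies G N)) refl h
      where
      go : ∀ xs → filter P? (copies G N) ≡ xs → 1 ≤ length xs → ∃[ S ] (S ∈ˡ copies G N × _)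
      go (S ∷ _) e _ = S , ∈-filter⁻ P? {xs = copies G N} (subst (S ∈ˡ_) (sym e) (here refl))

  some-copy : HasRainbow c K₁,₃ ⊎ HasMonochromatic c (suc m K₂)
  some-copy = go outcome
    where
    rainbow : 3 * m ∸ 1 ≤ rainbows → HasRainbow c K₁,₃
    rainbow h = nonempty {K₁,₃} (rainbow? c) (≤-trans (∸-monoˡ-≤ 1 (≤-trans {2} le (*-monoʳ-≤ 3 m≥1))) h)
    go : Outcome → HasRainbow c K₁,₃ ⊎ HasMonochromatic c (suc m K₂)
    go (local h)   = inj₂ (nonempty {suc m K₂} (monochromatic? c) (≤-trans (m^n>0 2 m) h))
    go (mixed h _) = inj₁ (rainbow h)
    go (many₁ h _) = inj₁ (rainbow h)
    go (many₂ h _) = inj₁ (rainbow h)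

-- Passing to a subset of the vertices

module _ {k M N : ℕ} {ι : Fin M → Fin N} (ι-injective : Injective ι) (c : Colouring k N) where

  restrict : Colouring k M
  restrict = record { colour = λ i j → colour c (ι i) (ι j) ; symm = λ i j →
      Colouring.symm c (ι i) (ι j) }

  rainbow-extend : ∀ G → HasRainbow restrict G → HasRainbow c G
  rainbow-extend G (S , S∈ , R) with ∈copies⁻ G S∈
  ... | f , inj , refl = image G (ι ∘ f) , ∈copies⁺ G (λ u v e → inj u v (ι-injective _ _ e)) , rainbow
    where
    rainbow : Rainbow c (image G (ι ∘ f))
    rainbow i j i′ j′ e e′ eq with edge⁻ G (ι ∘ f) e | edge⁻ G (ι ∘ f) e′
    ... | u , v , a , refl , refl | u′ , v′ , a′ , refl , refl with R _ _ _ _ (edge⁺ G f a)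
        (edge⁺ G f a′) eq
    ...   | inj₁ (p , q) = inj₁ (cong ι p , cong ι q)
    ...   | inj₂ (p , q) = inj₂ (cong ι p , cong ι q)

  monochromatic-extend : ∀ G → HasMonochromatic restrict G → HasMonochromatic c G
  monochromatic-extend G (S , S∈ , R) with ∈copies⁻ G S∈
  ... | f , inj , refl = image G (ι ∘ f) , ∈copies⁺ G (λ u v e → inj u v (ι-injective _ _ e)) ,
      monochromatic
    where
    monochromatic : Monochromatic c (image G (ι ∘ f))
    monochromatic i j i′ j′ e e′ with edge⁻ G (ι ∘ f) e | edge⁻ G (ι ∘ f) e′
    ... | u , v , a , refl , refl | u′ , v′ , a′ , refl , refl = R _ _ _ _ (edge⁺ G f a) (edge⁺ G f a′)

-- The minimum is attained

least : ∀ {P : ℕ → Set} → Decidable P → ∀ {t} → P t → ∃[ v ] (IsLeast P v × v ≤ t)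
least {P} P? {t} pt with below t
  where
  below : ∀ b → (∃[ v ] (IsLeast P v × v < b)) ⊎ (∀ {v} → v < b → ¬ P v)
  below zero = inj₂ λ ()
  below (suc b) with below b
  ... | inj₁ (v , l , v<b) = inj₁ (v , l , m<n⇒m<1+n v<b)
  ... | inj₂ none with P? b
  ...   | yes pb = inj₁ (b , (pb , λ v pv → ≮⇒≥ λ v<b → none v<b pv) , ≤-refl)
  ...   | no ¬pb = inj₂ λ {v} v<1+b pv → case m≤n⇒m<n∨m≡n (s≤s⁻¹ v<1+b) of λ
          { (inj₁ v<b) → none v<b pv ; (inj₂ refl) → ¬pb pv }
... | inj₁ (v , l , v<t) = v , l , <⇒≤ v<t
... | inj₂ none = t , (pt , λ v pv → ≮⇒≥ λ v<t → none v<t pv) , ≤-refl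

module _ {k N : ℕ} where

  -- The search for the minimum runs over encoded colourings, and decoding returns a colouring only
  -- up to this relation.
  _≈_ : Colouring k N → Colouring k N → Set
  c ≈ d = ∀ i j → colour c i j ≡ colour d i j

  ≈-sym : ∀ {c d} → c ≈ d → d ≈ c
  ≈-sym e i j = sym (e i j)

  exact-resp : ∀ {c d} → c ≈ d → Exact c → Exact d
  exact-resp e ex a = let i , j , i≢j , eq = ex a in i , j , i≢j , trans (sym (e i j)) eq

  rainbow-resp : ∀ {c d} → c ≈ d → ∀ {S} → Rainbow c S → Rainbow d S
  rainbow-resp e R i j i′ j′ x y eq = R i j i′ j′ x y (trans (e i j) (trans eq (sym (e i′ j′))))

  monochromatic-resp : ∀ {c d} → c ≈ d → ∀ {S} → Monochromatic c S → Monochromatic d S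
  monochromatic-resp e R i j i′ j′ x y = trans (sym (e i j)) (trans (R i j i′ j′ x y) (e i′ j′))

  total-resp : ∀ {c d} → c ≈ d → ∀ G H → total c G H ≡ total d G H
  total-resp {c} {d} e G H = cong₂ (λ xs ys → length xs + length ys)
    (filter-≐ (rainbow? c) (rainbow? d)
      ((λ {S} → rainbow-resp {c} {d} e {S}) , (λ {S} → rainbow-resp {d} {c} (≈-sym {c} {d} e) {S}))
          (copies G N))
    (filter-≐ (monochromatic? c) (monochromatic? d)
      ((λ {S} → monochromatic-resp {c} {d} e {S}) ,
          (λ {S} → monochromatic-resp {d} {c} (≈-sym {c} {d} e) {S})) (copies H N))

  exact? : (c : Colouring k N) → Dec (Exact c)
  exact? c = all? λ a → any? λ i → any? λ j → ¬? (i ≟ j) ×-dec (colour c i j ≟ a)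

module _ {k N : ℕ} where

  private
    agree : Fin (suc k) → Fin (suc k) → Fin (suc k)
    agree a b with a ≟ b
    ... | yes _ = a
    ... | no  _ = zero

    agree-comm : ∀ a b → agree a b ≡ agree b a
    agree-comm a b with a ≟ b | b ≟ a
    ... | yes refl | yes _ = refl
    ... | yes refl | no ne = contradiction refl ne
    ... | no ne | yes refl = contradiction refl ne
    ... | no _ | no _ = refl

    agree-refl : ∀ a → agree a a ≡ a
    agree-refl a with a ≟ a
    ... | yes _ = refl
    ... | no ne = contradiction refl ne

    -- Every number encodes a colouring: disagreeing values for the two orders
    -- of a pair are replaced by zero.
    decode : Fin (suc k ^ (N * N)) → Colouring (suc k) N
    decode e = record
      { colour = λ i j → agree (finToFun e (combine i j)) (finToFun e (combine j i))
      ; symm   = λ i j → agree-comm (finToFun e (combine i j)) (finToFun e (combine j i)) }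

    encode : Colouring (suc k) N → Fin (suc k ^ (N * N))
    encode c = funToFin λ x → let i , j = remQuot {N} N x in colour c i j

    decode-encode : ∀ c i j → colour c i j ≡ colour (decode (encode c)) i j
    decode-encode c i j = sym (trans
        (cong₂ agree (value i j) (trans (value j i) (Colouring.symm c j i))) (agree-refl _))
      where
      value : ∀ i j → finToFun (encode c) (combine i j) ≡ colour c i j
      value i j = trans (finToFun-funToFin {N * N} (λ x → let i , j = remQuot {N} N x in colour c i j) (combine i j))
        (cong (λ (i , j) → colour c i j) (remQuot-combine {N} {N} i j))

  attained? : ∀ G H → Decidable (λ t → ∃[ c ] (Exact {suc k} {N} c × total c G H ≡ t))
  attained? G H t = map′ (λ (e , p) → decode e , p)
    (λ (c , ex , eq) → encode c , exact-resp {c = c} {decode (encode c)} (decode-encode c) ex ,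
       trans (sym (total-resp {c = c} {decode (encode c)} (decode-encode c) G H)) eq)
    (any? λ e → exact? (decode e) ×-dec (total (decode e) G H ≟ⁿ t))

-- The Gallai-Ramsey number and the conclusion

!≤!! : ∀ m → suc m ! ≤ suc (m * 2) !!
!≤!! zero    = ≤-refl
-- Factor by factor, `k + 1 ≤ 2 * k + 1`.
!≤!! (suc m) = *-mono-≤ {suc (suc m)} {suc (suc (suc (m * 2)))}
    (s≤s (s≤s (≤-trans (m≤m*n m 2) (n≤1+n _)))) (!≤!! m)

-- Pascal's rule bounds `suc M choose 2` from below by `M choose 1`.
three-edges : ∀ {M} → 3 ≤ M → suc M choose 2 ≥ 3
three-edges {M} h = ≤-trans h (≤-trans (≤-reflexive (sym (nC1≡n M)))
  (≤-trans (m≤m+n (M choose 1) (M choose 2)) (≤-reflexive (nCk+nC[k+1]≡[n+1]C[k+1] M 1))))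

-- m and n = m + 1 stay variables, so that the order of the graph does not unfold.
module Conclusion {n m : ℕ} (n≡1+m : n ≡ suc m) (m≥1 : 1 ≤ m) {a a′ : Fin n} (a≢a′ : a ≢ a′)
    (b : Fin m) where

  gr : ℕ
  gr = n + (m + n)

  gr≡2+3m : gr ≡ 2 + 3 * m
  gr≡2+3m = trans (cong (λ n → n + (m + n)) n≡1+m) (arith m)
    where
    arith : ∀ m → suc m + (m + suc m) ≡ 2 + 3 * m
    arith = solve-∀

  m<n : m < n
  m<n = ≤-reflexive (sym n≡1+m)

  module Large = Construction n m n
  module Small = Construction n m m

  Attained : ℕ → Set
  Attained t = ∃[ c ] (Exact {3} {gr} c × total c K₁,₃ (n K₂) ≡ t)

  lower : ∀ {t} → Attained t → lowerBound n ≤ t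
  lower (c , _ , eq) = ≤-trans (subst (λ n → lowerBound n ≤ total c K₁,₃ (n K₂)) (sym n≡1+m)
    (Bounds.lowerBound≤total m≥1 gr≡2+3m c)) (≤-reflexive eq)

  upper : total Large.parts K₁,₃ (n K₂) ≤ (2 * n ∸ 1) !!
  upper = ≤-trans (Square.total-parts n m m<n)
    (subst (λ n → n ! ≤ (2 * n ∸ 1) !!) (sym n≡1+m)
      (≤-trans (!≤!! m) (≤-reflexive (cong (λ k → (k ∸ 1) !!) (*-comm (suc m) 2)))))

  unavoidable : ∀ M → M ≥ gr → (c : Colouring 3 M) → Exact c →
      HasRainbow c K₁,₃ ⊎ HasMonochromatic c (n K₂)
  unavoidable M M≥gr c _ = go (subst (λ n → HasRainbow c′ K₁,₃ ⊎ HasMonochromatic c′ (n K₂)) (sym n≡1+m)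
      (Bounds.some-copy m≥1 gr≡2+3m c′))
    where
    ι-injective : Injective (λ i → inject≤ i M≥gr)
    ι-injective = inject≤-injective M≥gr M≥gr
    c′ : Colouring 3 gr
    c′ = restrict ι-injective c
    go : HasRainbow c′ K₁,₃ ⊎ HasMonochromatic c′ (n K₂) → HasRainbow c K₁,₃ ⊎ HasMonochromatic c (n K₂)
    go (inj₁ R) = inj₁ (rainbow-extend ι-injective c K₁,₃ R)
    go (inj₂ M) = inj₂ (monochromatic-extend ι-injective c (n K₂) M)

  avoidable : ∀ {m′} → m′ < gr → ¬
      (∀ M → M ≥ m′ → (c : Colouring 3 M) → Exact c → HasRainbow c K₁,₃ ⊎ HasMonochromatic c (n K₂))
  avoidable m′<gr all = go (all (n + (m + m)) (s≤s⁻¹ (≤-trans m′<gr (≤-reflexive size))) Small.parts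
      (Small.exact a≢a′ b b))
    where
    size : gr ≡ suc (n + (m + m))
    size = trans (cong (λ k → n + (m + k)) n≡1+m) (trans (cong (n +_) (+-suc m m)) (+-suc n (m + m)))
    go : ¬ (HasRainbow Small.parts K₁,₃ ⊎ HasMonochromatic Small.parts (n K₂))
    go (inj₁ R) = Small.no-rainbow R
    go (inj₂ M) = Small.no-monochromatic m<n m<n M

  gallai-ramsey : IsGR 3 K₁,₃ (n K₂) gr
  gallai-ramsey =
    (subst (λ N → N choose 2 ≥ 3) (sym gr≡2+3m)
        (three-edges (s≤s (≤-trans {2} le (*-monoʳ-≤ 3 m≥1)))) , unavoidable) ,
    λ m′ (_ , all) → ≮⇒≥ λ m′<gr → avoidable m′<gr all

  conclusion : ∃[ v ] (IsGM 3 K₁,₃ (n K₂) v × lowerBound n ≤ v × v ≤ (2 * n ∸ 1) !!)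
  -- The extremal colouring does two things: it shows that some total is attained, and it bounds the
  -- least one from above.
  conclusion = let v , v-least , v≤ = least (attained? K₁,₃ (n K₂)) {total Large.parts K₁,₃ (n K₂)} (Large.parts , Large.exact a≢a′ b a , refl) in
    v , (gr , gallai-ramsey , v-least) , lower (proj₁ v-least) , ≤-trans v≤ upper

theorem3p7 : ∀ (n : ℕ) → n ≥ 2 →
    ∃[ v ] (IsGM 3 K₁,₃ (n K₂) v × lowerBound n ≤ v × v ≤ (2 * n ∸ 1) !!)
theorem3p7 1 (s≤s ())
theorem3p7 (suc (suc k)) _ = Conclusion.conclusion {suc (suc k)} {suc k} refl (s≤s z≤n) {zero}
    {suc zero} (λ ()) zero
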